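{- Let $k\ge 1$ be an integer and $G$ a graph. Every $k$-strategy $\Sigma$ defines a canonical tree-decomposition $(T,\mathcal{V})$ of $G$, of adhesion $<k$, that distinguishes all the $k$-blocks and tangles of order $k$ of $G$. That is: with $\mathcal{P}$ the set of all $k$-profiles in $G$, the tree-decomposition $(T,\mathcal{V})$ defined by $\Sigma$ on $G$ (the one inducing the set $N_\Sigma(G,\mathcal{P})$) has adhesion $<k$; whenever $P\neq P'$ are distinct $k$-profiles in $G$ each of which is either the $k$-profile $P_k(b)$ of a $k$-block $b$ of $G$ or a tangle of order $k$ in $G$, some separation induced by $(T,\mathcal{V})$ distinguishes $P$ from $P'$ (in particular, any two distinct $k$-blocks are distinguished); and for each fixed $\Sigma$ the map $G\mapsto (T,\mathcal{V})$ commutes with all graph isomorphisms $G\to G'$. In particular, such a decomposition exists for every $k$ and $G$.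
   Context: **Separations.** All graphs are finite, undirected and simple; $G$ has vertex set $V$. A separation of $G$ is a pair $(A,B)$ with $A,B\subseteq V$, $A\cup B=V$, such that $G$ has no edge between $A\setminus B$ and $B\setminus A$. Its order is $|A\cap B|$, its inverse is $(B,A)$; it is proper if neither $A\subseteq B$ nor $B\subseteq A$. A $(<k)$-separation is one of order $<k$; a $k$-separation is one of order exactly $k$. Write $(A,B)\le(C,D)$ if $A\subseteq C$ and $B\supseteq D$. Two separations $(A,B),(C,D)$ are nested if $(A,B)$ is $\le$-comparable with $(C,D)$ or with $(D,C)$; otherwise they cross. A separation is nested with a set $S$ of separations if it is nested with every element of $S$. A set of separations is nested if every two of its elements are nested. A separation system is a set of separations closed under taking inverses; it is proper if all its elements are proper. A set of separations is antisymmetric if it contains no separation together with its inverse. **Profiles.** A set $P$ of separations is consistent if whenever $(A,B)\in P$ and $(C,D)\le(A,B)$ is a separation, then $(D,C)\notin P$. A profile is a consistent set $P$ of separations such that for all $(A,B),(C,D)\in P$ we have $(B\cap D,A\cup C)\notin P$. A $k$-profile is a profile $P$ all of whose elements have order $<k$ and which contains, for every separation $(A,B)$ of order $<k$, exactly one of $(A,B),(B,A)$. An antisymmetric set $P$ of separations orients a set $S$ of separations if for every $(A,B)\in S$ either $(A,B)\in P$ or $(B,A)\in P\cap S$; then $P\cap S$ is an orientation of $S$. A separation $(A,B)$ distinguishes two sets $P,P'$ of separations if $(A,B)\in P\setminus P'$ and $(B,A)\in P'\setminus P$, or vice versa. A set $S$ of separations distinguishes a set $\mathcal{P}$ of sets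 of separations if every two distinct elements of $\mathcal{P}$ are distinguished by some element of $S$. A separation $(A,B)$ splits a consistent set $O$ if both $O\cup\{(A,B)\}$ and $O\cup\{(B,A)\}$ are consistent. **Blocks and tangles.** A $k$-block of $G$ is a maximal set $b\subseteq V$ with $|b|\ge k$ such that for every separation $(A,B)$ of order $<k$ we have $b\subseteq A$ or $b\subseteq B$. Its $k$-profile is $P_k(b)=\{(A,B): |A\cap B|<k,\ b\subseteq B\}$. A tangle of order $k$ in $G$ is a set $\theta$ of separations of order $<k$ containing exactly one of $(A,B),(B,A)$ for every separation $(A,B)$ of order $<k$, such that $G[A_1]\cup G[A_2]\cup G[A_3]\neq G$ for all (not necessarily distinct) $(A_1,B_1),(A_2,B_2),(A_3,B_3)\in\theta$. Tangles of order $k$, like the sets $P_k(b)$, are $k$-profiles. **Tasks.** A task is a pair $(S,\mathcal{P})$ of a proper separation system $S$ and a set $\mathcal{P}$ of profiles in $G$ such that every $P\in\mathcal{P}$ orients $S$ and $S$ distinguishes $\mathcal{P}$. It is feasible if, whenever $(A,B),(C,D)\in S$ cross and there are $P,P'\in\mathcal{P}$ with $(A,B),(C,D)\in P$ and $(B,A),(D,C)\in P'$, there is $(E,F)\in P\cap S$ with $(A\cup C,B\cap D)\le(E,F)$. The reduction of $(S,\mathcal{P})$ is $(R,\mathcal{P})$, where $R$ is the set of those separations in $S$ that distinguish some two profiles in $\mathcal{P}$. **Operations.** A separation $(A,B)\in S$ is extremal in $S$ if every $(C,D)\in S$ satisfies $(C,D)\le(A,B)$ or $(D,C)\le(A,B)$.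 A profile $P$ orienting $S$ is well separated in $S$ if the set of $\le$-maximal elements of $P\cap S$ is nested. A separation is locally maximal in $(S,\mathcal{P})$ if it is $\le$-maximal in $P\cap S$ for some $P\in\mathcal{P}$ that is well separated in $S$. Let $\mathsf{ext}(S,\mathcal{P})$ be the set of extremal separations in $S$ and their inverses; $\mathsf{loc}(S,\mathcal{P})$ the set of locally maximal separations in $(S,\mathcal{P})$ and their inverses; $\mathsf{all}(S,\mathcal{P})$ the set of all separations in $S$ that are nested with every separation in $S$. With $(R,\mathcal{P})$ the reduction of $(S,\mathcal{P})$, let $\mathsf{ext_r}(S,\mathcal{P})=\mathsf{ext}(R,\mathcal{P})$, $\mathsf{loc_r}(S,\mathcal{P})=\mathsf{loc}(R,\mathcal{P})$, $\mathsf{all_r}(S,\mathcal{P})=\mathsf{all}(R,\mathcal{P})$. **Strategies.** A strategy is a map $\sigma:\mathbb{N}\to\{\mathsf{ext},\mathsf{loc},\mathsf{all},\mathsf{ext_r},\mathsf{loc_r},\mathsf{all_r}\}$ (with $0\in\mathbb{N}$) such that $\sigma(i)\in\{\mathsf{ext_r},\mathsf{loc_r},\mathsf{all_r}\}$ for infinitely many $i$. Let $\sigma^+(i)=\sigma(i+1)$, and let $r_\sigma$ be the least $r$ with $\sigma(r)\in\{\mathsf{ext_r},\mathsf{loc_r},\mathsf{all_r}\}$. For a nested separation system $N$, let $\mathcal{O}_N$ be the set of all consistent orientations of $N$; given $S$ and $\mathcal{P}$, for $O\in\mathcal{O}_N$ let $S_O$ be the set of separations in $S$ that split $O$ and $\mathcal{P}_O=\{P\in\mathcal{P}: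 P\cap N=O\}$. For a feasible task $(S,\mathcal{P})$ the set $N_\sigma(S,\mathcal{P})$ is defined by recursion on $|S|$ and, for fixed $|S|$, on $r_\sigma$: if $S=\emptyset$, then $N_\sigma(S,\mathcal{P})=\emptyset$. If $S\ne\emptyset$, $r_\sigma=0$ and the reduction $(R,\mathcal{P})$ of $(S,\mathcal{P})$ has $R\subsetneq S$, then $N_\sigma(S,\mathcal{P})=N_\sigma(R,\mathcal{P})$. In all other cases, with $N:=\sigma(0)(S,\mathcal{P})$, let $N_\sigma(S,\mathcal{P})=N\cup\bigcup_{O\in\mathcal{O}_N}N_{\sigma^+}(S_O,\mathcal{P}_O)$. **$k$-strategies.** A $k$-strategy is a $k$-tuple $\Sigma=(\sigma_1,\dots,\sigma_k)$ of strategies each with range in $\{\mathsf{ext_r},\mathsf{loc_r},\mathsf{all_r}\}$. For a set $\mathcal{P}$ of $k$-profiles and $1\le\ell\le k$ let $P_\ell=\{(A,B)\in P:|A\cap B|<\ell\}$ and $\mathcal{P}_\ell=\{P_\ell:P\in\mathcal{P}\}$. The set $N_\Sigma(G,\mathcal{P})$ determined by $\Sigma$ is defined recursively: for $k=1$, $N_\Sigma(G,\mathcal{P})=N_{\sigma_1}(S,\mathcal{P})$, where $S$ is the set of all proper separations of $G$ of order $<1$. For $k\ge2$ let $N=N_{(\sigma_1,\dots,\sigma_{k-1})}(G,\mathcal{P}_{k-1})$, let $S$ be the set of proper $(k-1)$-separations of $G$ that are nested with $N$, and put $N_\Sigma(G,\mathcal{P})=N\cup\bigcup_{O\in\mathcal{O}_N}N_{\sigma_k}(S_O,\mathcal{P}_O)$.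 The set $N_\Sigma(G,\mathcal{P})$ is a nested proper separation system. **Tree-decompositions.** A tree-decomposition of $G$ is a pair $(T,\mathcal{V})$ of a tree $T$ and a family $\mathcal{V}=(V_t)_{t\in T}$ of vertex sets $V_t\subseteq V$ (its parts) with $V=\bigcup_t V_t$, every edge of $G$ having both ends in some $V_t$, and $V_{t_1}\cap V_{t_3}\subseteq V_{t_2}$ whenever $t_2$ lies on the $t_1$–$t_3$ path in $T$. Its adhesion is the maximum of $|V_t\cap V_{t'}|$ over edges $tt'$ of $T$ (and $0$ if $T$ has no edge). An oriented edge $\vec e=t_1t_2$ of $T$ induces the separation $(\bigcup_{t\in T_1}V_t,\bigcup_{t\in T_2}V_t)$, where $T_1\ni t_1$ and $T_2\ni t_2$ are the components of $T-e$. Every nested proper separation system $N$ of $G$ is induced by some tree-decomposition $(T,\mathcal{V})$ of $G$, meaning that the separations of $G$ that correspond to edges of $T$ are precisely those in $N$. Under the assumption that parts corresponding to different nodes of $T$ are distinct (one could otherwise artificially enlarge the tree, without changing the set of separations, by duplicating a part), $(T,\mathcal{V})$ is taken to be uniquely determined by $N$. The tree-decomposition that $\Sigma$ defines on $G$ is the tree-decomposition, in this sense, that induces $N_\Sigma(G,\mathcal{P})$. -}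

module Defs where

open import Data.Bool.Base using (Bool; T)
open import Data.Fin.Base using (Fin)
open import Data.Fin.Subset using (Subset; ⊤; ∣_∣; _∈_; _⊆_; _∩_; _∪_; _─_)
open import Data.List.Base using (List; []; _∷_; map; filter; allFin; cartesianProduct; length)
open import Data.List.Extrema.Nat using (max)
import Data.List.Membership.Propositional as List
open import Data.List.Relation.Unary.Unique.Propositional using (Unique)
open import Data.Nat.Base using (ℕ; zero; suc; _≤_; _<_; s≤s; s≤s⁻¹)
open import Data.Product.Base using (Σ; ∃; ∃₂; ∃-syntax; _×_; _,_; proj₁; swap; uncurry)
open import Data.Sum.Base using (_⊎_)
import Data.Unit.Base as Unit
import Data.Empty as Empty
open import Data.Vec.Functional using (Vector; init; last)
open import Function.Base using (_∘_)
open import Function.Bundles using (_⇔_; _↔_; Inverse)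
open import Function.Construct.Identity using (↔-id; ⇔-id)
open import Function.Definitions using (Injective)
open import Level using (0ℓ)
open import Relation.Binary.Construct.Closure.ReflexiveTransitive using (Star; ε; _◅_)
open import Relation.Binary.Core using (Rel)
open import Relation.Binary.Definitions using (Decidable; Symmetric)
open import Relation.Binary.PropositionalEquality.Core using (_≡_; _≢_)
open import Relation.Nullary using (¬_)
import Relation.Unary as U
open import Relation.Unary using (Pred)

private variable
  n : ℕ

ExactlyOne : Set → Set → Set
ExactlyOne X Y = (X × ¬ Y) ⊎ (¬ X × Y)

record Graph : Set₁ where
  field
    order  : ℕ
  Vertex : Set
  Vertex = Fin order
  field
    Adj    : Rel Vertex 0ℓ
    adj?   : Decidable Adj
    sym    : Symmetric Adj
    irrefl : ∀ {v} → ¬ Adj v v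

open Graph public using (Vertex; Adj; adj?) renaming (order to ∣V∣)

record _≅_ (G H : Graph) : Set where
  field
    bijection : Vertex G ↔ Vertex H
  to : Vertex G → Vertex H
  to = Inverse.to bijection
  field
    adj⇔ : ∀ u v → Adj G u v ⇔ Adj H (to u) (to v)

≅-refl : ∀ {G} → G ≅ G
≅-refl = record { bijection = ↔-id _ ; adj⇔ = λ _ _ → ⇔-id _ }

Sep : ℕ → Set
Sep n = Subset n × Subset n

IsSeparation : (G : Graph) → Pred (Sep (∣V∣ G)) 0ℓ
IsSeparation G (A , B) =
  A ∪ B ≡ ⊤ × (∀ u v → u ∈ A ─ B → v ∈ B ─ A → ¬ Adj G u v)

sepOrder : Sep n → ℕ
sepOrder (A , B) = ∣ A ∩ B ∣

IsProper : Pred (Sep n) 0ℓ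
IsProper (A , B) = ¬ (A ⊆ B) × ¬ (B ⊆ A)

infix 4 _≤ₛ_
_≤ₛ_ : Rel (Sep n) 0ℓ
(A , B) ≤ₛ (C , D) = A ⊆ C × D ⊆ B

Comparable : Rel (Sep n) 0ℓ
Comparable s r = s ≤ₛ r ⊎ r ≤ₛ s

Nested : Rel (Sep n) 0ℓ
Nested s r = Comparable s r ⊎ Comparable s (swap r)

SepSet : ℕ → Set₁
SepSet n = Pred (Sep n) 0ℓ

NestedWith : SepSet n → Pred (Sep n) 0ℓ
NestedWith S s = ∀ r → r U.∈ S → Nested s r

-- Sets of separations that are themselves elements of families (profiles,
-- orientations) are Boolean-valued, which keeps quantification over them in
-- Set.  They are only ever compared extensionally, by ⟦ P ⟧ U.≐ ⟦ Q ⟧.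
DecSepSet : ℕ → Set
DecSepSet n = Sep n → Bool

⟦_⟧ : DecSepSet n → SepSet n
⟦ P ⟧ s = T (P s)

Family : ℕ → Set₁
Family n = Pred (DecSepSet n) 0ℓ

Antisymmetric : SepSet n → Set
Antisymmetric P = ∀ s → s U.∈ P → swap s U.∉ P

Consistent : (G : Graph) → SepSet (∣V∣ G) → Set
Consistent G P =
  ∀ s r → s U.∈ P → IsSeparation G r → r ≤ₛ s → swap r U.∉ P

record IsProfile (G : Graph) (P : SepSet (∣V∣ G)) : Set where
  field
    separations : ∀ s → s U.∈ P → IsSeparation G s
    consistent  : Consistent G P
    profile     : ∀ A B C D → (A , B) U.∈ P → (C , D) U.∈ P →
                  (B ∩ D , A ∪ C) U.∉ P

record IsKProfile (G : Graph) (k : ℕ) (P : SepSet (∣V∣ G)) : Set where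
  field
    isProfile  : IsProfile G P
    order<     : ∀ s → s U.∈ P → sepOrder s < k
    exactlyOne : ∀ s → IsSeparation G s → sepOrder s < k →
                 ExactlyOne (s U.∈ P) (swap s U.∈ P)

KProfiles : (G : Graph) → ℕ → Family (∣V∣ G)
KProfiles G k P = IsKProfile G k ⟦ P ⟧

Orients : Rel (SepSet n) 0ℓ
Orients P S =
  Antisymmetric P × (∀ s → s U.∈ S → s U.∈ P ⊎ swap s U.∈ (P U.∩ S))

ConsistentOrientations : (G : Graph) → SepSet (∣V∣ G) → Family (∣V∣ G)
ConsistentOrientations G S O =
  Consistent G ⟦ O ⟧ × ∃[ P ] Orients ⟦ P ⟧ S × ⟦ O ⟧ U.≐ ⟦ P ⟧ U.∩ S

Distinguishes : Sep n → SepSet n → SepSet n → Set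
Distinguishes s P Q =
    (s U.∈ P U.∖ Q × swap s U.∈ Q U.∖ P)
  ⊎ (s U.∈ Q U.∖ P × swap s U.∈ P U.∖ Q)

Splits : (G : Graph) → Sep (∣V∣ G) → SepSet (∣V∣ G) → Set
Splits G s O = Consistent G (O U.∪ U.｛ s ｝) × Consistent G (O U.∪ U.｛ swap s ｝)

Inseparable : (G : Graph) → ℕ → Subset (∣V∣ G) → Set
Inseparable G k b =
  ∀ A B → IsSeparation G (A , B) → sepOrder (A , B) < k → b ⊆ A ⊎ b ⊆ B

record IsBlock (G : Graph) (k : ℕ) (b : Subset (∣V∣ G)) : Set where
  field
    size        : k ≤ ∣ b ∣
    inseparable : Inseparable G k b
    maximal     : ∀ c → k ≤ ∣ c ∣ → Inseparable G k c → b ⊆ c → c ≡ b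

blockProfile : (G : Graph) → ℕ → Subset (∣V∣ G) → SepSet (∣V∣ G)
blockProfile G k b (A , B) =
  IsSeparation G (A , B) × sepOrder (A , B) < k × b ⊆ B

-- G[A₁] ∪ G[A₂] ∪ G[A₃] ≡ G, spelled out for vertex and edge sets.
Covers : (G : Graph) (A₁ A₂ A₃ : Subset (∣V∣ G)) → Set
Covers G A₁ A₂ A₃ =
  A₁ ∪ A₂ ∪ A₃ ≡ ⊤ ×
  (∀ u v → Adj G u v → (u ∈ A₁ × v ∈ A₁) ⊎ (u ∈ A₂ × v ∈ A₂) ⊎ (u ∈ A₃ × v ∈ A₃))

record IsTangle (G : Graph) (k : ℕ) (θ : SepSet (∣V∣ G)) : Set where
  field
    separations : ∀ s → s U.∈ θ → IsSeparation G s × sepOrder s < k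
    exactlyOne  : ∀ s → IsSeparation G s → sepOrder s < k →
                  ExactlyOne (s U.∈ θ) (swap s U.∈ θ)
    noCover     : ∀ A₁ B₁ A₂ B₂ A₃ B₃ →
                  (A₁ , B₁) U.∈ θ → (A₂ , B₂) U.∈ θ → (A₃ , B₃) U.∈ θ →
                  ¬ Covers G A₁ A₂ A₃

IsBlockProfileOrTangle : (G : Graph) → ℕ → SepSet (∣V∣ G) → Set
IsBlockProfileOrTangle G k P =
  (∃[ b ] IsBlock G k b × P U.≐ blockProfile G k b) ⊎ IsTangle G k P

reduction : SepSet n → Family n → SepSet n
reduction S 𝒫 s =
  s U.∈ S ×
  ∃₂ λ P P′ → P U.∈ 𝒫 × P′ U.∈ 𝒫 × Distinguishes s ⟦ P ⟧ ⟦ P′ ⟧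

Extremal : SepSet n → Pred (Sep n) 0ℓ
Extremal S s = s U.∈ S × (∀ r → r U.∈ S → r ≤ₛ s ⊎ swap r ≤ₛ s)

Maximal : SepSet n → Pred (Sep n) 0ℓ
Maximal S s = s U.∈ S × (∀ r → r U.∈ S → s ≤ₛ r → r ≡ s)

WellSeparated : SepSet n → SepSet n → Set
WellSeparated P S =
  ∀ s r → Maximal (P U.∩ S) s → Maximal (P U.∩ S) r → Nested s r

LocallyMaximal : SepSet n → Family n → Pred (Sep n) 0ℓ
LocallyMaximal S 𝒫 s =
  ∃[ P ] P U.∈ 𝒫 × WellSeparated ⟦ P ⟧ S × Maximal (⟦ P ⟧ U.∩ S) s

data Op : Set where
  ext loc all extᵣ locᵣ allᵣ : Op

applyOp : Op → SepSet n → Family n → SepSet n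
applyOp ext  S 𝒫 s = Extremal S s ⊎ Extremal S (swap s)
applyOp loc  S 𝒫 s = LocallyMaximal S 𝒫 s ⊎ LocallyMaximal S 𝒫 (swap s)
applyOp all  S 𝒫 s = s U.∈ S × NestedWith S s
applyOp extᵣ S 𝒫   = applyOp ext (reduction S 𝒫) 𝒫
applyOp locᵣ S 𝒫   = applyOp loc (reduction S 𝒫) 𝒫
applyOp allᵣ S 𝒫   = applyOp all (reduction S 𝒫) 𝒫

IsReduced : Op → Set
IsReduced ext  = Empty.⊥
IsReduced loc  = Empty.⊥
IsReduced all  = Empty.⊥
IsReduced extᵣ = Unit.⊤
IsReduced locᵣ = Unit.⊤
IsReduced allᵣ = Unit.⊤

record Strategy : Set where
  field
    op         : ℕ → Op
    infinitely : ∀ m → ∃[ i ] m ≤ i × IsReduced (op i)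

open Strategy public using (op)

infix 20 _⁺
_⁺ : Strategy → Strategy
σ ⁺ = record { op = op σ ∘ suc ; infinitely = λ m → shift (Strategy.infinitely σ (suc m)) }
  where
  shift : ∀ {m} → ∃[ i ] suc m ≤ i × IsReduced (op σ i) →
          ∃[ i ] m ≤ i × IsReduced (op σ (suc i))
  shift (suc i , m<i , red) = i , s≤s⁻¹ m<i , red

module _ (G : Graph) where

  splitters : SepSet (∣V∣ G) → DecSepSet (∣V∣ G) → SepSet (∣V∣ G)
  splitters S O s = s U.∈ S × Splits G s ⟦ O ⟧

  inducing : Family (∣V∣ G) → SepSet (∣V∣ G) → DecSepSet (∣V∣ G) → Family (∣V∣ G)
  inducing 𝒫 N O P = P U.∈ 𝒫 × ⟦ P ⟧ U.∩ N U.≐ ⟦ O ⟧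

  -- r_σ = 0 says exactly that op σ 0 is reduced.
  Reduces : Strategy → SepSet (∣V∣ G) → Family (∣V∣ G) → Set
  Reduces σ S 𝒫 = IsReduced (op σ 0) × reduction S 𝒫 U.⊂ S

  -- Each constructor is one of the inclusions in the recursive equations for
  -- N_σ, so that membership in N_σ(S , 𝒫) is membership in their least
  -- solution.  For feasible tasks the recursion terminates and this is the
  -- only solution; no constructor applies when S is empty.
  data Nσ (σ : Strategy) (S : SepSet (∣V∣ G)) (𝒫 : Family (∣V∣ G))
          (s : Sep (∣V∣ G)) : Set where
    reduce : U.Satisfiable S → Reduces σ S 𝒫 →
             s U.∈ Nσ σ (reduction S 𝒫) 𝒫 → Nσ σ S 𝒫 s
    now    : U.Satisfiable S → ¬ Reduces σ S 𝒫 →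
             s U.∈ applyOp (op σ 0) S 𝒫 → Nσ σ S 𝒫 s
    later  : U.Satisfiable S → ¬ Reduces σ S 𝒫 →
             ∀ O → O U.∈ ConsistentOrientations G (applyOp (op σ 0) S 𝒫) →
             s U.∈ Nσ (σ ⁺) (splitters S O) (inducing 𝒫 (applyOp (op σ 0) S 𝒫) O) →
             Nσ σ S 𝒫 s

KStrategy : ℕ → Set
KStrategy k = Vector (Σ Strategy λ σ → ∀ i → IsReduced (op σ i)) k

truncate : ℕ → Family n → Family n
truncate ℓ 𝒫 Q = ∃[ P ] P U.∈ 𝒫 × ⟦ Q ⟧ U.≐ (λ s → s U.∈ ⟦ P ⟧ × sepOrder s < ℓ)

-- N ∪ ⋃_O N_σ(S_O , 𝒫_O), where S is the set of the proper separations of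
-- order exactly ℓ that are nested with N.
extend : (G : Graph) (ℓ : ℕ) → SepSet (∣V∣ G) → Strategy → Family (∣V∣ G) →
         SepSet (∣V∣ G)
extend G ℓ N σ 𝒫 =
  N U.∪ λ s → ∃[ O ] O U.∈ ConsistentOrientations G N ×
                s U.∈ Nσ G σ (splitters G S O) (inducing G 𝒫 N O)
  where
  S : SepSet (∣V∣ G)
  S s = IsSeparation G s × IsProper s × sepOrder s ≡ ℓ × NestedWith N s

-- The value at k = 0 is a dummy.
NΣ : (G : Graph) (k : ℕ) → KStrategy k → Family (∣V∣ G) → SepSet (∣V∣ G)
NΣ G zero          _  𝒫 = U.∅
NΣ G (suc zero)    σs 𝒫 =
  Nσ G (proj₁ (last σs)) (λ s → IsSeparation G s × IsProper s × sepOrder s < 1) 𝒫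
NΣ G (suc (suc j)) σs 𝒫 =
  extend G (suc j) (NΣ G (suc j) (init σs) (truncate (suc j) 𝒫)) (proj₁ (last σs)) 𝒫

Walk : (H : Graph) → Rel (Vertex H) 0ℓ
Walk H = Star (Adj H)

vertices : ∀ H {u v} → Walk H u v → List (Vertex H)
vertices H {u} ε       = u ∷ []
vertices H {u} (_ ◅ w) = u ∷ vertices H w

IsPath : ∀ H {u v} → Walk H u v → Set
IsPath H w = Unique (vertices H w)

record IsTree (H : Graph) : Set where
  field
    nonempty  : 0 < ∣V∣ H
    connected : ∀ u v → Walk H u v
    -- A path with at least three vertices whose ends are adjacent is a cycle.
    acyclic   : ∀ {u v} (w : Walk H u v) → IsPath H w → 3 ≤ length (vertices H w) →
                ¬ Adj H v u

record TreeDecomposition (G : Graph) : Set₁ where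
  field
    tree        : Graph
    isTree      : IsTree tree
    part        : Vertex tree → Subset (∣V∣ G)
    coverVertex : ∀ v → ∃[ t ] v ∈ part t
    coverEdge   : ∀ u v → Adj G u v → ∃[ t ] u ∈ part t × v ∈ part t
    onPath      : ∀ {t₁ t₃} (w : Walk tree t₁ t₃) → IsPath tree w →
                  ∀ t₂ → t₂ List.∈ vertices tree w → part t₁ ∩ part t₃ ⊆ part t₂

  Node : Set
  Node = Vertex tree

  adhesion : ℕ
  adhesion =
    max 0 (map (λ (t , t′) → ∣ part t ∩ part t′ ∣)
               (filter (uncurry (adj? tree))
                       (cartesianProduct (allFin (∣V∣ tree)) (allFin (∣V∣ tree)))))

  AdjWithout : (t₁ t₂ : Node) → Rel Node 0ℓ
  AdjWithout t₁ t₂ u v =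
    Adj tree u v × ¬ ((u ≡ t₁ × v ≡ t₂) ⊎ (u ≡ t₂ × v ≡ t₁))

  Induces : (t₁ t₂ : Node) → Sep (∣V∣ G) → Set
  Induces t₁ t₂ (A , B) =
    (∀ v → v ∈ A ⇔ (∃[ t ] Star (AdjWithout t₁ t₂) t₁ t × v ∈ part t)) ×
    (∀ v → v ∈ B ⇔ (∃[ t ] Star (AdjWithout t₁ t₂) t₂ t × v ∈ part t))

  induced : SepSet (∣V∣ G)
  induced s = ∃₂ λ t₁ t₂ → Adj tree t₁ t₂ × Induces t₁ t₂ s

open TreeDecomposition public using (tree; part; adhesion; induced)

-- Distinctness of the parts alone does not make the tree-decomposition
-- inducing N unique: subdividing an edge t₁t₂ by a new node with part
-- V_t₁ ∩ V_t₂ leaves the induced set of separations unchanged.  Therefore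
-- different oriented edges are also required to induce different separations.
record InducesExactly {G : Graph} (𝒯 : TreeDecomposition G)
                      (N : SepSet (∣V∣ G)) : Set where
  open TreeDecomposition 𝒯 using (Node; Induces)
  field
    induced≐      : induced 𝒯 U.≐ N
    distinctParts : Injective _≡_ _≡_ (part 𝒯)
    distinctSeps  : ∀ {t₁ t₂ u₁ u₂ : Node} {s} →
                    Adj (tree 𝒯) t₁ t₂ → Adj (tree 𝒯) u₁ u₂ →
                    Induces t₁ t₂ s → Induces u₁ u₂ s → t₁ ≡ u₁ × t₂ ≡ u₂

Defines : ∀ {k} → KStrategy k → (G : Graph) → TreeDecomposition G → Set
Defines {k} σs G 𝒯 = InducesExactly 𝒯 (NΣ G k σs (KProfiles G k))

record _≅[_]_ {G G′ : Graph} (𝒯 : TreeDecomposition G) (φ : G ≅ G′)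
              (𝒯′ : TreeDecomposition G′) : Set where
  field
    treeIso : tree 𝒯 ≅ tree 𝒯′
    parts   : ∀ t v → v ∈ part 𝒯 t ⇔ _≅_.to φ v ∈ part 𝒯′ (_≅_.to treeIso t)

IsCanonical : (∀ G → TreeDecomposition G) → Set₁
IsCanonical τ = ∀ {G G′} (φ : G ≅ G′) → τ G ≅[ φ ] τ G′

DistinguishesBlocksAndTangles : ∀ {G} → ℕ → TreeDecomposition G → Set₁
DistinguishesBlocksAndTangles {G} k 𝒯 =
  (∀ P P′ → IsBlockProfileOrTangle G k P → IsBlockProfileOrTangle G k P′ →
     ¬ (P U.≐ P′) → ∃[ s ] s U.∈ induced 𝒯 × Distinguishes s P P′) ×
  (∀ b b′ → IsBlock G k b → IsBlock G k b′ → b ≢ b′ →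
     ∃[ s ] s U.∈ induced 𝒯 ×
       Distinguishes s (blockProfile G k b) (blockProfile G k b′))

{-# OPTIONS --safe #-}

-- A maximal element of a reduced feasible task is extremal, so every reduced
-- step of a strategy takes some separation; by induction on (|S| , r_σ) the
-- recursion therefore ends in a nested set distinguishing 𝒫.  For k-profiles,
-- a separation of order k−1 that distinguishes P from P′ and crosses as few
-- elements of N as possible crosses none: uncrossing it from t ∈ N fails only
-- if an opposite corner has order below that of t and distinguishes two
-- profiles which t distinguishes efficiently.
--
-- The nodes of the tree are the consistent orientations O of N, adjacent when
-- they differ in one separation, and the part of O is the intersection of the
-- sides B of its elements (A , B).  Distinct nodes have distinct parts because
-- the strategies are reduced: if O and O′ both had the part X, some e ∈ N
-- between them would have the separator X and distinguish profiles P and P′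
-- efficiently, and joining a separation below e to one below the inverse of e,
-- both with separator X, would give a separation distinguishing P from P′ that
-- crosses e, although e was nested with all its competitors when it was chosen.
--
-- In any tree-decomposition inducing N, every node orients the edges, hence N,
-- towards itself, and its part is the intersection above; this gives uniqueness.
-- Canonicity follows, as N_Σ commutes with graph isomorphisms.

module Submission where

open import Defs
import Algebra.Properties.CommutativeMonoid.Sum as Sums
open import Data.Bool.Base using (Bool; T; true; false; if_then_else_)
import Data.Bool.Properties as Bool
open import Data.Empty using (⊥; ⊥-elim)
open import Data.Fin.Base using (Fin; zero; suc)
import Data.Fin.Properties as Fin
open import Data.Fin.Subset using (Subset; ∣_∣; ⊤; ⁅_⁆; _∈_; _∉_; _⊆_; _∩_; _∪_; _─_) renaming (⊥ to ∅)
open import Data.Fin.Subset.Properties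
open import Data.List.Base using (List; []; _∷_; _++_; map; filter; length; cartesianProductWith; cartesianProduct; allFin)
open import Data.List.Extrema.Nat using (max<v⁺)
open import Data.List.Membership.DecPropositional using () renaming (_∈?_ to mem?)
open import Data.List.Membership.Propositional using (find; lose) renaming (_∈_ to _∈ₗ_)
open import Data.List.Membership.Propositional.Properties
  using (∈-cartesianProductWith⁺; ∈-cartesianProduct⁺; ∈-++⁺ˡ; ∈-++⁺ʳ; ∈-map⁺; ∈-filter⁺; ∈-filter⁻)
open import Data.List.Relation.Unary.All using (All; []; _∷_)
import Data.List.Relation.Unary.All as All
import Data.List.Relation.Unary.All.Properties as All
open import Data.List.Relation.Unary.AllPairs using ([]; _∷_)
open import Data.List.Relation.Unary.Any using (here; there; any?)
open import Data.Nat.Base using (ℕ; zero; suc; _≤_; _<_; _+_; z≤n; s≤s)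
open import Data.Nat.Induction using (<-wellFounded)
import Data.Nat.Properties as ℕ
open import Data.Product.Base using (∃; ∃-syntax; ∃₂; _×_; _,_; proj₁; proj₂; swap)
import Data.Product.Base as Product
open import Data.Product.Properties using (≡-dec)
open import Data.Sum.Base using (_⊎_; inj₁; inj₂; [_,_]′)
import Data.Sum.Base as Sum
open import Data.Unit.Base using (tt)
open import Data.Vec.Base using ([]; _∷_; lookup; tabulate; there)
open import Data.Vec.Functional using (init; last)
import Data.Vec.Properties as Vec
open import Function.Base using (_∘_; id)
open import Function.Bundles using (_⇔_; mk⇔; Equivalence; Inverse; _↔_; mk↔ₛ′)
open import Induction.WellFounded using (Acc; acc)
open import Level using (0ℓ)
open import Relation.Binary.Construct.Closure.ReflexiveTransitive as Star using (Star; ε; _◅_; _◅◅_)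
open import Relation.Binary.Definitions using (DecidableEquality)
open import Relation.Binary.PropositionalEquality
open import Relation.Nullary using (¬_; Dec; yes; no; does; contradiction; isYes; toWitness; fromWitness)
open import Relation.Nullary.Decidable using (map′; _×-dec_; _⊎-dec_; _→-dec_; ¬?; T?; decidable-stable; dec-true; toSum)
import Relation.Unary as U
open import Relation.Unary using (Pred)

-- A separation (A , B) is read as pointing towards B. The obstacle to distinct parts is that the
-- choice of e guarantees nestedness only with the candidates present at that stage. A separation
-- that distinguishes the same two profiles as e survives every reduction and every passage to the
-- splitters of an orientation, so the invariant speaks of exactly these competitors, of the order
-- of e and nested with the elements of N of lower order. The competitor that crosses e is composed
-- of separations with the one separator X: joins of such separations have separator X again, so
-- neither its order nor its nestedness with lower orders calls for another uncrossing argument.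
--
-- Profiles and orientations are Boolean functions compared only extensionally. Invariance under a
-- relation between the vertex sets of two graphs therefore serves twice: for the identity it lets
-- searches run over representatives, for an isomorphism it gives canonicity.

private variable
  n : ℕ
  G G′ : Graph

-- Finite search

private
  bits : List Bool
  bits = true ∷ false ∷ []

subsets : ∀ n → List (Subset n)
subsets zero    = [] ∷ []
subsets (suc n) = cartesianProductWith _∷_ bits (subsets n)

∈-subsets : (p : Subset n) → p ∈ₗ subsets n
∈-subsets []          = here refl
∈-subsets (true  ∷ p) = ∈-cartesianProductWith⁺ _∷_ {xs = bits} (here refl) (∈-subsets p)
∈-subsets (false ∷ p) = ∈-cartesianProductWith⁺ _∷_ {xs = bits} (there (here refl)) (∈-subsets p)

allSeps : ∀ n → List (Sep n)
allSeps n = cartesianProduct (subsets n) (subsets n)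

∈-allSeps : (s : Sep n) → s ∈ₗ allSeps n
∈-allSeps (A , B) = ∈-cartesianProduct⁺ (∈-subsets A) (∈-subsets B)

infix 4 _≟ₛ_
_≟ₛ_ : DecidableEquality (Sep n)
_≟ₛ_ = ≡-dec (Vec.≡-dec Bool._≟_) (Vec.≡-dec Bool._≟_)

module _ {Q : SepSet n} (Q? : U.Decidable Q) where

  abstract

    ∃Sep? : Dec (∃ Q)
    ∃Sep? with any? Q? (allSeps n)
    ... | yes q = yes (let s , _ , qs = find q in s , qs)
    ... | no ¬q = no λ (s , qs) → ¬q (lose (∈-allSeps s) qs)

    ∀Sep? : Dec (∀ s → Q s)
    ∀Sep? = map′ (λ all s → All.lookup all (∈-allSeps s)) (λ all → All.universal all _) (All.all? Q? (allSeps n))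

    decSet : DecSepSet n
    decSet s = isYes (Q? s)

    decSet⁺ : ∀ {s} → Q s → ⟦ decSet ⟧ s
    decSet⁺ {s} = fromWitness {a? = Q? s}

    decSet⁻ : ∀ {s} → ⟦ decSet ⟧ s → Q s
    decSet⁻ {s} = toWitness {a? = Q? s}

    decSet-≐ : ⟦ decSet ⟧ U.≐ Q
    decSet-≐ = decSet⁻ , decSet⁺

    count : ℕ
    count = length (filter Q? (allSeps n))

module _ {Q R : SepSet n} (Q? : U.Decidable Q) (R? : U.Decidable R) (Q⊆R : ∀ {s} → Q s → R s) where

  abstract

    private
      length-filter-mono : ∀ xs → length (filter Q? xs) ≤ length (filter R? xs)
      length-filter-mono [] = z≤n
      length-filter-mono (x ∷ xs) with Q? x | R? x
      ... | yes q | yes r = s≤s (length-filter-mono xs)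
      ... | yes q | no ¬r = contradiction (Q⊆R q) ¬r
      ... | no ¬q | yes r = ℕ.m≤n⇒m≤1+n (length-filter-mono xs)
      ... | no ¬q | no ¬r = length-filter-mono xs

      length-filter-strict : ∀ {s} → R s → ¬ Q s → ∀ {xs} → s ∈ₗ xs →
                             length (filter Q? xs) < length (filter R? xs)
      length-filter-strict {s} rs ¬qs {x ∷ xs} (here refl) with Q? s | R? s
      ... | yes q | _     = contradiction q ¬qs
      ... | no ¬q | yes r = s≤s (length-filter-mono xs)
      ... | no ¬q | no ¬r = contradiction rs ¬r
      length-filter-strict rs ¬qs {x ∷ xs} (there s∈xs) with Q? x | R? x
      ... | yes q | yes r = s≤s (length-filter-strict rs ¬qs s∈xs)
      ... | yes q | no ¬r = contradiction (Q⊆R q) ¬r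
      ... | no ¬q | yes r = ℕ.m≤n⇒m≤1+n (length-filter-strict rs ¬qs s∈xs)
      ... | no ¬q | no ¬r = length-filter-strict rs ¬qs s∈xs

    count-mono : count Q? ≤ count R?
    count-mono = length-filter-mono (allSeps n)

    -- The measure behind the recursions on sets of separations: elements above a given one,
    -- crossings, remaining candidates, badly oriented separations, and differences between two
    -- orientations.
    count-strict : ∀ {s} → R s → ¬ Q s → count Q? < count R?
    count-strict {s} rs ¬qs = length-filter-strict rs ¬qs (∈-allSeps s)

private
  sublists : {X : Set} → List X → List (List X)
  sublists []       = [] ∷ []
  sublists (x ∷ xs) = sublists xs ++ map (x ∷_) (sublists xs)

  filter∈sublists : {X : Set} {Q : Pred X 0ℓ} (Q? : U.Decidable Q) → ∀ xs → filter Q? xs ∈ₗ sublists xs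
  filter∈sublists Q? [] = here refl
  filter∈sublists Q? (x ∷ xs) with Q? x
  ... | yes _ = ∈-++⁺ʳ (sublists xs) (∈-map⁺ (x ∷_) (filter∈sublists Q? xs))
  ... | no _  = ∈-++⁺ˡ (filter∈sublists Q? xs)

allDecSepSets : ∀ n → List (DecSepSet n)
allDecSepSets n = map (λ xs → decSet (λ s → mem? _≟ₛ_ s xs)) (sublists (allSeps n))

-- The finite list contains one function for each set of separations, so a search through it is
-- complete only for families that are `Extensional`.
∈-allDecSepSets : (P : DecSepSet n) → ∃[ Q ] Q ∈ₗ allDecSepSets n × ⟦ P ⟧ U.≐ ⟦ Q ⟧
∈-allDecSepSets {n} P =
  _ , ∈-map⁺ _ (filter∈sublists P? (allSeps n)) ,
  (λ {s} Ps → decSet⁺ Q? (∈-filter⁺ P? (∈-allSeps s) Ps)) ,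
  (λ {s} Qs → proj₂ (∈-filter⁻ P? {xs = allSeps n} (decSet⁻ Q? Qs)))
  where
  P? : U.Decidable ⟦ P ⟧
  P? s = T? (P s)
  Q? : U.Decidable (_∈ₗ filter P? (allSeps n))
  Q? s = mem? _≟ₛ_ s (filter P? (allSeps n))

Extensional : Family n → Set
Extensional 𝒬 = ∀ P Q → ⟦ P ⟧ U.≐ ⟦ Q ⟧ → 𝒬 P → 𝒬 Q

abstract

  ∃DecSepSet? : {𝒬 : Family n} → Extensional 𝒬 → U.Decidable 𝒬 → Dec (∃ 𝒬)
  ∃DecSepSet? {n} resp 𝒬? with any? 𝒬? (allDecSepSets n)
  ... | yes q = yes (let P , _ , qP = find q in P , qP)
  ... | no ¬q = no λ (P , qP) → let Q , Q∈ , P≐Q = ∈-allDecSepSets P in ¬q (lose Q∈ (resp P Q P≐Q qP))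

_≐?_ : {P Q : SepSet n} → U.Decidable P → U.Decidable Q → Dec (P U.≐ Q)
P? ≐? Q? = map′ (λ (f , g) → (λ {s} → f s) , (λ {s} → g s)) (λ (f , g) → (λ s → f {s}) , (λ s → g {s}))
  (∀Sep? (λ s → P? s →-dec Q? s) ×-dec ∀Sep? (λ s → Q? s →-dec P? s))

≐-sym : {P Q : SepSet n} → P U.≐ Q → Q U.≐ P
≐-sym (f , g) = g , f

≐-trans : {P Q R : SepSet n} → P U.≐ Q → Q U.≐ R → P U.≐ R
≐-trans (f , g) (h , k) = (λ x → h (f x)) , (λ x → g (k x))

-- The partial order of separations

≤ₛ-refl : {s : Sep n} → s ≤ₛ s
≤ₛ-refl = id , id

≤ₛ-trans : {s r t : Sep n} → s ≤ₛ r → r ≤ₛ t → s ≤ₛ t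
≤ₛ-trans (a , b) (c , d) = (λ x → c (a x)) , (λ x → b (d x))

≤ₛ-antisym : {s r : Sep n} → s ≤ₛ r → r ≤ₛ s → s ≡ r
≤ₛ-antisym (a , b) (c , d) = cong₂ _,_ (⊆-antisym a c) (⊆-antisym d b)

swap-anti : {s r : Sep n} → s ≤ₛ r → swap r ≤ₛ swap s
swap-anti (a , b) = b , a

_≤ₛ?_ : (s r : Sep n) → Dec (s ≤ₛ r)
s ≤ₛ? r = (proj₁ s ⊆? proj₁ r) ×-dec (proj₂ r ⊆? proj₂ s)

Nested? : (s r : Sep n) → Dec (Nested s r)
Nested? s r = ((s ≤ₛ? r) ⊎-dec (r ≤ₛ? s)) ⊎-dec ((s ≤ₛ? swap r) ⊎-dec (swap r ≤ₛ? s))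

IsProper? : U.Decidable (IsProper {n})
IsProper? (A , B) = ¬? (A ⊆? B) ×-dec ¬? (B ⊆? A)

pattern ≤n   p = inj₁ (inj₁ p)
pattern ≥n   p = inj₁ (inj₂ p)
pattern ≤sn  p = inj₂ (inj₁ p)
pattern ≥sn  p = inj₂ (inj₂ p)

Nested-sym : {s r : Sep n} → Nested s r → Nested r s
Nested-sym (≤n p)  = ≥n p
Nested-sym (≥n p)  = ≤n p
Nested-sym (≤sn p) = ≤sn (swap-anti p)
Nested-sym (≥sn p) = ≥sn (swap-anti p)

Nested-swapʳ : {s r : Sep n} → Nested s r → Nested s (swap r)
Nested-swapʳ (inj₁ p) = inj₂ p
Nested-swapʳ (inj₂ p) = inj₁ p

Nested-swapˡ : {s r : Sep n} → Nested s r → Nested (swap s) r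
Nested-swapˡ p = Nested-sym (Nested-swapʳ (Nested-sym p))

proper-swap : {s : Sep n} → IsProper s → IsProper (swap s)
proper-swap (a , b) = b , a

abstract

  ∃-maximal : {Q : SepSet n} (Q? : U.Decidable Q) → ∀ s → Q s → ∃[ m ] Maximal Q m × s ≤ₛ m
  ∃-maximal {n} {Q} Q? s Qs = go s Qs (<-wellFounded _)
    where
    above? : ∀ s → U.Decidable (λ r → Q r × s ≤ₛ r)
    above? s r = Q? r ×-dec (s ≤ₛ? r)
    go : ∀ s → Q s → Acc _<_ (count (above? s)) → ∃[ m ] Maximal Q m × s ≤ₛ m
    go s Qs (acc rec) with ∃Sep? {Q = λ r → Q r × s ≤ₛ r × r ≢ s} (λ r → Q? r ×-dec ((s ≤ₛ? r) ×-dec ¬? (r ≟ₛ s)))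
    ... | yes (r , Qr , s≤r , r≢s) =
      let m , max , r≤m = go r Qr (rec (count-strict (above? r) (above? s)
                            (λ (Qt , r≤t) → Qt , ≤ₛ-trans s≤r r≤t) (Qs , ≤ₛ-refl)
                            (λ (_ , r≤s) → r≢s (≤ₛ-antisym r≤s s≤r))))
      in m , max , ≤ₛ-trans s≤r r≤m
    ... | no ¬r = s , (Qs , λ r Qr s≤r → decidable-stable (r ≟ₛ s) λ r≢s → ¬r (r , Qr , s≤r , r≢s)) , ≤ₛ-refl

  ∃-minimal : {Q : SepSet n} (Q? : U.Decidable Q) → ∀ s → Q s →
              ∃[ m ] Q m × (∀ r → Q r → r ≤ₛ m → r ≡ m) × m ≤ₛ s
  ∃-minimal {Q = Q} Q? s Qs with ∃-maximal {Q = λ r → Q (swap r)} (λ r → Q? (swap r)) (swap s) Qs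
  ... | m , (Qm , max) , s≤m = swap m , Qm , (λ r Qr r≤m → cong swap (max (swap r) Qr (swap-anti r≤m))) , swap-anti s≤m

infixr 6 _∨ₛ_
_∨ₛ_ : Sep n → Sep n → Sep n
(A , B) ∨ₛ (C , D) = (A ∪ C , B ∩ D)

_∧ₛ_ : Sep n → Sep n → Sep n
(A , B) ∧ₛ (C , D) = (A ∩ C , B ∪ D)

∨ₛ-upperˡ : {s r : Sep n} → s ≤ₛ s ∨ₛ r
∨ₛ-upperˡ {s = A , B} {C , D} = p⊆p∪q C , p∩q⊆p B D

∨ₛ-upperʳ : {s r : Sep n} → r ≤ₛ s ∨ₛ r
∨ₛ-upperʳ {s = A , B} {C , D} = q⊆p∪q A C , p∩q⊆q B D

∨ₛ-least : {s r t : Sep n} → s ≤ₛ t → r ≤ₛ t → s ∨ₛ r ≤ₛ t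
∨ₛ-least {s = A , B} {C , D} (a , b) (c , d) =
  (λ x → [ a , c ]′ (x∈p∪q⁻ A C x)) , (λ x → x∈p∩q⁺ (b x , d x))

∧ₛ-lowerʳ : {s r : Sep n} → s ∧ₛ r ≤ₛ r
∧ₛ-lowerʳ {s = A , B} {C , D} = p∩q⊆q A C , q⊆p∪q B D

-- Two crossing separations have neither exception.
Nested-∨ₛ : {u s r : Sep n} → Nested u s → Nested u r →
            Nested u (s ∨ₛ r) ⊎ (s ≤ₛ u × u ≤ₛ swap r) ⊎ (s ≤ₛ swap u × swap u ≤ₛ swap r)
Nested-∨ₛ {s = s} {r} (≤n p)  _       = inj₁ (≤n (≤ₛ-trans p (∨ₛ-upperˡ {s = s} {r})))
Nested-∨ₛ {s = s} {r} (≥sn p) _       = inj₁ (≥sn (swap-anti (≤ₛ-trans (swap-anti p) (∨ₛ-upperˡ {s = s} {r}))))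
Nested-∨ₛ {s = s} {r} _       (≤n p)  = inj₁ (≤n (≤ₛ-trans p (∨ₛ-upperʳ {s = s} {r})))
Nested-∨ₛ {s = s} {r} _       (≥sn p) = inj₁ (≥sn (swap-anti (≤ₛ-trans (swap-anti p) (∨ₛ-upperʳ {s = s} {r}))))
Nested-∨ₛ {s = s} {r} (≥n p)  (≥n q)  = inj₁ (≥n (∨ₛ-least {s = s} {r} p q))
Nested-∨ₛ {s = s} {r} (≤sn p) (≤sn q) = inj₁ (≤sn (swap-anti (∨ₛ-least {s = s} {r} (swap-anti p) (swap-anti q))))
Nested-∨ₛ             (≥n p)  (≤sn q) = inj₂ (inj₁ (p , q))
Nested-∨ₛ             (≤sn p) (≥n q)  = inj₂ (inj₂ (swap-anti p , swap-anti q))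

∣∪∣+∣∩∣ : (p q : Subset n) → ∣ p ∪ q ∣ + ∣ p ∩ q ∣ ≡ ∣ p ∣ + ∣ q ∣
∣∪∣+∣∩∣ [] [] = refl
∣∪∣+∣∩∣ (false ∷ p) (false ∷ q) = ∣∪∣+∣∩∣ p q
∣∪∣+∣∩∣ (false ∷ p) (true ∷ q) = trans (cong suc (∣∪∣+∣∩∣ p q)) (sym (ℕ.+-suc ∣ p ∣ ∣ q ∣))
∣∪∣+∣∩∣ (true ∷ p) (false ∷ q) = cong suc (∣∪∣+∣∩∣ p q)
∣∪∣+∣∩∣ (true ∷ p) (true ∷ q) = cong suc (trans (ℕ.+-suc _ _) (trans (cong suc (∣∪∣+∣∩∣ p q)) (sym (ℕ.+-suc ∣ p ∣ ∣ q ∣))))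

-- For separations equality holds; the inequality is true of arbitrary pairs of sets, since both the
-- union and the intersection of the corner separators lie in those of the given ones.
submodular : (s r : Sep n) → sepOrder (s ∨ₛ r) + sepOrder (s ∧ₛ r) ≤ sepOrder s + sepOrder r
submodular (A , B) (C , D) = begin
  ∣ X ∣ + ∣ Y ∣             ≡⟨ ∣∪∣+∣∩∣ X Y ⟨
  ∣ X ∪ Y ∣ + ∣ X ∩ Y ∣     ≤⟨ ℕ.+-mono-≤ (p⊆q⇒∣p∣≤∣q∣ ∪⊆) (p⊆q⇒∣p∣≤∣q∣ ∩⊆) ⟩
  ∣ (A ∩ B) ∪ (C ∩ D) ∣ + ∣ (A ∩ B) ∩ (C ∩ D) ∣  ≡⟨ ∣∪∣+∣∩∣ (A ∩ B) (C ∩ D) ⟩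
  ∣ A ∩ B ∣ + ∣ C ∩ D ∣     ∎
  where
  open ℕ.≤-Reasoning
  X = (A ∪ C) ∩ (B ∩ D)
  Y = (A ∩ C) ∩ (B ∪ D)
  X⊆ : ∀ {v} → v ∈ X → (v ∈ A ⊎ v ∈ C) × v ∈ B × v ∈ D
  X⊆ x = let p , q = x∈p∩q⁻ (A ∪ C) (B ∩ D) x in x∈p∪q⁻ A C p , x∈p∩q⁻ B D q
  Y⊆ : ∀ {v} → v ∈ Y → (v ∈ A × v ∈ C) × (v ∈ B ⊎ v ∈ D)
  Y⊆ y = let p , q = x∈p∩q⁻ (A ∩ C) (B ∪ D) y in x∈p∩q⁻ A C p , x∈p∪q⁻ B D q
  ∪⊆ : X ∪ Y ⊆ (A ∩ B) ∪ (C ∩ D)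
  ∪⊆ z with x∈p∪q⁻ X Y z
  ... | inj₁ x with X⊆ x
  ...   | inj₁ a , b , d = x∈p∪q⁺ (inj₁ (x∈p∩q⁺ (a , b)))
  ...   | inj₂ c , b , d = x∈p∪q⁺ (inj₂ (x∈p∩q⁺ (c , d)))
  ∪⊆ z | inj₂ y with Y⊆ y
  ...   | (a , c) , inj₁ b = x∈p∪q⁺ (inj₁ (x∈p∩q⁺ (a , b)))
  ...   | (a , c) , inj₂ d = x∈p∪q⁺ (inj₂ (x∈p∩q⁺ (c , d)))
  ∩⊆ : X ∩ Y ⊆ (A ∩ B) ∩ (C ∩ D)
  ∩⊆ z with x∈p∩q⁻ X Y z
  ... | x , y with X⊆ x | Y⊆ y
  ...   | _ , b , d | (a , c) , _ = x∈p∩q⁺ (x∈p∩q⁺ (a , b) , x∈p∩q⁺ (c , d))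

sepOrder-swap : (s : Sep n) → sepOrder (swap s) ≡ sepOrder s
sepOrder-swap (A , B) = cong ∣_∣ (∩-comm B A)

⊆∧≥⇒⊇ : {p q : Subset n} → p ⊆ q → ∣ q ∣ ≤ ∣ p ∣ → q ⊆ p
⊆∧≥⇒⊇ {p = p} {q} p⊆q ∣q∣≤∣p∣ {x} x∈q with x ∈? p
... | yes x∈p = x∈p
... | no x∉p = contradiction ∣q∣≤∣p∣ (ℕ.<⇒≱ (p⊂q⇒∣p∣<∣q∣ (p⊆q , x , x∈q , x∉p)))

-- Separations of a graph and their corners

module _ (G : Graph) where

  private
    ∣G∣ = ∣V∣ G

  sep-cover : (s : Sep ∣G∣) → IsSeparation G s → ∀ v → v ∈ proj₁ s ⊎ v ∈ proj₂ s
  sep-cover (A , B) (cover , _) v = x∈p∪q⁻ A B (subst (v ∈_) (sym cover) ∈⊤)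

  sep-edge : (s : Sep ∣G∣) → IsSeparation G s → ∀ u v → Adj G u v →
             (u ∈ proj₁ s × v ∈ proj₁ s) ⊎ (u ∈ proj₂ s × v ∈ proj₂ s)
  sep-edge s@(A , B) sep u v adj with u ∈? A | v ∈? A | u ∈? B | v ∈? B
  ... | yes a | yes b | _ | _ = inj₁ (a , b)
  ... | _ | _ | yes a | yes b = inj₂ (a , b)
  ... | no a | _ | no b | _ = ⊥-elim ([ a , b ]′ (sep-cover s sep u))
  ... | _ | no a | _ | no b = ⊥-elim ([ a , b ]′ (sep-cover s sep v))
  ... | yes a | no b | no c | yes d = ⊥-elim (proj₂ sep u v (x∈p∧x∉q⇒x∈p─q a c) (x∈p∧x∉q⇒x∈p─q d b) adj)
  ... | no b | yes a | yes d | no c = ⊥-elim (proj₂ sep v u (x∈p∧x∉q⇒x∈p─q a c) (x∈p∧x∉q⇒x∈p─q d b) (Graph.sym G adj))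

  private
    x∈p─q⇒x∉q : ∀ {m} (p q : Subset m) {x} → x ∈ p ─ q → x ∉ q
    x∈p─q⇒x∉q (true ∷ p) (false ∷ q) {zero} _ ()
    x∈p─q⇒x∉q (_ ∷ p) (_ ∷ q) {suc x} (there x∈) (there x∈q) = x∈p─q⇒x∉q p q x∈ x∈q

  -- Together with `sep-cover` and `sep-edge` this reads a separation as a cover of the vertices and
  -- edges by two induced subgraphs, a form in which corners are checked by cases.
  mkSeparation : (s : Sep ∣G∣) → (∀ v → v ∈ proj₁ s ⊎ v ∈ proj₂ s) →
                 (∀ u v → Adj G u v → (u ∈ proj₁ s × v ∈ proj₁ s) ⊎ (u ∈ proj₂ s × v ∈ proj₂ s)) →
                 IsSeparation G s
  mkSeparation (A , B) cover edge =
    ⊆-antisym ⊆⊤ (λ {v} _ → x∈p∪q⁺ (cover v)) ,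
    λ u v u∈ v∈ adj → [ (λ (_ , v∈A) → x∈p─q⇒x∉q B A v∈ v∈A) , (λ (u∈B , _) → x∈p─q⇒x∉q A B u∈ u∈B) ]′ (edge u v adj)

  IsSeparation? : U.Decidable (IsSeparation G)
  IsSeparation? (A , B) = Vec.≡-dec Bool._≟_ (A ∪ B) ⊤ ×-dec
    Fin.all? λ u → Fin.all? λ v → (u ∈? (A ─ B)) →-dec ((v ∈? (B ─ A)) →-dec ¬? (adj? G u v))

  swap-separation : (s : Sep ∣G∣) → IsSeparation G s → IsSeparation G (swap s)
  swap-separation s sep = mkSeparation (swap s) (λ v → [ inj₂ , inj₁ ]′ (sep-cover s sep v))
    (λ u v adj → [ inj₂ , inj₁ ]′ (sep-edge s sep u v adj))

  ∨ₛ-separation : (s r : Sep ∣G∣) → IsSeparation G s → IsSeparation G r → IsSeparation G (s ∨ₛ r)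
  ∨ₛ-separation s@(A , B) r@(C , D) sep₁ sep₂ = mkSeparation (s ∨ₛ r) cover edge
    where
    cover : ∀ v → v ∈ A ∪ C ⊎ v ∈ B ∩ D
    cover v with sep-cover s sep₁ v | sep-cover r sep₂ v
    ... | inj₁ a | _      = inj₁ (x∈p∪q⁺ (inj₁ a))
    ... | _      | inj₁ c = inj₁ (x∈p∪q⁺ (inj₂ c))
    ... | inj₂ b | inj₂ d = inj₂ (x∈p∩q⁺ (b , d))
    edge : ∀ u v → Adj G u v → (u ∈ A ∪ C × v ∈ A ∪ C) ⊎ (u ∈ B ∩ D × v ∈ B ∩ D)
    edge u v adj with sep-edge s sep₁ u v adj | sep-edge r sep₂ u v adj
    ... | inj₁ (a , a′) | _             = inj₁ (x∈p∪q⁺ (inj₁ a) , x∈p∪q⁺ (inj₁ a′))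
    ... | _             | inj₁ (c , c′) = inj₁ (x∈p∪q⁺ (inj₂ c) , x∈p∪q⁺ (inj₂ c′))
    ... | inj₂ (b , b′) | inj₂ (d , d′) = inj₂ (x∈p∩q⁺ (b , d) , x∈p∩q⁺ (b′ , d′))

  ∧ₛ-separation : (s r : Sep ∣G∣) → IsSeparation G s → IsSeparation G r → IsSeparation G (s ∧ₛ r)
  ∧ₛ-separation s r sep₁ sep₂ = swap-separation (swap s ∨ₛ swap r)
    (∨ₛ-separation (swap s) (swap r) (swap-separation s sep₁) (swap-separation r sep₂))

-- A logical relation between the vertex sets of two graphs.  The identity
-- correspondence turns its fundamental lemmas into extensionality.
record Correspondence (G G′ : Graph) : Set₁ where
  infix 4 _≈_
  field
    _≈_        : Subset (∣V∣ G) → Subset (∣V∣ G′) → Set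
    to         : Subset (∣V∣ G) → Subset (∣V∣ G′)
    to≈        : ∀ p → p ≈ to p
    from       : Subset (∣V∣ G′) → Subset (∣V∣ G)
    from≈      : ∀ p′ → from p′ ≈ p′
    functional : ∀ {p p′ q′} → p ≈ p′ → p ≈ q′ → p′ ≡ q′
    injective  : ∀ {p q p′} → p ≈ p′ → q ≈ p′ → p ≡ q
    ⊆⇒         : ∀ {p p′ q q′} → p ≈ p′ → q ≈ q′ → p ⊆ q → p′ ⊆ q′
    ⊆⇐         : ∀ {p p′ q q′} → p ≈ p′ → q ≈ q′ → p′ ⊆ q′ → p ⊆ q
    ∩-cong     : ∀ {p p′ q q′} → p ≈ p′ → q ≈ q′ → p ∩ q ≈ p′ ∩ q′
    ∪-cong     : ∀ {p p′ q q′} → p ≈ p′ → q ≈ q′ → p ∪ q ≈ p′ ∪ q′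
    ∣∣-cong    : ∀ {p p′} → p ≈ p′ → ∣ p ∣ ≡ ∣ p′ ∣
    sep⇒       : ∀ {p p′ q q′} → p ≈ p′ → q ≈ q′ → IsSeparation G (p , q) → IsSeparation G′ (p′ , q′)
    sep⇐       : ∀ {p p′ q q′} → p ≈ p′ → q ≈ q′ → IsSeparation G′ (p′ , q′) → IsSeparation G (p , q)

  infix 4 _≈ₛ_
  _≈ₛ_ : Sep (∣V∣ G) → Sep (∣V∣ G′) → Set
  s ≈ₛ s′ = proj₁ s ≈ proj₁ s′ × proj₂ s ≈ proj₂ s′

  toₛ : Sep (∣V∣ G) → Sep (∣V∣ G′)
  toₛ = Product.map to to

  toₛ≈ : ∀ s → s ≈ₛ toₛ s
  toₛ≈ (A , B) = to≈ A , to≈ B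

  fromₛ : Sep (∣V∣ G′) → Sep (∣V∣ G)
  fromₛ = Product.map from from

  fromₛ≈ : ∀ s′ → fromₛ s′ ≈ₛ s′
  fromₛ≈ (A , B) = from≈ A , from≈ B

  functionalₛ : ∀ {s s′ r′} → s ≈ₛ s′ → s ≈ₛ r′ → s′ ≡ r′
  functionalₛ (a , b) (c , d) = cong₂ _,_ (functional a c) (functional b d)

  injectiveₛ : ∀ {s r s′} → s ≈ₛ s′ → r ≈ₛ s′ → s ≡ r
  injectiveₛ (a , b) (c , d) = cong₂ _,_ (injective a c) (injective b d)

  ≤ₛ⇒ : ∀ {s r s′ r′} → s ≈ₛ s′ → r ≈ₛ r′ → s ≤ₛ r → s′ ≤ₛ r′
  ≤ₛ⇒ (a , b) (c , d) (l , g) = ⊆⇒ a c l , ⊆⇒ d b g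

  ≤ₛ⇐ : ∀ {s r s′ r′} → s ≈ₛ s′ → r ≈ₛ r′ → s′ ≤ₛ r′ → s ≤ₛ r
  ≤ₛ⇐ (a , b) (c , d) (l , g) = ⊆⇐ a c l , ⊆⇐ d b g

  nested⇒ : ∀ {s r s′ r′} → s ≈ₛ s′ → r ≈ₛ r′ → Nested s r → Nested s′ r′
  nested⇒ e f = Sum.map (Sum.map (≤ₛ⇒ e f) (≤ₛ⇒ f e)) (Sum.map (≤ₛ⇒ e (swap f)) (≤ₛ⇒ (swap f) e))

  order-cong : ∀ {s s′} → s ≈ₛ s′ → sepOrder s ≡ sepOrder s′
  order-cong (a , b) = ∣∣-cong (∩-cong a b)

flip : Correspondence G G′ → Correspondence G′ G
flip c = record
  { _≈_ = λ p q → q ≈ p ; to = from ; to≈ = from≈ ; from = to ; from≈ = to≈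
  ; functional = injective ; injective = functional ; ⊆⇒ = ⊆⇐ ; ⊆⇐ = ⊆⇒
  ; ∩-cong = ∩-cong ; ∪-cong = ∪-cong ; ∣∣-cong = sym ∘ ∣∣-cong ; sep⇒ = sep⇐ ; sep⇐ = sep⇒ }
  where open Correspondence c

identity : (G : Graph) → Correspondence G G
identity G = record
  { _≈_ = _≡_ ; to = id ; to≈ = λ _ → refl ; from = id ; from≈ = λ _ → refl
  ; functional = λ p q → trans (sym p) q ; injective = λ p q → trans p (sym q)
  ; ⊆⇒ = λ { refl refl → id } ; ⊆⇐ = λ { refl refl → id }
  ; ∩-cong = cong₂ _∩_ ; ∪-cong = cong₂ _∪_ ; ∣∣-cong = cong ∣_∣
  ; sep⇒ = λ { refl refl → id } ; sep⇐ = λ { refl refl → id } }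

-- Each construction is treated in this one direction; applying the result to `flip c` gives the
-- converse.
Fwd : Correspondence G G′ → SepSet (∣V∣ G) → SepSet (∣V∣ G′) → Set
Fwd c S S′ = ∀ s s′ → Correspondence._≈ₛ_ c s s′ → S s → S′ s′

Rel : Correspondence G G′ → SepSet (∣V∣ G) → SepSet (∣V∣ G′) → Set
Rel c S S′ = Fwd c S S′ × Fwd (flip c) S′ S

FamFwd : Correspondence G G′ → Family (∣V∣ G) → Family (∣V∣ G′) → Set
FamFwd c 𝒫 𝒫′ = ∀ P P′ → Rel c ⟦ P ⟧ ⟦ P′ ⟧ → 𝒫 P → 𝒫′ P′

FamRel : Correspondence G G′ → Family (∣V∣ G) → Family (∣V∣ G′) → Set
FamRel c 𝒫 𝒫′ = FamFwd c 𝒫 𝒫′ × FamFwd (flip c) 𝒫′ 𝒫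

-- Supplies the witness on the other side wherever a notion quantifies existentially over profiles
-- or orientations.
push : Correspondence G G′ → DecSepSet (∣V∣ G) → DecSepSet (∣V∣ G′)
push c P = P ∘ Correspondence.fromₛ c

push-rel : (c : Correspondence G G′) (P : DecSepSet (∣V∣ G)) → Rel c ⟦ P ⟧ ⟦ push c P ⟧
push-rel c P = (λ s s′ e → subst (T ∘ P) (injectiveₛ e (fromₛ≈ s′))) ,
               (λ s′ s e → subst (T ∘ P) (injectiveₛ (fromₛ≈ s′) e))
  where open Correspondence c

-- Invariance of the notions used in the recursion

module _ (c : Correspondence G G′) where
  open Correspondence c

  private
    S₀ = SepSet (∣V∣ G)
    S₁ = SepSet (∣V∣ G′)

  ∩-rel : {P S : S₀} {P′ S′ : S₁} → Rel c P P′ → Rel c S S′ → Rel c (P U.∩ S) (P′ U.∩ S′)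
  ∩-rel (f , g) (h , k) = (λ s s′ e (p , q) → f s s′ e p , h s s′ e q) ,
                          (λ s s′ e (p , q) → g s s′ e p , k s s′ e q)

  ≐-fwd : {P Q : S₀} {P′ Q′ : S₁} → Rel c P P′ → Rel c Q Q′ → P U.≐ Q → P′ U.≐ Q′
  ≐-fwd (f , g) (h , k) (a , b) =
    (λ {s′} p → h _ s′ (fromₛ≈ s′) (a (g s′ _ (fromₛ≈ s′) p))) ,
    (λ {s′} q → f _ s′ (fromₛ≈ s′) (b (k s′ _ (fromₛ≈ s′) q)))

  nestedWith-fwd : {S : S₀} {S′ : S₁} → Rel c S S′ → Fwd c (NestedWith S) (NestedWith S′)
  nestedWith-fwd (_ , g) s s′ e nst r′ r′∈ = nested⇒ e (fromₛ≈ r′) (nst _ (g r′ _ (fromₛ≈ r′) r′∈))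

  maximal-fwd : {S : S₀} {S′ : S₁} → Rel c S S′ → Fwd c (Maximal S) (Maximal S′)
  maximal-fwd (f , g) s s′ e (Ss , max) = f s s′ e Ss , λ r′ S′r′ s′≤r′ →
    let eʳ = fromₛ≈ r′
        r≡s = max _ (g r′ _ eʳ S′r′) (≤ₛ⇐ e eʳ s′≤r′)
    in functionalₛ (subst (_≈ₛ r′) r≡s eʳ) e

  extremal-fwd : {S : S₀} {S′ : S₁} → Rel c S S′ → Fwd c (Extremal S) (Extremal S′)
  extremal-fwd (f , g) s s′ e (Ss , extr) = f s s′ e Ss , λ r′ S′r′ →
    let eʳ = fromₛ≈ r′ in Sum.map (≤ₛ⇒ eʳ e) (≤ₛ⇒ (swap eʳ) e) (extr _ (g r′ _ eʳ S′r′))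

  distinguishes-fwd : {P Q : S₀} {P′ Q′ : S₁} → Rel c P P′ → Rel c Q Q′ →
                      ∀ s s′ → s ≈ₛ s′ → Distinguishes s P Q → Distinguishes s′ P′ Q′
  distinguishes-fwd {P} {Q} {P′} {Q′} RP RQ s s′ e = Sum.map (oneWay {P} {Q} {P′} {Q′} RP RQ) (oneWay {Q} {P} {Q′} {P′} RQ RP)
    where
    oneWay : ∀ {P Q : S₀} {P′ Q′ : S₁} → Rel c P P′ → Rel c Q Q′ →
           (s U.∈ P U.∖ Q × swap s U.∈ Q U.∖ P) → (s′ U.∈ P′ U.∖ Q′ × swap s′ U.∈ Q′ U.∖ P′)
    oneWay (f , g) (h , k) ((p , ¬q) , (q , ¬p)) =
      (f _ _ e p , ¬q ∘ k _ _ e) , (h _ _ (swap e) q , ¬p ∘ g _ _ (swap e))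

module _ (c : Correspondence G G′) where
  open Correspondence c

  private
    S₀ = SepSet (∣V∣ G)
    S₁ = SepSet (∣V∣ G′)

  maximal-rel : {S : S₀} {S′ : S₁} → Rel c S S′ → Rel c (Maximal S) (Maximal S′)
  maximal-rel RS = maximal-fwd c RS , maximal-fwd (flip c) (swap RS)

  wellSeparated-fwd : {P S : S₀} {P′ S′ : S₁} → Rel c P P′ → Rel c S S′ → WellSeparated P S → WellSeparated P′ S′
  wellSeparated-fwd {P} {S} {P′} {S′} RP RS ws s′ r′ ms mr =
    nested⇒ (fromₛ≈ s′) (fromₛ≈ r′) (ws _ _ (back s′ _ (fromₛ≈ s′) ms) (back r′ _ (fromₛ≈ r′) mr))
    where back = proj₂ (maximal-rel (∩-rel c {P} {S} {P′} {S′} RP RS))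

  consistent-fwd : {P : S₀} {P′ : S₁} → Rel c P P′ → Consistent G P → Consistent G′ P′
  consistent-fwd (f , g) con s′ r′ P′s′ sep r′≤s′ P′r′ =
    let eˢ = fromₛ≈ s′ ; eʳ = fromₛ≈ r′ in
    con _ _ (g _ _ eˢ P′s′) (sep⇐ (proj₁ eʳ) (proj₂ eʳ) sep) (≤ₛ⇐ eʳ eˢ r′≤s′) (g _ _ (swap eʳ) P′r′)

  orients-fwd : {P S : S₀} {P′ S′ : S₁} → Rel c P P′ → Rel c S S′ → Orients P S → Orients P′ S′
  orients-fwd (f , g) (h , k) (anti , tot) =
    (λ s′ p q → anti _ (g s′ _ (fromₛ≈ s′) p) (g _ _ (swap (fromₛ≈ s′)) q)) ,
    (λ s′ S′s′ → Sum.map (f _ _ (fromₛ≈ s′)) (λ (p , q) → f _ _ (swap (fromₛ≈ s′)) p , h _ _ (swap (fromₛ≈ s′)) q)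
                   (tot _ (k s′ _ (fromₛ≈ s′) S′s′)))

  consOrient-fwd : {S : S₀} {S′ : S₁} → Rel c S S′ → FamFwd c (ConsistentOrientations G S) (ConsistentOrientations G′ S′)
  consOrient-fwd {S} {S′} RS O O′ RO (con , P , ori , eq) =
    consistent-fwd RO con , push c P , orients-fwd (push-rel c P) RS ori ,
    ≐-fwd c RO (∩-rel c {⟦ P ⟧} {S} {⟦ push c P ⟧} {S′} (push-rel c P) RS) eq

  splits-fwd : {O : S₀} {O′ : S₁} → Rel c O O′ → ∀ s s′ → s ≈ₛ s′ → Splits G s O → Splits G′ s′ O′
  splits-fwd {O} {O′} (f , g) s s′ e (p , q) =
    consistent-fwd {O U.∪ U.｛ s ｝} {O′ U.∪ U.｛ s′ ｝} (rel s s′ e) p ,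
    consistent-fwd {O U.∪ U.｛ swap s ｝} {O′ U.∪ U.｛ swap s′ ｝} (rel (swap s) (swap s′) (swap e)) q
    where
    rel : ∀ s s′ → s ≈ₛ s′ → Rel c (O U.∪ U.｛ s ｝) (O′ U.∪ U.｛ s′ ｝)
    rel s s′ e = (λ r r′ eʳ → Sum.map (f r r′ eʳ) (λ { refl → functionalₛ e eʳ })) ,
                 (λ r′ r eʳ → Sum.map (g r′ r eʳ) (λ { refl → injectiveₛ e eʳ }))

  reduction-fwd : {S : S₀} {S′ : S₁} {𝒫 : Family (∣V∣ G)} {𝒫′ : Family (∣V∣ G′)} →
                  Rel c S S′ → FamRel c 𝒫 𝒫′ → Fwd c (reduction S 𝒫) (reduction S′ 𝒫′)
  reduction-fwd RS R𝒫 s s′ e (Ss , P , Q , 𝒫P , 𝒫Q , dist) =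
    proj₁ RS s s′ e Ss , push c P , push c Q ,
    proj₁ R𝒫 P _ (push-rel c P) 𝒫P , proj₁ R𝒫 Q _ (push-rel c Q) 𝒫Q ,
    distinguishes-fwd c {⟦ P ⟧} {⟦ Q ⟧} {⟦ push c P ⟧} {⟦ push c Q ⟧} (push-rel c P) (push-rel c Q) s s′ e dist

  locallyMaximal-fwd : {S : S₀} {S′ : S₁} {𝒫 : Family (∣V∣ G)} {𝒫′ : Family (∣V∣ G′)} →
                       Rel c S S′ → FamRel c 𝒫 𝒫′ → Fwd c (LocallyMaximal S 𝒫) (LocallyMaximal S′ 𝒫′)
  locallyMaximal-fwd {S} {S′} RS R𝒫 s s′ e (P , 𝒫P , ws , max) =
    push c P , proj₁ R𝒫 P _ (push-rel c P) 𝒫P , wellSeparated-fwd {⟦ P ⟧} (push-rel c P) RS ws ,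
    maximal-fwd c (∩-rel c {⟦ P ⟧} {S} {⟦ push c P ⟧} {S′} (push-rel c P) RS) s s′ e max

  inducing-fwd : {N : S₀} {N′ : S₁} {𝒫 : Family (∣V∣ G)} {𝒫′ : Family (∣V∣ G′)} {O : DecSepSet (∣V∣ G)} {O′ : DecSepSet (∣V∣ G′)} →
                 FamRel c 𝒫 𝒫′ → Rel c N N′ → Rel c ⟦ O ⟧ ⟦ O′ ⟧ →
                 FamFwd c (inducing G 𝒫 N O) (inducing G′ 𝒫′ N′ O′)
  inducing-fwd {N} {N′} R𝒫 RN RO P P′ RP (𝒫P , eq) =
    proj₁ R𝒫 P P′ RP 𝒫P , ≐-fwd c (∩-rel c {⟦ P ⟧} {N} {⟦ P′ ⟧} {N′} RP RN) RO eq

module _ (c : Correspondence G G′) {S : SepSet (∣V∣ G)} {S′ : SepSet (∣V∣ G′)}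
         {𝒫 : Family (∣V∣ G)} {𝒫′ : Family (∣V∣ G′)} where

  reduction-rel : Rel c S S′ → FamRel c 𝒫 𝒫′ → Rel c (reduction S 𝒫) (reduction S′ 𝒫′)
  reduction-rel RS R𝒫 = reduction-fwd c RS R𝒫 , reduction-fwd (flip c) RS˘ R𝒫˘
    where RS˘ = swap RS
          R𝒫˘ = swap R𝒫

applyOp-fwd : (c : Correspondence G G′) {S : SepSet (∣V∣ G)} {S′ : SepSet (∣V∣ G′)}
              {𝒫 : Family (∣V∣ G)} {𝒫′ : Family (∣V∣ G′)} →
              ∀ o → Rel c S S′ → FamRel c 𝒫 𝒫′ → Fwd c (applyOp o S 𝒫) (applyOp o S′ 𝒫′)
applyOp-fwd c ext RS R𝒫 s s′ e = Sum.map (extremal-fwd c RS s s′ e) (extremal-fwd c RS (swap s) (swap s′) (swap e))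
applyOp-fwd c loc RS R𝒫 s s′ e = Sum.map (locallyMaximal-fwd c RS R𝒫 s s′ e) (locallyMaximal-fwd c RS R𝒫 (swap s) (swap s′) (swap e))
applyOp-fwd c all RS R𝒫 s s′ e (p , q) = proj₁ RS s s′ e p , nestedWith-fwd c RS s s′ e q
applyOp-fwd c extᵣ RS R𝒫 = applyOp-fwd c ext (reduction-rel c RS R𝒫) R𝒫
applyOp-fwd c locᵣ RS R𝒫 = applyOp-fwd c loc (reduction-rel c RS R𝒫) R𝒫
applyOp-fwd c {𝒫 = 𝒫} {𝒫′} allᵣ RS R𝒫 = applyOp-fwd c {𝒫 = 𝒫} {𝒫′} all (reduction-rel c RS R𝒫) R𝒫

applyOp-rel : (c : Correspondence G G′) {S : SepSet (∣V∣ G)} {S′ : SepSet (∣V∣ G′)}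
              {𝒫 : Family (∣V∣ G)} {𝒫′ : Family (∣V∣ G′)} →
              ∀ o → Rel c S S′ → FamRel c 𝒫 𝒫′ → Rel c (applyOp o S 𝒫) (applyOp o S′ 𝒫′)
applyOp-rel c {𝒫 = 𝒫} {𝒫′} o RS R𝒫 =
  applyOp-fwd c {𝒫 = 𝒫} {𝒫′} o RS R𝒫 , applyOp-fwd (flip c) {𝒫 = 𝒫′} {𝒫} o (swap RS) (swap R𝒫)

splitters-rel : (c : Correspondence G G′) {S : SepSet (∣V∣ G)} {S′ : SepSet (∣V∣ G′)} (O : DecSepSet (∣V∣ G)) (O′ : DecSepSet (∣V∣ G′)) →
                Rel c S S′ → Rel c ⟦ O ⟧ ⟦ O′ ⟧ → Rel c (splitters G S O) (splitters G′ S′ O′)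
splitters-rel c O O′ (f , g) RO =
  (λ s s′ e (p , q) → f s s′ e p , splits-fwd c {⟦ O ⟧} {⟦ O′ ⟧} RO s s′ e q) ,
  (λ s′ s e (p , q) → g s′ s e p , splits-fwd (flip c) {⟦ O′ ⟧} {⟦ O ⟧} (swap RO) s′ s e q)

inducing-rel : (c : Correspondence G G′) {N : SepSet (∣V∣ G)} {N′ : SepSet (∣V∣ G′)} {𝒫 : Family (∣V∣ G)} {𝒫′ : Family (∣V∣ G′)}
               (O : DecSepSet (∣V∣ G)) (O′ : DecSepSet (∣V∣ G′)) →
               FamRel c 𝒫 𝒫′ → Rel c N N′ → Rel c ⟦ O ⟧ ⟦ O′ ⟧ →
               FamRel c (inducing G 𝒫 N O) (inducing G′ 𝒫′ N′ O′)
inducing-rel c {N} {N′} {𝒫} {𝒫′} O O′ R𝒫 RN RO =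
  inducing-fwd c {N} {N′} {𝒫} {𝒫′} {O} {O′} R𝒫 RN RO ,
  inducing-fwd (flip c) {N′} {N} {𝒫′} {𝒫} {O′} {O} (swap R𝒫) (swap RN) (swap RO)

-- Induction on the derivation. The constructors `now` and `later` carry the negated premise that no
-- reduction is due, so S and S′ must be related in both directions even for this one-sided
-- conclusion.
Nσ-fwd : (c : Correspondence G G′) {S : SepSet (∣V∣ G)} {S′ : SepSet (∣V∣ G′)}
         {𝒫 : Family (∣V∣ G)} {𝒫′ : Family (∣V∣ G′)} →
         ∀ σ → Rel c S S′ → FamRel c 𝒫 𝒫′ → Fwd c (Nσ G σ S 𝒫) (Nσ G′ σ S′ 𝒫′)
Nσ-fwd {G} {G′} c {S} {S′} {𝒫} {𝒫′} σ RS R𝒫 s s′ e = go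
  where
  open Correspondence c
  R-rel = reduction-rel c {𝒫 = 𝒫} {𝒫′} RS R𝒫
  N = applyOp (op σ 0) S 𝒫
  N′ = applyOp (op σ 0) S′ 𝒫′
  N-rel = applyOp-rel c {𝒫 = 𝒫} {𝒫′} (op σ 0) RS R𝒫
  nonempty : U.Satisfiable S → U.Satisfiable S′
  nonempty (r , Sr) = toₛ r , proj₁ RS r _ (toₛ≈ r) Sr
  reduces : Reduces G σ S 𝒫 → Reduces G′ σ S′ 𝒫′
  reduces (red , _ , S⊈R) = red , proj₁ , λ S′⊆R′ → S⊈R λ {r} Sr →
    proj₂ R-rel _ _ (toₛ≈ r) (S′⊆R′ (proj₁ RS _ _ (toₛ≈ r) Sr))
  reduces⁻ : Reduces G′ σ S′ 𝒫′ → Reduces G σ S 𝒫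
  reduces⁻ (red , _ , S⊈R) = red , proj₁ , λ S⊆R → S⊈R λ {r} S′r →
    proj₁ R-rel _ _ (fromₛ≈ r) (S⊆R (proj₂ RS _ _ (fromₛ≈ r) S′r))
  go : Nσ G σ S 𝒫 s → Nσ G′ σ S′ 𝒫′ s′
  go (reduce ne red d) = reduce (nonempty ne) (reduces red) (Nσ-fwd c σ R-rel R𝒫 s s′ e d)
  go (now ne ¬red d) = now (nonempty ne) (¬red ∘ reduces⁻) (proj₁ N-rel s s′ e d)
  go (later ne ¬red O con d) = later (nonempty ne) (¬red ∘ reduces⁻) (push c O)
    (consOrient-fwd c N-rel O _ (push-rel c O) con)
    (Nσ-fwd c (σ ⁺) (splitters-rel c O (push c O) RS (push-rel c O))
       (inducing-rel c {N} {N′} {𝒫} {𝒫′} O (push c O) R𝒫 N-rel (push-rel c O)) s s′ e d)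

-- Tasks and strategies

module Tasks (G : Graph) where

  private
    ∣G∣ = ∣V∣ G

  ≐⇒Rel : {S S′ : SepSet ∣G∣} → S U.≐ S′ → Rel (identity G) S S′
  ≐⇒Rel (f , g) = (λ { _ _ (refl , refl) → f }) , (λ { _ _ (refl , refl) → g })

  Rel⇒≐ : {S S′ : SepSet ∣G∣} → Rel (identity G) S S′ → S U.≐ S′
  Rel⇒≐ (f , g) = (λ {s} → f s s (refl , refl)) , (λ {s} → g s s (refl , refl))

  Ext⇒FamRel : {𝒫 : Family ∣G∣} → Extensional 𝒫 → FamRel (identity G) 𝒫 𝒫
  Ext⇒FamRel e = (λ P P′ R → e P P′ (Rel⇒≐ R)) , (λ P′ P R → e P′ P (≐-sym (Rel⇒≐ {⟦ P ⟧} {⟦ P′ ⟧} (swap R))))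

  Rel-refl : {S : SepSet ∣G∣} → Rel (identity G) S S
  Rel-refl = ≐⇒Rel (id , id)

  Consistent? : {P : SepSet ∣G∣} → U.Decidable P → Dec (Consistent G P)
  Consistent? P? = ∀Sep? λ s → ∀Sep? λ r →
    P? s →-dec (IsSeparation? G r →-dec ((r ≤ₛ? s) →-dec ¬? (P? (swap r))))

  Splits? : {O : SepSet ∣G∣} → U.Decidable O → U.Decidable (λ s → Splits G s O)
  Splits? O? s = Consistent? (λ r → O? r ⊎-dec (s ≟ₛ r)) ×-dec Consistent? (λ r → O? r ⊎-dec (swap s ≟ₛ r))

  record IsOrientation (N O : SepSet ∣G∣) : Set where
    field
      sub        : ∀ {s} → O s → N s
      total      : ∀ {s} → N s → O s ⊎ O (swap s)
      consistent : Consistent G O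

  consOrient⇒orientation : {N : SepSet ∣G∣} (O : DecSepSet ∣G∣) → ConsistentOrientations G N O → IsOrientation N ⟦ O ⟧
  consOrient⇒orientation O (con , P , (anti , tot) , (f , g)) = record
    { sub = proj₂ ∘ f
    ; total = λ {s} Ns → Sum.map (λ Ps → g (Ps , Ns)) g (tot s Ns)
    ; consistent = con }

  ≐-or-differ : {N : SepSet ∣G∣} (O O′ : DecSepSet ∣G∣) → IsOrientation N ⟦ O ⟧ → IsOrientation N ⟦ O′ ⟧ →
                ⟦ O ⟧ U.≐ ⟦ O′ ⟧ ⊎ (∃[ s ] ⟦ O ⟧ s × ⟦ O′ ⟧ (swap s))
  ≐-or-differ O O′ o o′ with ∃Sep? {Q = λ s → ⟦ O ⟧ s × ⟦ O′ ⟧ (swap s)} (λ s → T? (O s) ×-dec T? (O′ (swap s)))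
  ... | yes d = inj₂ d
  ... | no ¬d = inj₁ ( (λ {s} Os → [ id , (λ O′s → ⊥-elim (¬d (s , Os , O′s))) ]′ (IsOrientation.total o′ (IsOrientation.sub o Os)))
                     , (λ {s} O′s → [ id , (λ Os → ⊥-elim (¬d (swap s , Os , O′s))) ]′ (IsOrientation.total o (IsOrientation.sub o′ O′s))))

  -- If s or its inverse were below t, consistency with t would forbid one of the two ways of
  -- orienting s.
  splitter-above : ∀ {O s t} → IsSeparation G s → Nested s t → O t → Splits G s O → t ≤ₛ s ⊎ t ≤ₛ swap s
  splitter-above {s = s} {t} sep (≤n s≤t)  Ot (_ , con) = ⊥-elim (con t s (inj₁ Ot) sep s≤t (inj₂ refl))
  splitter-above {s = s} {t} sep (≥n t≤s)  Ot _         = inj₁ t≤s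
  splitter-above {s = s} {t} sep (≤sn s≤t) Ot _         = inj₂ (swap-anti s≤t)
  splitter-above {s = s} {t} sep (≥sn t≤s) Ot (con , _) = ⊥-elim (con t (swap s) (inj₁ Ot) (swap-separation G s sep) (swap-anti t≤s) (inj₂ refl))

  -- The separation t lies between the two: up to inversion, t is below s and its inverse is below
  -- s′.
  splitters-nested : ∀ {O O′ s s′ t} → IsSeparation G s → IsSeparation G s′ → Nested s t → Nested s′ t →
                     O t → O′ (swap t) → Splits G s O → Splits G s′ O′ → Nested s s′
  splitters-nested {O} {O′} sep sep′ nst nst′ Ot O′t sp sp′
    with splitter-above {O} sep nst Ot sp | splitter-above {O′} sep′ (Nested-swapʳ nst′) O′t sp′
  ... | inj₁ a | inj₁ b = ≥sn (≤ₛ-trans (swap-anti b) a)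
  ... | inj₁ a | inj₂ b = ≥n (≤ₛ-trans (swap-anti b) a)
  ... | inj₂ a | inj₁ b = ≤n (≤ₛ-trans (swap-anti a) b)
  ... | inj₂ a | inj₂ b = ≤sn (≤ₛ-trans (swap-anti a) b)

  -- The oriented form of `Distinguishes`. The non-memberships are left out because they follow for
  -- profiles, which are antisymmetric.
  Dist : Sep ∣G∣ → SepSet ∣G∣ → SepSet ∣G∣ → Set
  Dist s P Q = P s × Q (swap s)

  module _ {P : SepSet ∣G∣} (prof : IsProfile G P) where
    open IsProfile prof

    profile-anti : ∀ {s} → P s → ¬ P (swap s)
    profile-anti {s} Ps = consistent s s Ps (separations s Ps) ≤ₛ-refl

  module _ {P Q : SepSet ∣G∣} (p : IsProfile G P) (q : IsProfile G Q) where

    Dist⇒Distinguishes : ∀ {s} → Dist s P Q → Distinguishes s P Q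
    Dist⇒Distinguishes {s} (Ps , Qs) = inj₁ ((Ps , λ Qs′ → profile-anti q Qs′ Qs) , (Qs , profile-anti p Ps))

  Distinguishes⇒Dist : {P Q : SepSet ∣G∣} → ∀ {s} → Distinguishes s P Q → Dist s P Q ⊎ Dist (swap s) P Q
  Distinguishes⇒Dist (inj₁ ((Ps , _) , (Qs , _))) = inj₁ (Ps , Qs)
  Distinguishes⇒Dist (inj₂ ((Qs , _) , (Ps , _))) = inj₂ (Ps , Qs)

  Distinguishes-swap : {P Q : SepSet ∣G∣} → ∀ {s} → Distinguishes s P Q → Distinguishes (swap s) P Q
  Distinguishes-swap (inj₁ (a , b)) = inj₂ (b , a)
  Distinguishes-swap (inj₂ (a , b)) = inj₁ (b , a)

  -- Adding s to O stays inside P and adding its inverse stays inside Q, and consistency passes to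
  -- subsets.
  Dist-splits : {P Q O : SepSet ∣G∣} → IsProfile G P → IsProfile G Q → (∀ {s} → O s → P s) → (∀ {s} → O s → Q s) →
                ∀ {s} → Dist s P Q → Splits G s O
  Dist-splits {P} {Q} {O} p q O⊆P O⊆Q {s} (Ps , Qs) =
    (λ t r t∈ sep r≤t r∈ → IsProfile.consistent p t r (inP t∈) sep r≤t (inP r∈)) ,
    (λ t r t∈ sep r≤t r∈ → IsProfile.consistent q t r (inQ t∈) sep r≤t (inQ r∈))
    where
    inP : ∀ {t} → (O U.∪ U.｛ s ｝) t → P t
    inP (inj₁ Ot)   = O⊆P Ot
    inP (inj₂ refl) = Ps
    inQ : ∀ {t} → (O U.∪ U.｛ swap s ｝) t → Q t
    inQ (inj₁ Ot)   = O⊆Q Ot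
    inQ (inj₂ refl) = Qs

  Distinguishes? : (P Q : DecSepSet ∣G∣) → ∀ s → Dec (Distinguishes s ⟦ P ⟧ ⟦ Q ⟧)
  Distinguishes? P Q s = (dif P Q s ×-dec dif Q P (swap s)) ⊎-dec (dif Q P s ×-dec dif P Q (swap s))
    where
    dif : ∀ P Q s → Dec ((⟦ P ⟧ U.∖ ⟦ Q ⟧) s)
    dif P Q s = T? (P s) ×-dec ¬? (T? (Q s))

  Maximal? : {S : SepSet ∣G∣} → U.Decidable S → U.Decidable (Maximal S)
  Maximal? S? s = S? s ×-dec ∀Sep? (λ r → S? r →-dec ((s ≤ₛ? r) →-dec (r ≟ₛ s)))

  Extremal? : {S : SepSet ∣G∣} → U.Decidable S → U.Decidable (Extremal S)
  Extremal? S? s = S? s ×-dec ∀Sep? (λ r → S? r →-dec ((r ≤ₛ? s) ⊎-dec (swap r ≤ₛ? s)))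

  SwapClosed : SepSet ∣G∣ → Set
  SwapClosed S = ∀ s → S s → S (swap s)

  -- The finiteness data and the paper's feasible tasks; distinctness of two
  -- profiles is stated positively.
  record Task (S : SepSet ∣G∣) (𝒫 : Family ∣G∣) : Set₁ where
    field
      S?            : U.Decidable S
      𝒫?            : U.Decidable 𝒫
      𝒫-ext         : Extensional 𝒫
      S-sep         : ∀ {s} → S s → IsSeparation G s
      S-swap        : SwapClosed S
      profiles      : ∀ P → 𝒫 P → IsProfile G ⟦ P ⟧
      orients       : ∀ P → 𝒫 P → ∀ {s} → S s → ⟦ P ⟧ s ⊎ ⟦ P ⟧ (swap s)
      distinguishes : ∀ P Q → 𝒫 P → 𝒫 Q → ⟦ P ⟧ U.≐ ⟦ Q ⟧ ⊎ ∃[ s ] S s × Dist s ⟦ P ⟧ ⟦ Q ⟧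
      feasible      : ∀ P Q → 𝒫 P → 𝒫 Q → ∀ {s r} → S s → S r → ¬ Nested s r →
                      Dist s ⟦ P ⟧ ⟦ Q ⟧ → Dist r ⟦ P ⟧ ⟦ Q ⟧ →
                      ∃[ e ] S e × ⟦ P ⟧ e × s ≤ₛ e × r ≤ₛ e

    -- Shows that the separation provided by feasibility distinguishes the same two profiles. Hence
    -- it survives reduction and the passage to splitters, and both keep a task feasible.
    Dist-up : ∀ P Q → 𝒫 P → 𝒫 Q → ∀ {s e} → S e → Dist s ⟦ P ⟧ ⟦ Q ⟧ → ⟦ P ⟧ e → s ≤ₛ e → Dist e ⟦ P ⟧ ⟦ Q ⟧
    Dist-up P Q 𝒫P 𝒫Q {s} {e} Se (Ps , Qs) Pe s≤e with orients Q 𝒫Q Se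
    ... | inj₂ Qe = Pe , Qe
    ... | inj₁ Qe = ⊥-elim (IsProfile.consistent (profiles Q 𝒫Q) (swap s) (swap e) Qs (swap-separation G e (S-sep Se)) (swap-anti s≤e) Qe)

  reduction-swap : {S : SepSet ∣G∣} {𝒫 : Family ∣G∣} → SwapClosed S → SwapClosed (reduction S 𝒫)
  reduction-swap S-swap s (Ss , P , Q , 𝒫P , 𝒫Q , dist) = S-swap _ Ss , P , Q , 𝒫P , 𝒫Q , Distinguishes-swap {⟦ P ⟧} {⟦ Q ⟧} dist

  distinguished-ext : {𝒫 : Family ∣G∣} → Extensional 𝒫 → ∀ s P →
                      Extensional (λ Q → 𝒫 P × 𝒫 Q × Distinguishes s ⟦ P ⟧ ⟦ Q ⟧)
  distinguished-ext e s P Q Q′ eq (𝒫P , 𝒫Q , d) = 𝒫P , e Q Q′ eq 𝒫Q ,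
    distinguishes-fwd (identity G) {⟦ P ⟧} {⟦ Q ⟧} {⟦ P ⟧} {⟦ Q′ ⟧} Rel-refl (≐⇒Rel eq) s s (refl , refl) d

  reduction? : {S : SepSet ∣G∣} {𝒫 : Family ∣G∣} → U.Decidable S → U.Decidable 𝒫 → Extensional 𝒫 → U.Decidable (reduction S 𝒫)
  reduction? {𝒫 = 𝒫} S? 𝒫? e s = S? s ×-dec
    ∃DecSepSet? (λ { P P′ eq (Q , 𝒫P , 𝒫Q , d) → Q , e P P′ eq 𝒫P , 𝒫Q ,
                     distinguishes-fwd (identity G) {⟦ P ⟧} {⟦ Q ⟧} {⟦ P′ ⟧} {⟦ Q ⟧} (≐⇒Rel eq) Rel-refl s s (refl , refl) d })
    λ P → ∃DecSepSet? (distinguished-ext e s P) λ Q → 𝒫? P ×-dec (𝒫? Q ×-dec Distinguishes? P Q s)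

  inducing-ext : {N : SepSet ∣G∣} {𝒫 : Family ∣G∣} → Extensional 𝒫 → ∀ O → Extensional (inducing G 𝒫 N O)
  inducing-ext {𝒫 = 𝒫} 𝒫-ext O P P′ eq =
    proj₁ (inducing-rel (identity G) {𝒫 = 𝒫} {𝒫} O O (Ext⇒FamRel 𝒫-ext) Rel-refl Rel-refl) P P′ (≐⇒Rel eq)

  inducing? : {N : SepSet ∣G∣} {𝒫 : Family ∣G∣} → U.Decidable 𝒫 → U.Decidable N → ∀ O → U.Decidable (inducing G 𝒫 N O)
  inducing? 𝒫? N? O P = 𝒫? P ×-dec ((λ s → T? (P s) ×-dec N? s) ≐? (λ s → T? (O s)))

  module _ {S : SepSet ∣G∣} {𝒫 : Family ∣G∣} (task : Task S 𝒫) where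
    open Task task

    reduction⁺ : ∀ {s} → S s → ∀ P Q → 𝒫 P → 𝒫 Q → Dist s ⟦ P ⟧ ⟦ Q ⟧ → reduction S 𝒫 s
    reduction⁺ Ss P Q 𝒫P 𝒫Q d = Ss , P , Q , 𝒫P , 𝒫Q , Dist⇒Distinguishes (profiles P 𝒫P) (profiles Q 𝒫Q) d

    reduction⁻ : ∀ {s} → reduction S 𝒫 s → ∃₂ λ P Q → 𝒫 P × 𝒫 Q × Dist s ⟦ P ⟧ ⟦ Q ⟧
    reduction⁻ (_ , P , Q , 𝒫P , 𝒫Q , d) with Distinguishes⇒Dist {⟦ P ⟧} {⟦ Q ⟧} d
    ... | inj₁ d′ = P , Q , 𝒫P , 𝒫Q , d′
    ... | inj₂ (Ps , Qs) = Q , P , 𝒫Q , 𝒫P , Qs , Ps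

    reduction-task : Task (reduction S 𝒫) 𝒫
    reduction-task = record
      { S? = reduction? S? 𝒫? 𝒫-ext ; 𝒫? = 𝒫? ; 𝒫-ext = 𝒫-ext ; S-sep = S-sep ∘ proj₁
      ; S-swap = reduction-swap S-swap
      ; profiles = profiles ; orients = λ P 𝒫P → orients P 𝒫P ∘ proj₁
      ; distinguishes = λ P Q 𝒫P 𝒫Q → Sum.map₂ (λ (s , Ss , d) → s , reduction⁺ Ss P Q 𝒫P 𝒫Q d , d) (distinguishes P Q 𝒫P 𝒫Q)
      ; feasible = λ P Q 𝒫P 𝒫Q (Ss , _) (Sr , _) cr ds dr →
          let e , Se , Pe , s≤e , r≤e = feasible P Q 𝒫P 𝒫Q Ss Sr cr ds dr
          in e , reduction⁺ Se P Q 𝒫P 𝒫Q (Dist-up P Q 𝒫P 𝒫Q Se ds Pe s≤e) , Pe , s≤e , r≤e }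

    module _ {N : SepSet ∣G∣} (N? : U.Decidable N) (O : DecSepSet ∣G∣) (con : ConsistentOrientations G N O) where

      splitters⁺ : ∀ P Q → inducing G 𝒫 N O P → inducing G 𝒫 N O Q → ∀ {s} → S s → Dist s ⟦ P ⟧ ⟦ Q ⟧ → splitters G S O s
      splitters⁺ P Q (𝒫P , _ , p) (𝒫Q , _ , q) Ss d = Ss , Dist-splits (profiles P 𝒫P) (profiles Q 𝒫Q) (proj₁ ∘ p) (proj₁ ∘ q) d

      splitters-task : Task (splitters G S O) (inducing G 𝒫 N O)
      splitters-task = record
        { S? = λ s → S? s ×-dec Splits? (λ s → T? (O s)) s
        ; 𝒫? = inducing? 𝒫? N? O ; 𝒫-ext = inducing-ext 𝒫-ext O ; S-sep = S-sep ∘ proj₁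
        ; S-swap = λ _ (Ss , a , b) → S-swap _ Ss , b , a
        ; profiles = λ P → profiles P ∘ proj₁
        ; orients = λ P (𝒫P , _) → orients P 𝒫P ∘ proj₁
        ; distinguishes = λ P Q p q → Sum.map₂ (λ (s , Ss , d) → s , splitters⁺ P Q p q Ss d , d)
                            (distinguishes P Q (proj₁ p) (proj₁ q))
        ; feasible = λ P Q p q (Ss , _) (Sr , _) cr ds dr →
            let e , Se , Pe , s≤e , r≤e = feasible P Q (proj₁ p) (proj₁ q) Ss Sr cr ds dr
            in e , splitters⁺ P Q p q Se (Dist-up P Q (proj₁ p) (proj₁ q) Se ds Pe s≤e) , Pe , s≤e , r≤e }

    -- Orient r by P and go up to a maximal element m. As s and m are nested and both maximal in the
    -- consistent set P, they coincide or point towards each other, and r inherits nestedness with s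
    -- from m.
    locallyMaximal⇒nested : ∀ {s} → LocallyMaximal S 𝒫 s → S s × NestedWith S s
    locallyMaximal⇒nested {s} (P , 𝒫P , ws , max@((Ps , Ss) , maxˢ)) = Ss , λ r Sr →
      [ nested Sr , Nested-swapʳ ∘ nested (S-swap _ Sr) ]′ (orients P 𝒫P Sr)
      where
      nested : ∀ {r} → S r → ⟦ P ⟧ r → Nested s r
      nested {r} Sr Pr with ∃-maximal (λ t → T? (P t) ×-dec S? t) r (Pr , Sr)
      ... | m , max′@((Pm , Sm) , maxᵐ) , r≤m with ws s m max max′
      ...   | ≤n s≤m  = ≥n (subst (r ≤ₛ_) (maxˢ m (Pm , Sm) s≤m) r≤m)
      ...   | ≥n m≤s  = ≥n (≤ₛ-trans r≤m m≤s)
      ...   | ≤sn s≤m = ≤sn (swap-anti (≤ₛ-trans r≤m (swap-anti s≤m)))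
      ...   | ≥sn m≤s = ⊥-elim (IsProfile.consistent (profiles P 𝒫P) s (swap m) Ps (S-sep (S-swap _ Sm)) m≤s Pm)

    extremal⇒nested : ∀ {s} → Extremal S s → S s × NestedWith S s
    extremal⇒nested (Ss , e) = Ss , λ r Sr → [ ≥n , ≥sn ]′ (e r Sr)

    swap⇒nested : ∀ {s} → S (swap s) × NestedWith S (swap s) → S s × NestedWith S s
    swap⇒nested (Ss , nst) = S-swap _ Ss , λ r Sr → Nested-swapˡ (nst r Sr)

    module _ (reduced : ∀ {s} → S s → reduction S 𝒫 s) where

      -- If m crossed some r and both distinguished a common pair of profiles, feasibility would
      -- give an element of S above both; by maximality it would be m itself, which would then be
      -- above r.
      maximal⇒extremal : ∀ {m} → Maximal S m → Extremal S m
      maximal⇒extremal {m} (Sm , max) = Sm , above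
        where
        nested-case : ∀ {r} → S r → Nested m r → r ≤ₛ m ⊎ swap r ≤ₛ m
        nested-case Sr (≤n m≤r) with refl ← max _ Sr m≤r = inj₁ ≤ₛ-refl
        nested-case Sr (≥n r≤m) = inj₁ r≤m
        nested-case Sr (≤sn m≤r) with refl ← max _ (S-swap _ Sr) m≤r = inj₂ ≤ₛ-refl
        nested-case Sr (≥sn r≤m) = inj₂ r≤m

        not-crossing : ∀ {r} → S r → ¬ Nested m r → ∀ P Q → 𝒫 P → 𝒫 Q → ¬ (Dist m ⟦ P ⟧ ⟦ Q ⟧ × Dist r ⟦ P ⟧ ⟦ Q ⟧)
        not-crossing Sr cr P Q 𝒫P 𝒫Q (dm , dr) with feasible P Q 𝒫P 𝒫Q Sm Sr cr dm dr
        ... | e , Se , Pe , m≤e , r≤e with refl ← max e Se m≤e = cr (≥n r≤e)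

        -- A common pair always exists: if P and P′ orient r alike, one of Q and Q′ orients r the
        -- other way, and by its orientation of m that profile differs on m from P or from P′.
        crossing-case : ∀ {r} → S r → ¬ ¬ Nested m r
        crossing-case {r} Sr cr with reduction⁻ (reduced Sm) | reduction⁻ (reduced Sr)
        ... | P , P′ , 𝒫P , 𝒫P′ , Pm , P′m | Q , Q′ , 𝒫Q , 𝒫Q′ , Qr , Q′r
          with orients P 𝒫P Sr | orients P′ 𝒫P′ Sr
        ... | inj₁ Pr | inj₂ P′r = not-crossing Sr cr P P′ 𝒫P 𝒫P′ ((Pm , P′m) , Pr , P′r)
        ... | inj₂ Pr | inj₁ P′r = not-crossing (S-swap _ Sr) (cr ∘ Nested-swapʳ) P P′ 𝒫P 𝒫P′ ((Pm , P′m) , Pr , P′r)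
        ... | inj₁ Pr | inj₁ P′r with orients Q′ 𝒫Q′ Sm
        ...   | inj₁ Q′m = not-crossing (S-swap _ Sr) (cr ∘ Nested-swapʳ) Q′ P′ 𝒫Q′ 𝒫P′ ((Q′m , P′m) , Q′r , P′r)
        ...   | inj₂ Q′m = not-crossing Sr cr P Q′ 𝒫P 𝒫Q′ ((Pm , Q′m) , Pr , Q′r)
        crossing-case {r} Sr cr | P , P′ , 𝒫P , 𝒫P′ , Pm , P′m | Q , Q′ , 𝒫Q , 𝒫Q′ , Qr , Q′r
          | inj₂ Pr | inj₂ P′r with orients Q 𝒫Q Sm
        ...   | inj₁ Qm = not-crossing Sr cr Q P′ 𝒫Q 𝒫P′ ((Qm , P′m) , Qr , P′r)
        ...   | inj₂ Qm = not-crossing (S-swap _ Sr) (cr ∘ Nested-swapʳ) P Q 𝒫P 𝒫Q ((Pm , Qm) , Pr , Qr)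

        above : ∀ r → S r → r ≤ₛ m ⊎ swap r ≤ₛ m
        above r Sr = nested-case Sr (decidable-stable (Nested? m r) (crossing-case Sr))

      -- Any profile P containing s has s as the greatest element of its orientation of S. So s is
      -- the only maximal element there, and P is trivially well separated.
      extremal⇒locallyMaximal : ∀ {s} → Extremal S s → LocallyMaximal S 𝒫 s
      extremal⇒locallyMaximal {s} (Ss , above) with reduction⁻ (reduced Ss)
      ... | P , _ , 𝒫P , _ , Ps , _ = P , 𝒫P , ws , (Ps , Ss) , λ r Pr s≤r → ≤ₛ-antisym (below Pr) s≤r
        where
        below : ∀ {r} → (⟦ P ⟧ U.∩ S) r → r ≤ₛ s
        below {r} (Pr , Sr) with above r Sr
        ... | inj₁ r≤s = r≤s
        ... | inj₂ r≤s = ⊥-elim (IsProfile.consistent (profiles P 𝒫P) s (swap r) Ps (S-sep (S-swap _ Sr)) r≤s Pr)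
        unique : ∀ {r} → Maximal (⟦ P ⟧ U.∩ S) r → s ≡ r
        unique (Pr , max) = max s (Ps , Ss) (below Pr)
        ws : WellSeparated ⟦ P ⟧ S
        ws t r mt mr with refl ← unique mt | refl ← unique mr = ≤n ≤ₛ-refl

  op⇒nested : {S : SepSet ∣G∣} {𝒫 : Family ∣G∣} → Task S 𝒫 → ∀ o → ¬ IsReduced o → ∀ {s} → applyOp o S 𝒫 s → S s × NestedWith S s
  op⇒nested task ext _ = [ extremal⇒nested task , swap⇒nested task ∘ extremal⇒nested task ]′
  op⇒nested task loc _ = [ locallyMaximal⇒nested task , swap⇒nested task ∘ locallyMaximal⇒nested task ]′
  op⇒nested task all _ = id
  op⇒nested task extᵣ ¬r = ⊥-elim (¬r tt)
  op⇒nested task locᵣ ¬r = ⊥-elim (¬r tt)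
  op⇒nested task allᵣ ¬r = ⊥-elim (¬r tt)

  op⇒reduced-nested : {S : SepSet ∣G∣} {𝒫 : Family ∣G∣} → Task S 𝒫 → ∀ o → IsReduced o → ∀ {s} → applyOp o S 𝒫 s →
                      reduction S 𝒫 s × NestedWith (reduction S 𝒫) s
  op⇒reduced-nested task extᵣ _ = op⇒nested (reduction-task task) ext λ ()
  op⇒reduced-nested task locᵣ _ = op⇒nested (reduction-task task) loc λ ()
  op⇒reduced-nested {S} {𝒫} task allᵣ _ = op⇒nested {𝒫 = 𝒫} (reduction-task task) all λ ()

  op-nonempty : {S : SepSet ∣G∣} {𝒫 : Family ∣G∣} → Task S 𝒫 → ∀ o → IsReduced o → (∀ {s} → S s → reduction S 𝒫 s) →
                U.Satisfiable S → U.Satisfiable (applyOp o S 𝒫)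
  op-nonempty {S} {𝒫} task o red S⊆R (s , Ss) = go o red
    where
    task′ = reduction-task task
    R⊆RR : ∀ {s} → reduction S 𝒫 s → reduction (reduction S 𝒫) 𝒫 s
    R⊆RR (Ss , w) = (Ss , w) , w
    max = ∃-maximal (Task.S? task′) s (S⊆R Ss)
    m = proj₁ max
    extremal : Extremal (reduction S 𝒫) m
    extremal = maximal⇒extremal task′ R⊆RR (proj₁ (proj₂ max))
    go : ∀ o → IsReduced o → U.Satisfiable (applyOp o S 𝒫)
    go extᵣ _ = m , inj₁ extremal
    go locᵣ _ = m , inj₁ (extremal⇒locallyMaximal task′ R⊆RR extremal)
    go allᵣ _ = m , extremal⇒nested task′ extremal

  op⊆ : {S : SepSet ∣G∣} {𝒫 : Family ∣G∣} → SwapClosed S → ∀ o {s} → applyOp o S 𝒫 s → S s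
  op⊆ S-swap ext = [ proj₁ , S-swap _ ∘ proj₁ ]′
  op⊆ S-swap loc = [ (λ (_ , _ , _ , (_ , Ss) , _) → Ss) , (λ (_ , _ , _ , (_ , Ss) , _) → S-swap _ Ss) ]′
  op⊆ S-swap all = proj₁
  op⊆ {𝒫 = 𝒫} S-swap extᵣ = proj₁ ∘ op⊆ {𝒫 = 𝒫} (reduction-swap S-swap) ext
  op⊆ {𝒫 = 𝒫} S-swap locᵣ = proj₁ ∘ op⊆ {𝒫 = 𝒫} (reduction-swap S-swap) loc
  op⊆ {𝒫 = 𝒫} S-swap allᵣ = proj₁ ∘ op⊆ {𝒫 = 𝒫} (reduction-swap S-swap) all

  op-swap : {S : SepSet ∣G∣} {𝒫 : Family ∣G∣} → SwapClosed S → ∀ o {s} → applyOp o S 𝒫 s → applyOp o S 𝒫 (swap s)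
  op-swap S-swap ext = Sum.swap
  op-swap S-swap loc = Sum.swap
  op-swap S-swap all (Ss , nst) = S-swap _ Ss , λ r Sr → Nested-swapˡ (nst r Sr)
  op-swap S-swap extᵣ = Sum.swap
  op-swap S-swap locᵣ = Sum.swap
  op-swap {𝒫 = 𝒫} S-swap allᵣ = op-swap {𝒫 = 𝒫} (reduction-swap S-swap) all

  Nσ⊆ : {S : SepSet ∣G∣} {𝒫 : Family ∣G∣} → SwapClosed S → ∀ {σ s} → Nσ G σ S 𝒫 s → S s
  Nσ⊆ S-swap (reduce _ _ d) = proj₁ (Nσ⊆ (reduction-swap S-swap) d)
  Nσ⊆ {𝒫 = 𝒫} S-swap {σ} (now _ _ d) = op⊆ {𝒫 = 𝒫} S-swap (op σ 0) d
  Nσ⊆ S-swap (later _ _ O _ d) = proj₁ (Nσ⊆ (λ _ (Ss , a , b) → S-swap _ Ss , b , a) d)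

  Nσ-swap : {S : SepSet ∣G∣} {𝒫 : Family ∣G∣} → SwapClosed S → ∀ {σ s} → Nσ G σ S 𝒫 s → Nσ G σ S 𝒫 (swap s)
  Nσ-swap S-swap (reduce ne red d) = reduce ne red (Nσ-swap (reduction-swap S-swap) d)
  Nσ-swap {𝒫 = 𝒫} S-swap {σ} (now ne ¬red d) = now ne ¬red (op-swap {𝒫 = 𝒫} S-swap (op σ 0) d)
  Nσ-swap S-swap (later ne ¬red O con d) = later ne ¬red O con (Nσ-swap (λ _ (Ss , a , b) → S-swap _ Ss , b , a) d)

  applyOp? : {S : SepSet ∣G∣} {𝒫 : Family ∣G∣} → U.Decidable S → U.Decidable 𝒫 → Extensional 𝒫 → ∀ o → U.Decidable (applyOp o S 𝒫)
  applyOp? S? 𝒫? e ext s = Extremal? S? s ⊎-dec Extremal? S? (swap s)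
  applyOp? {S} {𝒫} S? 𝒫? e loc s = locallyMaximal? s ⊎-dec locallyMaximal? (swap s)
    where
    Max? : ∀ P → U.Decidable (Maximal (⟦ P ⟧ U.∩ S))
    Max? P = Maximal? (λ t → T? (P t) ×-dec S? t)
    locallyMaximal? : U.Decidable (LocallyMaximal S 𝒫)
    locallyMaximal? s = ∃DecSepSet?
      (λ { P P′ eq (𝒫P , ws , max) → e P P′ eq 𝒫P , wellSeparated-fwd (identity G) {⟦ P ⟧} (≐⇒Rel eq) Rel-refl ws ,
           maximal-fwd (identity G) (∩-rel (identity G) {⟦ P ⟧} {S} {⟦ P′ ⟧} {S} (≐⇒Rel eq) Rel-refl) s s (refl , refl) max })
      λ P → 𝒫? P ×-dec ((∀Sep? λ t → ∀Sep? λ r → Max? P t →-dec (Max? P r →-dec Nested? t r)) ×-dec Max? P s)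
  applyOp? S? 𝒫? e all s = S? s ×-dec ∀Sep? (λ r → S? r →-dec Nested? s r)
  applyOp? S? 𝒫? e extᵣ = applyOp? (reduction? S? 𝒫? e) 𝒫? e ext
  applyOp? S? 𝒫? e locᵣ = applyOp? (reduction? S? 𝒫? e) 𝒫? e loc
  applyOp? S? 𝒫? e allᵣ = applyOp? (reduction? S? 𝒫? e) 𝒫? e all

  IsReduced? : ∀ o → Dec (IsReduced o)
  IsReduced? ext  = no λ ()
  IsReduced? loc  = no λ ()
  IsReduced? all  = no λ ()
  IsReduced? extᵣ = yes tt
  IsReduced? locᵣ = yes tt
  IsReduced? allᵣ = yes tt

-- Solving feasible tasks by recursion

module Solutions (G : Graph) where

  open Tasks G

  private
    ∣G∣ = ∣V∣ G

  -- Decidability is part of the invariant because the next stage searches for elements of the set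
  -- just constructed and for orientations of it.
  record Solved (σ : Strategy) (S : SepSet ∣G∣) (𝒫 : Family ∣G∣) : Set₁ where
    field
      dec           : U.Decidable (Nσ G σ S 𝒫)
      nested        : ∀ {s r} → Nσ G σ S 𝒫 s → Nσ G σ S 𝒫 r → Nested s r
      distinguishes : ∀ P Q → 𝒫 P → 𝒫 Q → ⟦ P ⟧ U.≐ ⟦ Q ⟧ ⊎ ∃[ s ] Nσ G σ S 𝒫 s × Dist s ⟦ P ⟧ ⟦ Q ⟧

  consOrient-ext : (N : SepSet ∣G∣) → Extensional (ConsistentOrientations G N)
  consOrient-ext N P Q eq = consOrient-fwd (identity G) {N} {N} Rel-refl P Q (≐⇒Rel eq)

  consOrient? : {N : SepSet ∣G∣} → U.Decidable N → U.Decidable (ConsistentOrientations G N)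
  consOrient? {N} N? O = Consistent? (λ s → T? (O s)) ×-dec ∃DecSepSet? orients-ext λ P →
      ((∀Sep? λ s → T? (P s) →-dec ¬? (T? (P (swap s)))) ×-dec
       (∀Sep? λ s → N? s →-dec (T? (P s) ⊎-dec (T? (P (swap s)) ×-dec N? (swap s))))) ×-dec
      ((λ s → T? (O s)) ≐? (λ s → T? (P s) ×-dec N? s))
    where
    orients-ext : Extensional (λ P → Orients ⟦ P ⟧ N × ⟦ O ⟧ U.≐ ⟦ P ⟧ U.∩ N)
    orients-ext P Q eq (o , e) = orients-fwd (identity G) {⟦ P ⟧} {N} {⟦ Q ⟧} {N} (≐⇒Rel eq) Rel-refl o ,
      ((λ Os → let Ps , Ns = proj₁ e Os in proj₁ eq Ps , Ns) , (λ (Qs , Ns) → proj₂ e (proj₂ eq Qs , Ns)))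

  orientation⇒consOrient : {N : SepSet ∣G∣} (O : DecSepSet ∣G∣) → (∀ {s} → N s → IsSeparation G s) → SwapClosed N →
                           IsOrientation N ⟦ O ⟧ → ConsistentOrientations G N O
  orientation⇒consOrient O N-sep N-swap o = consistent , O ,
    ((λ s Os → consistent s s Os (N-sep (sub Os)) ≤ₛ-refl) ,
     (λ s Ns → Sum.map₂ (λ Os → Os , N-swap s Ns) (total Ns))) ,
    ((λ Os → Os , sub Os) , proj₁)
    where open IsOrientation o

  profile-orients : {N : SepSet ∣G∣} (N? : U.Decidable N) (P : DecSepSet ∣G∣) → IsProfile G ⟦ P ⟧ →
                    (∀ {s} → N s → ⟦ P ⟧ s ⊎ ⟦ P ⟧ (swap s)) → SwapClosed N →
                    IsOrientation N ⟦ decSet (λ s → T? (P s) ×-dec N? s) ⟧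
  profile-orients {N} N? P prof tot N-swap = record
    { sub = proj₂ ∘ decSet⁻ O?
    ; total = λ {s} Ns → Sum.map (λ Ps → decSet⁺ O? (Ps , Ns)) (λ Ps → decSet⁺ O? (Ps , N-swap s Ns)) (tot Ns)
    ; consistent = λ s r Os sep r≤s Or → IsProfile.consistent prof s r (proj₁ (decSet⁻ O? Os)) sep r≤s (proj₁ (decSet⁻ O? Or)) }
    where
    O? : U.Decidable (⟦ P ⟧ U.∩ N)
    O? s = T? (P s) ×-dec N? s

  not-distinguished : (N : SepSet ∣G∣) (P Q : DecSepSet ∣G∣) → SwapClosed N →
                      (∀ {s} → N s → ⟦ P ⟧ s ⊎ ⟦ P ⟧ (swap s)) → (∀ {s} → N s → ⟦ Q ⟧ s ⊎ ⟦ Q ⟧ (swap s)) →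
                      ¬ (∃[ s ] N s × Dist s ⟦ P ⟧ ⟦ Q ⟧) → ⟦ P ⟧ U.∩ N U.≐ ⟦ Q ⟧ U.∩ N
  not-distinguished N P Q N-swap totP totQ ¬d =
    (λ {s} (Ps , Ns) → [ (λ Qs → Qs , Ns) , (λ Qs → ⊥-elim (¬d (s , Ns , Ps , Qs))) ]′ (totQ Ns)) ,
    (λ {s} (Qs , Ns) → [ (λ Ps → Ps , Ns) , (λ Ps → ⊥-elim (¬d (swap s , N-swap s Ns , Ps , Qs))) ]′ (totP Ns))

  -- Both a step of the recursion for one strategy and the passage from one order to the next adjoin
  -- to N the solutions below all its consistent orientations; this module treats the two together.
  module Gluing
    {N S : SepSet ∣G∣} {𝒫 : Family ∣G∣} (N? : U.Decidable N) (N-sep : ∀ {s} → N s → IsSeparation G s) (N-swap : SwapClosed N)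
    (S-sep : ∀ {s} → S s → IsSeparation G s) (S-swap : SwapClosed S)
    (N-nested : ∀ {s} → N s → NestedWith N s) (S-nested : ∀ {s} → S s → NestedWith N s)
    (𝒫-ext : Extensional 𝒫) (profiles : ∀ P → 𝒫 P → IsProfile G ⟦ P ⟧)
    (orients : ∀ P → 𝒫 P → ∀ {s} → N s → ⟦ P ⟧ s ⊎ ⟦ P ⟧ (swap s))
    (τ : Strategy) (sub : ∀ O → ConsistentOrientations G N O → Solved τ (splitters G S O) (inducing G 𝒫 N O)) where

    Within : DecSepSet ∣G∣ → SepSet ∣G∣
    Within O = Nσ G τ (splitters G S O) (inducing G 𝒫 N O)

    Later : SepSet ∣G∣
    Later s = ∃[ O ] ConsistentOrientations G N O × Within O s

    Within⊆ : ∀ O {s} → Within O s → splitters G S O s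
    Within⊆ O = Nσ⊆ (λ _ (Ss , a , b) → S-swap _ Ss , b , a)

    glued-swap : SwapClosed (N U.∪ Later)
    glued-swap s (inj₁ Ns)            = inj₁ (N-swap s Ns)
    glued-swap s (inj₂ (O , con , d)) = inj₂ (O , con , Nσ-swap (λ _ (Ss , a , b) → S-swap _ Ss , b , a) d)

    private
      -- Makes the subproblem depend only on the extension of O, as the search over orientations and
      -- the comparison of two subproblems require.
      transport : ∀ O O′ → ⟦ O ⟧ U.≐ ⟦ O′ ⟧ → ∀ {s} → Within O s → Within O′ s
      transport O O′ eq {s} = Nσ-fwd (identity G) τ
        (splitters-rel (identity G) O O′ Rel-refl (≐⇒Rel eq))
        (inducing-rel (identity G) {N} {N} {𝒫} {𝒫} O O′ (Ext⇒FamRel 𝒫-ext) Rel-refl (≐⇒Rel eq)) s s (refl , refl)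

      Later? : U.Decidable Later
      Later? s = ∃DecSepSet?
        (λ O O′ eq (con , d) → consOrient-ext N O O′ eq con , transport O O′ eq d) one
        where
        one : U.Decidable (λ O → ConsistentOrientations G N O × Within O s)
        one O with consOrient? N? O
        ... | no ¬con = no (¬con ∘ proj₁)
        ... | yes con = map′ (con ,_) proj₂ (Solved.dec (sub O con) s)

    glued? : U.Decidable (N U.∪ Later)
    glued? s = N? s ⊎-dec Later? s

    glued-nested : ∀ {s r} → (N U.∪ Later) s → (N U.∪ Later) r → Nested s r
    glued-nested (inj₁ Ns) (inj₁ Nr) = N-nested Ns _ Nr
    glued-nested (inj₁ Ns) (inj₂ (O , _ , d)) = Nested-sym (S-nested (proj₁ (Within⊆ O d)) _ Ns)
    glued-nested (inj₂ (O , _ , d)) (inj₁ Nr) = S-nested (proj₁ (Within⊆ O d)) _ Nr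
    glued-nested (inj₂ (O , con , d)) (inj₂ (O′ , con′ , d′))
      with ≐-or-differ O O′ (consOrient⇒orientation O con) (consOrient⇒orientation O′ con′)
    ... | inj₁ eq = Solved.nested (sub O′ con′) (transport O O′ eq d) d′
    ... | inj₂ (t , Ot , O′t) =
      let Ss , sp = Within⊆ O d ; Sr , sp′ = Within⊆ O′ d′
          o = consOrient⇒orientation O con ; o′ = consOrient⇒orientation O′ con′
          Nt = IsOrientation.sub o Ot
      in splitters-nested {⟦ O ⟧} {⟦ O′ ⟧} (S-sep Ss) (S-sep Sr) (S-nested Ss _ Nt) (S-nested Sr _ Nt) Ot O′t sp sp′

    -- Profiles that N does not distinguish induce the same orientation of N, so both belong to one
    -- subproblem, whose solution settles the matter.
    glued-distinguishes : ∀ P Q → 𝒫 P → 𝒫 Q → ⟦ P ⟧ U.≐ ⟦ Q ⟧ ⊎ ∃[ s ] (N U.∪ Later) s × Dist s ⟦ P ⟧ ⟦ Q ⟧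
    glued-distinguishes P Q 𝒫P 𝒫Q with ∃Sep? (λ s → N? s ×-dec (T? (P s) ×-dec T? (Q (swap s))))
    ... | yes (s , Ns , d) = inj₂ (s , inj₁ Ns , d)
    ... | no ¬d = Sum.map₂ (λ (s , e , d) → s , inj₂ (O , con , e) , d)
                    (Solved.distinguishes (sub O con) P Q (𝒫P , ≐-sym (decSet-≐ O?)) (𝒫Q , ≐-trans (≐-sym P∩N≐Q∩N) (≐-sym (decSet-≐ O?))))
      where
      O? : U.Decidable (⟦ P ⟧ U.∩ N)
      O? s = T? (P s) ×-dec N? s
      O = decSet O?
      con : ConsistentOrientations G N O
      con = orientation⇒consOrient O N-sep N-swap (profile-orients N? P (profiles P 𝒫P) (orients P 𝒫P) N-swap)
      P∩N≐Q∩N = not-distinguished N P Q N-swap (orients P 𝒫P) (orients Q 𝒫Q) ¬d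

  module _ {S : SepSet ∣G∣} {𝒫 : Family ∣G∣} (task : Task S 𝒫) (σ : Strategy) where
    open Task task

    private
      R? = reduction? S? 𝒫? 𝒫-ext
      N = applyOp (op σ 0) S 𝒫
      N? = applyOp? S? 𝒫? 𝒫-ext (op σ 0)
      N⊆S : ∀ {s} → N s → S s
      N⊆S = op⊆ {𝒫 = 𝒫} S-swap (op σ 0)
      N-swap : SwapClosed N
      N-swap s = op-swap {𝒫 = 𝒫} S-swap (op σ 0)

    Reduces? : Dec (Reduces G σ S 𝒫)
    Reduces? = map′ (λ (red , s , Ss , ¬Rs) → red , proj₁ , λ S⊆R → ¬Rs (S⊆R Ss))
                    (λ (red , _ , S⊈R) → red , decidable-stable ∃? λ ¬∃ →
                       S⊈R λ {s} Ss → decidable-stable (R? s) λ ¬Rs → ¬∃ (s , Ss , ¬Rs))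
                    (IsReduced? (op σ 0) ×-dec ∃?)
      where ∃? = ∃Sep? λ s → S? s ×-dec ¬? (R? s)

    -- O already contains s or its inverse, and the other one cannot be added consistently. Hence
    -- taking even one separation makes every subproblem strictly smaller.
    splitters-avoid : ∀ O → ConsistentOrientations G N O → ∀ {s} → N s → ¬ splitters G S O s
    splitters-avoid O con {s} Ns (Ss , a , b) with IsOrientation.total (consOrient⇒orientation O con) Ns
    ... | inj₁ Os = b s s (inj₁ Os) (S-sep Ss) ≤ₛ-refl (inj₂ refl)
    ... | inj₂ Os = a (swap s) (swap s) (inj₁ Os) (S-sep (S-swap _ Ss)) ≤ₛ-refl (inj₂ refl)

    solve-empty : ¬ U.Satisfiable S → Solved σ S 𝒫
    solve-empty ¬S = record
      { dec = λ s → no (none s)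
      ; nested = λ d _ → ⊥-elim (none _ d)
      ; distinguishes = λ P Q 𝒫P 𝒫Q → Sum.map₂ (λ (s , Ss , _) → ⊥-elim (¬S (s , Ss))) (distinguishes P Q 𝒫P 𝒫Q) }
      where
      none : ∀ s → ¬ Nσ G σ S 𝒫 s
      none s (reduce ne _ _)    = ¬S ne
      none s (now ne _ _)       = ¬S ne
      none s (later ne _ _ _ _) = ¬S ne

    solve-reduce : U.Satisfiable S → Reduces G σ S 𝒫 → Solved σ (reduction S 𝒫) 𝒫 → Solved σ S 𝒫
    solve-reduce ne red sub = record
      { dec = λ s → map′ (reduce ne red) un (Solved.dec sub s)
      ; nested = λ d d′ → Solved.nested sub (un d) (un d′)
      ; distinguishes = λ P Q 𝒫P 𝒫Q → Sum.map₂ (λ (s , d , e) → s , reduce ne red d , e) (Solved.distinguishes sub P Q 𝒫P 𝒫Q) }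
      where
      un : ∀ {s} → Nσ G σ S 𝒫 s → Nσ G σ (reduction S 𝒫) 𝒫 s
      un (reduce _ _ d)       = d
      un (now _ ¬red _)       = ⊥-elim (¬red red)
      un (later _ ¬red _ _ _) = ⊥-elim (¬red red)

    module _ (ne : U.Satisfiable S) (¬red : ¬ Reduces G σ S 𝒫) where

      private
        S⊆R : IsReduced (op σ 0) → ∀ {s} → S s → reduction S 𝒫 s
        S⊆R red {s} Ss = decidable-stable (R? s) λ ¬Rs → ¬red (red , proj₁ , λ S⊆R′ → ¬Rs (S⊆R′ Ss))

      N-nested : ∀ {s} → N s → NestedWith S s
      N-nested {s} Ns with IsReduced? (op σ 0)
      ... | no ¬r = proj₂ (op⇒nested task (op σ 0) ¬r Ns)
      -- A reduced operation acts only once S equals its reduction, so nestedness with the reduction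
      -- is nestedness with S.
      ... | yes r = λ t St → proj₂ (op⇒reduced-nested task (op σ 0) r Ns) t (S⊆R r St)

      N-nonempty : IsReduced (op σ 0) → U.Satisfiable N
      N-nonempty red = op-nonempty task (op σ 0) red (S⊆R red) ne

      module _ (sub : ∀ O → ConsistentOrientations G N O → Solved (σ ⁺) (splitters G S O) (inducing G 𝒫 N O)) where

        solve-step : Solved σ S 𝒫
        solve-step = record
          { dec = λ s → map′ mk un (glued? s)
          ; nested = λ d d′ → glued-nested (un d) (un d′)
          ; distinguishes = λ P Q 𝒫P 𝒫Q → Sum.map₂ (λ (s , e , d) → s , mk e , d) (glued-distinguishes P Q 𝒫P 𝒫Q) }
          where
          open Gluing {𝒫 = 𝒫} N? (S-sep ∘ N⊆S) N-swap S-sep S-swap (λ Ns r Nr → N-nested Ns r (N⊆S Nr))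
            (λ Ss r Nr → Nested-sym (N-nested Nr _ Ss)) 𝒫-ext profiles (λ P 𝒫P → orients P 𝒫P ∘ N⊆S) (σ ⁺) sub
          un : ∀ {s} → Nσ G σ S 𝒫 s → (N U.∪ Later) s
          un (reduce _ red _)    = ⊥-elim (¬red red)
          un (now _ _ d)         = inj₁ d
          un (later _ _ O con d) = inj₂ (O , con , d)
          mk : ∀ {s} → (N U.∪ Later) s → Nσ G σ S 𝒫 s
          mk (inj₁ d)             = now ne ¬red d
          mk (inj₂ (O , con , d)) = later ne ¬red O con d

  module _ {S : SepSet ∣G∣} {𝒫 : Family ∣G∣} (task : Task S 𝒫) (σ : Strategy) where
    open Task task

    private
      N = applyOp (op σ 0) S 𝒫
      N? = applyOp? S? 𝒫? 𝒫-ext (op σ 0)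

    solve-by : (Reduces G σ S 𝒫 → Solved σ (reduction S 𝒫) 𝒫) →
               (U.Satisfiable S → ¬ Reduces G σ S 𝒫 → ∀ O → ConsistentOrientations G N O →
                Solved (σ ⁺) (splitters G S O) (inducing G 𝒫 N O)) →
               Solved σ S 𝒫
    solve-by byReduction byStep with ∃Sep? S?
    ... | no ¬S = solve-empty task σ ¬S
    ... | yes ne with Reduces? task σ
    ...   | yes rd = solve-reduce task σ ne rd (byReduction rd)
    ...   | no ¬rd = solve-step task σ ne ¬rd (byStep ne ¬rd)

    reduction-smaller : Reduces G σ S 𝒫 → count (reduction? S? 𝒫? 𝒫-ext) < count S?
    reduction-smaller (_ , _ , S⊈R) with ∃Sep? (λ s → S? s ×-dec ¬? (reduction? S? 𝒫? 𝒫-ext s))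
    ... | yes (s , Ss , ¬Rs) = count-strict (reduction? S? 𝒫? 𝒫-ext) S? proj₁ Ss ¬Rs
    ... | no ¬∃ = ⊥-elim (S⊈R λ {s} Ss → decidable-stable (reduction? S? 𝒫? 𝒫-ext s) λ ¬Rs → ¬∃ (s , Ss , ¬Rs))

    module _ (O : DecSepSet ∣G∣) (con : ConsistentOrientations G N O) where

      step-task : Task (splitters G S O) (inducing G 𝒫 N O)
      step-task = splitters-task task N? O con

      private
        S_O? = Task.S? step-task

      splitters-no-larger : count S_O? ≤ count S?
      splitters-no-larger = count-mono S_O? S? proj₁

      splitters-smaller : IsReduced (op σ 0) → U.Satisfiable S → ¬ Reduces G σ S 𝒫 → count S_O? < count S?
      splitters-smaller red ne ¬rd = count-strict S_O? S? proj₁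
          (op⊆ {𝒫 = 𝒫} S-swap (op σ 0) Ns) (splitters-avoid task σ O con Ns)
        where Ns = proj₂ (N-nonempty task σ ne ¬rd red)

  private
    -- Lexicographic recursion on a strict bound c for the size of S and on any index r of a reduced
    -- operation. At r = 0 every subproblem has fewer separations and r may be chosen anew;
    -- otherwise shifting the strategy lowers r while S does not grow.
    solve′ : ∀ c σ {S 𝒫} (task : Task S 𝒫) → count (Task.S? task) < c → ∀ r → IsReduced (op σ r) → Solved σ S 𝒫
    solve′ (suc c) σ task (s≤s ≤c) zero red = solve-by task σ
      (λ rd → solve′ c σ (reduction-task task) (ℕ.<-≤-trans (reduction-smaller task σ rd) ≤c) zero red)
      (λ ne ¬rd O con → let i , _ , redᵢ = Strategy.infinitely (σ ⁺) 0 in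
        solve′ c (σ ⁺) (step-task task σ O con)
          (ℕ.<-≤-trans (splitters-smaller task σ O con red ne ¬rd) ≤c) i redᵢ)
    solve′ (suc c) σ task (s≤s ≤c) (suc r) red = solve-by task σ
      (λ rd → solve′ c σ (reduction-task task) (ℕ.<-≤-trans (reduction-smaller task σ rd) ≤c) (suc r) red)
      (λ ne ¬rd O con → solve′ (suc c) (σ ⁺) (step-task task σ O con)
        (s≤s (ℕ.≤-trans (splitters-no-larger task σ O con) ≤c)) r red)

  solve : ∀ σ {S 𝒫} → Task S 𝒫 → Solved σ S 𝒫
  solve σ task = let i , _ , red = Strategy.infinitely σ 0 in solve′ _ σ task (ℕ.n<1+n _) i red

  -- Nestedness is claimed only with competitors for the same two profiles. These are still present
  -- when s is taken, since distinguishing P and Q keeps them in every reduction and among the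
  -- splitters of every orientation induced by both profiles.
  Witnessed : SepSet ∣G∣ → Family ∣G∣ → Sep ∣G∣ → Set
  Witnessed S 𝒫 s = ∃₂ λ P Q → 𝒫 P × 𝒫 Q × Dist s ⟦ P ⟧ ⟦ Q ⟧ × (∀ g → S g → Dist g ⟦ P ⟧ ⟦ Q ⟧ → Nested s g)

  Nσ-witnessed : ∀ {σ S 𝒫} → (∀ i → IsReduced (op σ i)) → Task S 𝒫 → ∀ {s} → Nσ G σ S 𝒫 s → Witnessed S 𝒫 s
  Nσ-witnessed red task (reduce _ _ d) with Nσ-witnessed red (reduction-task task) d
  ... | P , Q , 𝒫P , 𝒫Q , ds , w = P , Q , 𝒫P , 𝒫Q , ds , λ g Sg dg → w g (reduction⁺ task Sg P Q 𝒫P 𝒫Q dg) dg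
  Nσ-witnessed {σ} red task (now _ _ d) with op⇒reduced-nested task (op σ 0) (red 0) d
  ... | Rs , nst with reduction⁻ task Rs
  ...   | P , Q , 𝒫P , 𝒫Q , ds = P , Q , 𝒫P , 𝒫Q , ds , λ g Sg dg → nst g (reduction⁺ task Sg P Q 𝒫P 𝒫Q dg)
  Nσ-witnessed {σ} red task (later _ _ O con d) with Nσ-witnessed (red ∘ suc) (step-task task σ O con) d
  ... | P , Q , 𝒫P , 𝒫Q , ds , w = P , Q , proj₁ 𝒫P , proj₁ 𝒫Q , ds , λ g Sg dg →
    w g (splitters⁺ task (applyOp? (Task.S? task) (Task.𝒫? task) (Task.𝒫-ext task) (op σ 0)) O con P Q 𝒫P 𝒫Q Sg dg) dg

small-corner : ∀ {a b x y} → x + y ≤ a + b → a < x → y < b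
small-corner x+y≤a+b a<x = ℕ.≰⇒> λ b≤y → ℕ.<⇒≱ (ℕ.+-mono-<-≤ a<x b≤y) x+y≤a+b

swap< : ∀ {n k} (s : Sep n) → sepOrder s < k → sepOrder (swap s) < k
swap< s = subst (_< _) (sym (sepOrder-swap s))

-- k-profiles and k-strategies

module Levels (G : Graph) where

  open Tasks G
  open Solutions G

  private
    ∣G∣ = ∣V∣ G

  module KProfile {k} {P : SepSet ∣G∣} (prof : IsKProfile G k P) where
    open IsKProfile prof public
    open IsProfile isProfile public

    total : ∀ {s} → IsSeparation G s → sepOrder s < k → P s ⊎ P (swap s)
    total {s} sep lt = Sum.map proj₁ proj₂ (exactlyOne s sep lt)

    anti : ∀ {s} → P s → ¬ P (swap s)
    anti = profile-anti isProfile

    -- The profile property excludes the inverse of the join, and the order bound forces P to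
    -- contain one of the two.
    join : ∀ {s r} → P s → P r → sepOrder (s ∨ₛ r) < k → P (s ∨ₛ r)
    join {s} {r} Ps Pr lt = [ id , ⊥-elim ∘ profile (proj₁ s) (proj₂ s) (proj₁ r) (proj₂ r) Ps Pr ]′
      (total (∨ₛ-separation G s r (separations s Ps) (separations r Pr)) lt)

    down : ∀ {s r} → P s → IsSeparation G r → sepOrder r < k → r ≤ₛ s → P r
    down {s} {r} Ps sep lt r≤s = [ id , ⊥-elim ∘ consistent s r Ps sep r≤s ]′ (total sep lt)

  Dist-∨ₛ : ∀ {k} {P Q : SepSet ∣G∣} → IsKProfile G k P → IsKProfile G k Q → ∀ {s r} →
            Dist s P Q → P r → sepOrder (s ∨ₛ r) < k → Dist (s ∨ₛ r) P Q
  Dist-∨ₛ p q {s} {r} (Ps , Qs) Pr lt = KProfile.join p Ps Pr lt ,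
    KProfile.down q Qs (swap-separation G (s ∨ₛ r) (∨ₛ-separation G s r (KProfile.separations p s Ps) (KProfile.separations p r Pr)))
      (swap< (s ∨ₛ r) lt) (swap-anti {s = s} {s ∨ₛ r} (∨ₛ-upperˡ {s = s} {r}))

  Dist-∧ₛ : ∀ {k} {P Q : SepSet ∣G∣} → IsKProfile G k P → IsKProfile G k Q → ∀ {s r} →
            Dist s P Q → Q (swap r) → sepOrder (s ∧ₛ r) < k → Dist (s ∧ₛ r) P Q
  Dist-∧ₛ p q {s} {r} (Ps , Qs) Qr lt =
    let a , b = Dist-∨ₛ q p {swap s} {swap r} (Qs , Ps) Qr (swap< (s ∧ₛ r) lt) in b , a

  -- An improper separation is comparable with its own inverse, so consistency forbids a profile to
  -- contain the larger of the two.
  Dist-proper : ∀ {P Q : SepSet ∣G∣} → IsProfile G P → IsProfile G Q → ∀ {s} → Dist s P Q → IsProper s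
  Dist-proper p q {s} (Ps , Qs) =
    (λ A⊆B → IsProfile.consistent q (swap s) s Qs (IsProfile.separations p s Ps) (A⊆B , A⊆B) Qs) ,
    (λ B⊆A → IsProfile.consistent p s (swap s) Ps (IsProfile.separations q _ Qs) (B⊆A , B⊆A) Ps)

  -- For k-profiles with ℓ the order of a separation that distinguishes P and Q, this says that the
  -- separation does so efficiently, that is, with least possible order.
  Agree : ℕ → SepSet ∣G∣ → SepSet ∣G∣ → Set
  Agree ℓ P Q = ∀ s → IsSeparation G s → sepOrder s < ℓ → ¬ Dist s P Q

  Agree-sym : ∀ {ℓ P Q} → Agree ℓ P Q → Agree ℓ Q P
  Agree-sym agree s sep lt (Qs , Ps) = agree (swap s) (swap-separation G s sep) (swap< s lt) (Ps , Qs)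

  record KFamily (k : ℕ) (𝒫 : Family ∣G∣) : Set₁ where
    field
      𝒫?        : U.Decidable 𝒫
      𝒫-ext     : Extensional 𝒫
      kprofiles : ∀ P → 𝒫 P → IsKProfile G k ⟦ P ⟧

    equal-or-distinguished : ∀ P Q → 𝒫 P → 𝒫 Q → ⟦ P ⟧ U.≐ ⟦ Q ⟧ ⊎ ∃[ s ] Dist s ⟦ P ⟧ ⟦ Q ⟧
    equal-or-distinguished P Q 𝒫P 𝒫Q with ∃Sep? (λ s → T? (P s) ×-dec T? (Q (swap s)))
    ... | yes d = inj₂ d
    ... | no ¬d = inj₁ ((λ {s} Ps → [ id , (λ Qs → ⊥-elim (¬d (s , Ps , Qs))) ]′ (KProfile.total q (KProfile.separations p s Ps) (KProfile.order< p s Ps)))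
                       , (λ {s} Qs → [ id , (λ Ps → ⊥-elim (¬d (swap s , Ps , Qs))) ]′ (KProfile.total p (KProfile.separations q s Qs) (KProfile.order< q s Qs))))
      where
      p = kprofiles P 𝒫P
      q = kprofiles Q 𝒫Q

  module _ {ℓ : ℕ} {𝒫 : Family ∣G∣} (fam : KFamily (suc ℓ) 𝒫) {N : SepSet ∣G∣} (N? : U.Decidable N)
           (N-sep : ∀ {s} → N s → IsSeparation G s) (N-order : ∀ {s} → N s → sepOrder s < ℓ) (N-swap : SwapClosed N)
           (N-nested : ∀ {s} → N s → NestedWith N s)
           (efficient : ∀ {s} → N s → ∃₂ λ P Q → 𝒫 P × 𝒫 Q × Dist s ⟦ P ⟧ ⟦ Q ⟧ × Agree (sepOrder s) ⟦ P ⟧ ⟦ Q ⟧) where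
    open KFamily fam

    private
      Crosses : Sep ∣G∣ → SepSet ∣G∣
      Crosses s t = N t × ¬ Nested s t

      crosses? : ∀ s → U.Decidable (Crosses s)
      crosses? s t = N? t ×-dec ¬? (Nested? s t)

      -- The join is above t, so t is no longer crossed. An element of N nested with s is nested
      -- with t too, and it stays nested with the join because the exceptions in `Nested-∨ₛ` would
      -- make s and t nested.
      fewer-crossings : ∀ {s t} → Crosses s t → count (crosses? (s ∨ₛ t)) < count (crosses? s)
      fewer-crossings {s} {t} (Nt , cr) = count-strict (crosses? (s ∨ₛ t)) (crosses? s)
        (λ (Nu , cr′) → Nu , λ nst → [ cr′ ∘ Nested-sym , [ (λ (a , b) → cr (≤sn (≤ₛ-trans a b))) , (λ (a , b) → cr (≤sn (≤ₛ-trans a b))) ]′ ]′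
           (Nested-∨ₛ {s = s} {t} (Nested-sym nst) (N-nested Nu _ Nt)))
        {t} (Nt , cr) (λ (_ , cr′) → cr′ (≥n (∨ₛ-upperʳ {s = s} {t})))

      swap-crossings : ∀ s → count (crosses? (swap s)) ≤ count (crosses? s)
      swap-crossings s = count-mono (crosses? (swap s)) (crosses? s) (λ (Nt , cr) → Nt , cr ∘ Nested-swapˡ)

      -- One of these two corners would distinguish the profiles that t distinguishes efficiently.
      no-small-corners : ∀ {s t} → N t → IsSeparation G s → sepOrder s ≡ ℓ →
                         sepOrder (s ∧ₛ t) < sepOrder t → ¬ sepOrder (swap s ∧ₛ t) < sepOrder t
      no-small-corners {s} {t} Nt sep o≡ <₁ <₂ with efficient Nt
      ... | Q , Q′ , 𝒫Q , 𝒫Q′ , dt , agree =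
        [ go (swap s) (swap-separation G s sep) <₂ , go s sep <₁ ]′ (KProfile.total q′ sep (subst (_< _) (sym o≡) (ℕ.n<1+n ℓ)))
        where
        q  = kprofiles Q 𝒫Q
        q′ = kprofiles Q′ 𝒫Q′
        go : ∀ s → IsSeparation G s → sepOrder (s ∧ₛ t) < sepOrder t → ¬ ⟦ Q′ ⟧ (swap s)
        go s sep lt Q′s = agree (s ∧ₛ t) (∧ₛ-separation G s t sep (N-sep Nt)) lt (Qst , Q′st)
          where
          lt′ = ℕ.<-trans lt (KProfile.order< q t (proj₁ dt))
          Qst = KProfile.down q (proj₁ dt) (∧ₛ-separation G s t sep (N-sep Nt)) lt′ (∧ₛ-lowerʳ {s = s} {t})
          Q′st = KProfile.join q′ {swap s} {swap t} Q′s (proj₂ dt) (swap< (s ∧ₛ t) lt′)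

    distinguished-nestedly : ∀ P P′ → 𝒫 P → 𝒫 P′ → Agree ℓ ⟦ P ⟧ ⟦ P′ ⟧ → ∀ s → Dist s ⟦ P ⟧ ⟦ P′ ⟧ →
                             ∃[ r ] Dist r ⟦ P ⟧ ⟦ P′ ⟧ × NestedWith N r
    distinguished-nestedly P P′ 𝒫P 𝒫P′ agree s d = go s d (<-wellFounded _)
      where
      p  = kprofiles P 𝒫P
      p′ = kprofiles P′ 𝒫P′
      order≡ : ∀ {s} → Dist s ⟦ P ⟧ ⟦ P′ ⟧ → sepOrder s ≡ ℓ
      order≡ {s} d = ℕ.≤-antisym (ℕ.≤-pred (KProfile.order< p s (proj₁ d)))
                       (ℕ.≮⇒≥ λ lt → agree s (KProfile.separations p s (proj₁ d)) lt d)
      same-side : ∀ {t} → N t → (⟦ P ⟧ t × ⟦ P′ ⟧ t) ⊎ (⟦ P ⟧ (swap t) × ⟦ P′ ⟧ (swap t))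
      same-side {t} Nt with KProfile.total p (N-sep Nt) (ℕ.m≤n⇒m≤1+n (N-order Nt)) | KProfile.total p′ (N-sep Nt) (ℕ.m≤n⇒m≤1+n (N-order Nt))
      ... | inj₁ a | inj₁ b = inj₁ (a , b)
      ... | inj₂ a | inj₂ b = inj₂ (a , b)
      ... | inj₁ a | inj₂ b = ⊥-elim (agree t (N-sep Nt) (N-order Nt) (a , b))
      ... | inj₂ a | inj₁ b = ⊥-elim (Agree-sym {P = ⟦ P ⟧} {⟦ P′ ⟧} agree t (N-sep Nt) (N-order Nt) (b , a))
      go : ∀ s → Dist s ⟦ P ⟧ ⟦ P′ ⟧ → Acc _<_ (count (crosses? s)) → ∃[ r ] Dist r ⟦ P ⟧ ⟦ P′ ⟧ × NestedWith N r
      uncross : ∀ s t → Dist s ⟦ P ⟧ ⟦ P′ ⟧ → Acc _<_ (count (crosses? s)) → Crosses s t → ⟦ P ⟧ t → ⟦ P′ ⟧ t →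
                ∃[ r ] Dist r ⟦ P ⟧ ⟦ P′ ⟧ × NestedWith N r
      go s d a with ∃Sep? (crosses? s)
      ... | no ¬cr = s , d , λ t Nt → decidable-stable (Nested? s t) λ cr → ¬cr (t , Nt , cr)
      ... | yes (t , Nt , cr) with same-side Nt
      ...   | inj₁ (Pt , P′t) = uncross s t d a (Nt , cr) Pt P′t
      ...   | inj₂ (Pt , P′t) = uncross s (swap t) d a (N-swap t Nt , cr ∘ Nested-swapʳ) Pt P′t
      -- Both profiles contain t. So P contains the first corner and P′ the second if its order
      -- permits, and either corner then distinguishes the profiles. If both are too large,
      -- submodularity pushes the two opposite corners below the order of t.
      uncross s t d (acc rec) (Nt , cr) Pt P′t with sepOrder (s ∨ₛ t) ℕ.≤? ℓ | sepOrder (swap s ∨ₛ t) ℕ.≤? ℓ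
      ... | yes ≤ℓ | _ = go (s ∨ₛ t) (Dist-∨ₛ p p′ {s} {t} d Pt (s≤s ≤ℓ)) (rec (fewer-crossings (Nt , cr)))
      ... | no _ | yes ≤ℓ =
        let a , b = Dist-∨ₛ p′ p {swap s} {t} (proj₂ d , proj₁ d) P′t (s≤s ≤ℓ)
        in go (swap (swap s ∨ₛ t)) (b , a) (rec (ℕ.≤-<-trans (swap-crossings (swap s ∨ₛ t))
             (ℕ.<-≤-trans (fewer-crossings {swap s} {t} (Nt , cr ∘ Nested-swapˡ)) (swap-crossings s))))
      ... | no >₁ | no >₂ = ⊥-elim (no-small-corners Nt (KProfile.separations p s (proj₁ d)) (order≡ d)
          (small (submodular s t) (ℕ.≰⇒> >₁) (order≡ d))
          (small (submodular (swap s) t) (ℕ.≰⇒> >₂) (trans (sepOrder-swap s) (order≡ d))))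
        where
        small : ∀ {x y a b} → x + y ≤ a + b → ℓ < x → a ≡ ℓ → y < b
        small h lt refl = small-corner h lt

    module _ {𝒫′ : Family ∣G∣} (𝒫′⊆𝒫 : ∀ {P} → 𝒫′ P → 𝒫 P) (𝒫′? : U.Decidable 𝒫′) (𝒫′-ext : Extensional 𝒫′)
             (agree : ∀ P Q → 𝒫′ P → 𝒫′ Q → Agree ℓ ⟦ P ⟧ ⟦ Q ⟧)
             {S : SepSet ∣G∣} (S? : U.Decidable S) (S-swap : SwapClosed S) (S-sep : ∀ {s} → S s → IsSeparation G s)
             (S-order : ∀ {s} → S s → sepOrder s ≡ ℓ) (S-nested : ∀ {s} → S s → NestedWith N s)
             (S-full : ∀ P Q → 𝒫′ P → 𝒫′ Q → ∀ s → sepOrder s ≡ ℓ → NestedWith N s → Dist s ⟦ P ⟧ ⟦ Q ⟧ → S s) where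

      private
        order≡ : ∀ P Q → 𝒫′ P → 𝒫′ Q → ∀ {s} → Dist s ⟦ P ⟧ ⟦ Q ⟧ → sepOrder s ≡ ℓ
        order≡ P Q 𝒫P 𝒫Q {s} d = ℕ.≤-antisym (ℕ.≤-pred (KProfile.order< p s (proj₁ d)))
                       (ℕ.≮⇒≥ λ lt → agree P Q 𝒫P 𝒫Q s (KProfile.separations p s (proj₁ d)) lt d)
          where p = kprofiles P (𝒫′⊆𝒫 𝒫P)

      -- Feasibility comes from submodularity. If s and r of order ℓ distinguish P from Q and their
      -- join has order above ℓ, their meet has order below ℓ and still distinguishes P from Q,
      -- although these agree there. The join is nested with N because s and r are nested with N and
      -- cross each other.
      level-task : Task S 𝒫′
      level-task = record
        { S? = S? ; 𝒫? = 𝒫′? ; 𝒫-ext = 𝒫′-ext ; S-sep = S-sep ; S-swap = S-swap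
        ; profiles = λ P 𝒫P → IsKProfile.isProfile (kprofiles P (𝒫′⊆𝒫 𝒫P))
        ; orients = λ P 𝒫P Ss → KProfile.total (kprofiles P (𝒫′⊆𝒫 𝒫P)) (S-sep Ss) (S-order< Ss)
        ; distinguishes = dist
        ; feasible = feas }
        where
        S-order< : ∀ {s} → S s → sepOrder s < suc ℓ
        S-order< Ss = subst (_< suc ℓ) (sym (S-order Ss)) (ℕ.n<1+n ℓ)
        dist : ∀ P Q → 𝒫′ P → 𝒫′ Q → ⟦ P ⟧ U.≐ ⟦ Q ⟧ ⊎ ∃[ s ] S s × Dist s ⟦ P ⟧ ⟦ Q ⟧
        dist P Q 𝒫P 𝒫Q with equal-or-distinguished P Q (𝒫′⊆𝒫 𝒫P) (𝒫′⊆𝒫 𝒫Q)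
        ... | inj₁ eq = inj₁ eq
        ... | inj₂ (s , d) with distinguished-nestedly P Q (𝒫′⊆𝒫 𝒫P) (𝒫′⊆𝒫 𝒫Q) (agree P Q 𝒫P 𝒫Q) s d
        ...   | r , d′ , nst = inj₂ (r , S-full P Q 𝒫P 𝒫Q r (order≡ P Q 𝒫P 𝒫Q d′) nst d′ , d′)
        feas : ∀ P Q → 𝒫′ P → 𝒫′ Q → ∀ {s r} → S s → S r → ¬ Nested s r → Dist s ⟦ P ⟧ ⟦ Q ⟧ → Dist r ⟦ P ⟧ ⟦ Q ⟧ →
               ∃[ e ] S e × ⟦ P ⟧ e × s ≤ₛ e × r ≤ₛ e
        feas P Q 𝒫P 𝒫Q {s} {r} Ss Sr cr ds dr with sepOrder (s ∨ₛ r) ℕ.≤? ℓ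
        ... | yes ≤ℓ = s ∨ₛ r , S-full P Q 𝒫P 𝒫Q (s ∨ₛ r) (order≡ P Q 𝒫P 𝒫Q d) nst d , proj₁ d , ∨ₛ-upperˡ {s = s} {r} , ∨ₛ-upperʳ {s = s} {r}
          where
          d = Dist-∨ₛ (kprofiles P (𝒫′⊆𝒫 𝒫P)) (kprofiles Q (𝒫′⊆𝒫 𝒫Q)) {s} {r} ds (proj₁ dr) (s≤s ≤ℓ)
          nst : NestedWith N (s ∨ₛ r)
          nst u Nu = [ Nested-sym , [ (λ (a , b) → ⊥-elim (cr (≤sn (≤ₛ-trans a b)))) , (λ (a , b) → ⊥-elim (cr (≤sn (≤ₛ-trans a b)))) ]′ ]′
            (Nested-∨ₛ {s = s} {r} (Nested-sym (S-nested Ss u Nu)) (Nested-sym (S-nested Sr u Nu)))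
        ... | no >ℓ = ⊥-elim (agree P Q 𝒫P 𝒫Q (s ∧ₛ r) (∧ₛ-separation G s r (S-sep Ss) (S-sep Sr)) <ℓ
                (Dist-∧ₛ (kprofiles P (𝒫′⊆𝒫 𝒫P)) (kprofiles Q (𝒫′⊆𝒫 𝒫Q)) {s} {r} ds (proj₂ dr) (ℕ.m≤n⇒m≤1+n <ℓ)))
          where
          <ℓ : sepOrder (s ∧ₛ r) < ℓ
          <ℓ = small-corner (subst₂ (λ a b → _ ≤ a + b) (S-order Ss) (S-order Sr) (submodular s r)) (ℕ.≰⇒> >ℓ)

  -- The last component records that e was chosen by an operation that only
  -- takes separations nested with every candidate at that stage.
  Efficient : SepSet ∣G∣ → Family ∣G∣ → Sep ∣G∣ → Set
  Efficient N 𝒫 e = ∃₂ λ P Q → 𝒫 P × 𝒫 Q × Dist e ⟦ P ⟧ ⟦ Q ⟧ × Agree (sepOrder e) ⟦ P ⟧ ⟦ Q ⟧ ×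
    (∀ g → sepOrder g ≡ sepOrder e → (∀ u → N u → sepOrder u < sepOrder e → Nested g u) → Dist g ⟦ P ⟧ ⟦ Q ⟧ → Nested e g)

  record Good (k : ℕ) (N : SepSet ∣G∣) (𝒫 : Family ∣G∣) : Set₁ where
    field
      N?            : U.Decidable N
      separation    : ∀ {s} → N s → IsSeparation G s
      proper        : ∀ {s} → N s → IsProper s
      order<        : ∀ {s} → N s → sepOrder s < k
      swap-closed   : SwapClosed N
      nested        : ∀ {s} → N s → NestedWith N s
      distinguishes : ∀ P Q → 𝒫 P → 𝒫 Q → ⟦ P ⟧ U.≐ ⟦ Q ⟧ ⊎ ∃[ s ] N s × Dist s ⟦ P ⟧ ⟦ Q ⟧
      efficient     : ∀ {s} → N s → Efficient N 𝒫 s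

  truncation : ℕ → DecSepSet ∣G∣ → DecSepSet ∣G∣
  truncation ℓ P = decSet λ s → T? (P s) ×-dec (sepOrder s ℕ.<? ℓ)

  truncation-≐ : ∀ ℓ P → ⟦ truncation ℓ P ⟧ U.≐ (λ s → s U.∈ ⟦ P ⟧ × sepOrder s < ℓ)
  truncation-≐ ℓ P = decSet-≐ λ s → T? (P s) ×-dec (sepOrder s ℕ.<? ℓ)

  truncate-family : ∀ {k 𝒫} → KFamily (suc k) 𝒫 → KFamily k (truncate k 𝒫)
  truncate-family {k} {𝒫} fam = record
    { 𝒫? = λ Q → ∃DecSepSet? (λ P P′ eq (𝒫P , a , b) → 𝒫-ext P P′ eq 𝒫P ,
                   (λ Qs → let Ps , lt = a Qs in proj₁ eq Ps , lt) , (λ (Ps , lt) → b (proj₂ eq Ps , lt)))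
             λ P → 𝒫? P ×-dec ((λ s → T? (Q s)) ≐? (λ s → T? (P s) ×-dec (sepOrder s ℕ.<? k)))
    ; 𝒫-ext = λ Q Q′ eq (P , 𝒫P , e) → P , 𝒫P , ≐-trans (≐-sym eq) e
    ; kprofiles = λ { Q (P , 𝒫P , (f , g)) → let module p = KProfile (kprofiles P 𝒫P) in record
        { isProfile = record
          { separations = λ s Qs → p.separations s (proj₁ (f Qs))
          ; consistent = λ s r Qs sep r≤s Qr → p.consistent s r (proj₁ (f Qs)) sep r≤s (proj₁ (f Qr))
          ; profile = λ A B C D Qs Qr Qt → p.profile A B C D (proj₁ (f Qs)) (proj₁ (f Qr)) (proj₁ (f Qt)) }
        ; order< = λ s Qs → proj₂ (f Qs)
        ; exactlyOne = λ s sep lt → Sum.map (λ (Ps , ¬Ps) → g (Ps , lt) , ¬Ps ∘ proj₁ ∘ f)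
                                           (λ (¬Ps , Ps) → ¬Ps ∘ proj₁ ∘ f , g (Ps , swap< s lt)) (p.exactlyOne s sep (ℕ.m≤n⇒m≤1+n lt)) } } }
    where open KFamily fam

  NΣ-good : ∀ k (σs : KStrategy (suc k)) {𝒫} → KFamily (suc k) 𝒫 → Good (suc k) (NΣ G (suc k) σs 𝒫) 𝒫
  NΣ-good zero σs {𝒫} fam = record
    { N? = Solved.dec sol
    ; separation = proj₁ ∘ N⊆S
    ; proper = proj₁ ∘ proj₂ ∘ N⊆S
    ; order< = proj₂ ∘ proj₂ ∘ N⊆S
    ; swap-closed = λ s → Nσ-swap S-swap
    ; nested = λ Ns r Nr → Solved.nested sol Ns Nr
    ; distinguishes = Solved.distinguishes sol
    ; efficient = λ {e} Ne → let P , Q , 𝒫P , 𝒫Q , d , w = Nσ-witnessed (proj₂ (last σs)) task Ne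
                                 o≡ = order≡0 (N⊆S Ne)
                             in P , Q , 𝒫P , 𝒫Q , d , (λ s sep lt → ⊥-elim (ℕ.n≮0 (subst (_ <_) o≡ lt))) ,
                                λ g og _ dg → w g (S-full P Q 𝒫P 𝒫Q g (trans og o≡) (λ _ ()) dg) dg }
    where
    open KFamily fam
    σ = proj₁ (last σs)
    S : SepSet ∣G∣
    S s = IsSeparation G s × IsProper s × sepOrder s < 1
    order≡0 : ∀ {s} → S s → sepOrder s ≡ 0
    order≡0 (_ , _ , lt) = ℕ.n<1⇒n≡0 lt
    S-swap : SwapClosed S
    S-swap s (sep , pr , lt) = swap-separation G s sep , proper-swap pr , swap< s lt
    S-full : ∀ P Q → 𝒫 P → 𝒫 Q → ∀ s → sepOrder s ≡ 0 → NestedWith U.∅ s → Dist s ⟦ P ⟧ ⟦ Q ⟧ → S s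
    S-full P Q 𝒫P 𝒫Q s o≡ _ d = IsProfile.separations p s (proj₁ d) ,
        Dist-proper p (IsKProfile.isProfile (kprofiles Q 𝒫Q)) d , subst (_< 1) (sym o≡) (s≤s z≤n)
      where p = IsKProfile.isProfile (kprofiles P 𝒫P)
    task : Task S 𝒫
    -- The base case is the level ℓ = 0 over the empty N, where agreement below order 0 is vacuous.
    task = level-task fam {N = U.∅} (λ _ → no λ ()) (λ ()) (λ ()) (λ _ ()) (λ ()) (λ ()) id 𝒫? 𝒫-ext (λ _ _ _ _ _ _ ())
      (λ s → IsSeparation? G s ×-dec (IsProper? s ×-dec (sepOrder s ℕ.<? 1))) S-swap proj₁ order≡0 (λ _ _ ()) S-full
    sol = solve σ task
    N⊆S : ∀ {s} → Nσ G σ S 𝒫 s → S s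
    N⊆S = Nσ⊆ S-swap
  NΣ-good (suc j) σs {𝒫} fam = record
    { N? = glued?
    ; separation = [ prev.separation , S-sep ∘ L⊆S ]′
    ; proper = [ prev.proper , proj₁ ∘ proj₂ ∘ L⊆S ]′
    ; order< = [ ℕ.m≤n⇒m≤1+n ∘ prev.order< , (λ d → subst (_< suc (suc j)) (sym (S-order (L⊆S d))) (ℕ.n<1+n _)) ]′
    ; swap-closed = glued-swap
    ; nested = λ Ns r Nr → glued-nested Ns Nr
    ; distinguishes = glued-distinguishes
    ; efficient = [ efficient-prev , (λ (O , con , d) → efficient-later O con d) ]′ }
    where
    open KFamily fam
    σ = proj₁ (last σs)
    N = NΣ G (suc j) (init σs) (truncate (suc j) 𝒫)
    module prev = Good (NΣ-good j (init σs) (truncate-family fam))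
    S : SepSet ∣G∣
    S s = IsSeparation G s × IsProper s × sepOrder s ≡ suc j × NestedWith N s
    S? : U.Decidable S
    S? s = IsSeparation? G s ×-dec (IsProper? s ×-dec ((sepOrder s ℕ.≟ suc j) ×-dec ∀Sep? (λ r → prev.N? r →-dec Nested? s r)))
    S-sep : ∀ {s} → S s → IsSeparation G s
    S-sep = proj₁
    S-order : ∀ {s} → S s → sepOrder s ≡ suc j
    S-order = proj₁ ∘ proj₂ ∘ proj₂
    S-nested : ∀ {s} → S s → NestedWith N s
    S-nested = proj₂ ∘ proj₂ ∘ proj₂
    S-swap : SwapClosed S
    S-swap s (sep , pr , o≡ , nst) = swap-separation G s sep , proper-swap pr , trans (sepOrder-swap s) o≡ , λ r Nr → Nested-swapˡ (nst r Nr)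
    profiles : ∀ P → 𝒫 P → IsProfile G ⟦ P ⟧
    profiles P 𝒫P = IsKProfile.isProfile (kprofiles P 𝒫P)
    orients : ∀ P → 𝒫 P → ∀ {s} → N s → ⟦ P ⟧ s ⊎ ⟦ P ⟧ (swap s)
    orients P 𝒫P Ns = KProfile.total (kprofiles P 𝒫P) (prev.separation Ns) (ℕ.m≤n⇒m≤1+n (prev.order< Ns))
    truncated : ∀ P → 𝒫 P → truncate (suc j) 𝒫 (truncation (suc j) P)
    truncated P 𝒫P = P , 𝒫P , truncation-≐ (suc j) P
    -- The witnesses at the previous level are truncations of members of 𝒫. The separations in
    -- question have at most the order of e, which is below the cut, so the full profiles contain
    -- the same ones.
    efficient-lower : ∀ {e} → N e → ∃₂ λ P Q → 𝒫 P × 𝒫 Q × Dist e ⟦ P ⟧ ⟦ Q ⟧ × Agree (sepOrder e) ⟦ P ⟧ ⟦ Q ⟧ ×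
      (∀ g → sepOrder g ≡ sepOrder e → (∀ u → N u → sepOrder u < sepOrder e → Nested g u) → Dist g ⟦ P ⟧ ⟦ Q ⟧ → Nested e g)
    efficient-lower {e} Ne with prev.efficient Ne
    ... | _ , _ , (P , 𝒫P , (f , f⁻)) , (Q , 𝒫Q , (h , h⁻)) , (Pe , Qe) , agree , w =
      P , Q , 𝒫P , 𝒫Q , (proj₁ (f Pe) , proj₁ (h Qe)) ,
      (λ s sep lt (Ps , Qs) → let lt′ = ℕ.<-trans lt (prev.order< Ne) in agree s sep lt (f⁻ (Ps , lt′) , h⁻ (Qs , swap< s lt′))) ,
      λ g o≡ nst (Pg , Qg) → let lt′ = subst (_< suc j) (sym o≡) (prev.order< Ne) in w g o≡ nst (f⁻ (Pg , lt′) , h⁻ (Qg , swap< g lt′))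
    -- If a separation of smaller order distinguished them, their truncations would differ, so some
    -- element of N would distinguish these as well; but P and Q orient N in the same way.
    agree : ∀ O P Q → inducing G 𝒫 N O P → inducing G 𝒫 N O Q → Agree (suc j) ⟦ P ⟧ ⟦ Q ⟧
    agree O P Q (𝒫P , p , p⁻) (𝒫Q , q , q⁻) s sep lt (Ps , Qs)
      with prev.distinguishes _ _ (truncated P 𝒫P) (truncated Q 𝒫Q)
    ... | inj₁ (f , _) = KProfile.anti (kprofiles Q 𝒫Q) (proj₁ (proj₁ (truncation-≐ (suc j) Q) (f (proj₂ (truncation-≐ (suc j) P) (Ps , lt))))) Qs
    ... | inj₂ (t , Nt , Pt , Qt) = KProfile.anti (kprofiles Q 𝒫Q)
            (proj₁ (q⁻ (p (proj₁ (proj₁ (truncation-≐ (suc j) P) Pt) , Nt)))) (proj₁ (proj₁ (truncation-≐ (suc j) Q) Qt))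
    S-full : ∀ O P Q → inducing G 𝒫 N O P → inducing G 𝒫 N O Q → ∀ s → sepOrder s ≡ suc j → NestedWith N s →
             Dist s ⟦ P ⟧ ⟦ Q ⟧ → splitters G S O s
    S-full O P Q (𝒫P , _ , p) (𝒫Q , _ , q) s o≡ nst d =
      (IsProfile.separations (profiles P 𝒫P) s (proj₁ d) , Dist-proper (profiles P 𝒫P) (profiles Q 𝒫Q) d , o≡ , nst) ,
      Dist-splits (profiles P 𝒫P) (profiles Q 𝒫Q) (proj₁ ∘ p) (proj₁ ∘ q) d
    task : ∀ O → Task (splitters G S O) (inducing G 𝒫 N O)
    task O = level-task fam {N = N} prev.N? prev.separation prev.order< prev.swap-closed prev.nested
      (λ Ne → let P , Q , 𝒫P , 𝒫Q , d , a , _ = efficient-lower Ne in P , Q , 𝒫P , 𝒫Q , d , a)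
      proj₁ (inducing? 𝒫? prev.N? O) (inducing-ext 𝒫-ext O) (agree O) (λ s → S? s ×-dec Splits? (λ r → T? (O r)) s)
      (λ _ (Ss , a , b) → S-swap _ Ss , b , a) (S-sep ∘ proj₁) (S-order ∘ proj₁) (S-nested ∘ proj₁) (S-full O)
    open Gluing {S = S} prev.N? prev.separation prev.swap-closed S-sep S-swap prev.nested S-nested 𝒫-ext profiles orients σ
      (λ O _ → solve σ (task O))
    L⊆S : ∀ {s} → Later s → S s
    L⊆S (O , _ , d) = proj₁ (Within⊆ O d)
    efficient-prev : ∀ {e} → N e → Efficient (N U.∪ Later) 𝒫 e
    efficient-prev Ne = let P , Q , 𝒫P , 𝒫Q , d , a , w = efficient-lower Ne in
      P , Q , 𝒫P , 𝒫Q , d , a , λ g o≡ nst → w g o≡ (λ u Nu → nst u (inj₁ Nu))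
    efficient-later : ∀ {e} O → ConsistentOrientations G N O → Within O e → Efficient (N U.∪ Later) 𝒫 e
    efficient-later {e} O con de with Nσ-witnessed (proj₂ (last σs)) (task O) de
    ... | P , Q , iP , iQ , d , w = P , Q , proj₁ iP , proj₁ iQ , d ,
      subst (λ ℓ → Agree ℓ ⟦ P ⟧ ⟦ Q ⟧) (sym oe) (agree O P Q iP iQ) ,
      -- All of N has order below that of e, so the assumption on g makes it nested with N and hence
      -- a candidate at this level.
      λ g o≡ nst dg → w g (S-full O P Q iP iQ g (trans o≡ oe)
        (λ u Nu → nst u (inj₁ Nu) (subst (_ <_) (sym oe) (prev.order< Nu))) dg) dg
      where
      oe : sepOrder e ≡ suc j
      oe = S-order (proj₁ (Within⊆ O de))

-- Vertex sets from decidable conditions, and the part of an orientation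

module _ {n : ℕ} {Q : Fin n → Set} (Q? : ∀ v → Dec (Q v)) where

  subsetOf : Subset n
  subsetOf = tabulate λ v → does (Q? v)

  ∈-subsetOf⁺ : ∀ {v} → Q v → v ∈ subsetOf
  ∈-subsetOf⁺ {v} q = Vec.lookup⇒[]= v _ (trans (Vec.lookup∘tabulate _ v) (dec-true (Q? v) q))

  ∈-subsetOf⁻ : ∀ {v} → v ∈ subsetOf → Q v
  ∈-subsetOf⁻ {v} v∈ with Q? v | trans (sym (Vec.lookup∘tabulate (λ v → does (Q? v)) v)) (Vec.[]=⇒lookup v∈)
  ... | yes q | _ = q
  ... | no _  | ()

module _ {n : ℕ} (O : DecSepSet n) where

  private
    inPart? : ∀ v → Dec (∀ s → ⟦ O ⟧ s → v ∈ proj₂ s)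
    inPart? v = ∀Sep? λ s → T? (O s) →-dec (v ∈? proj₂ s)

  abstract

    partOf : Subset n
    partOf = subsetOf inPart?

    ∈-partOf⁺ : ∀ {v} → (∀ s → ⟦ O ⟧ s → v ∈ proj₂ s) → v ∈ partOf
    ∈-partOf⁺ = ∈-subsetOf⁺ inPart?

    ∈-partOf⁻ : ∀ {v} → v ∈ partOf → ∀ s → ⟦ O ⟧ s → v ∈ proj₂ s
    ∈-partOf⁻ = ∈-subsetOf⁻ inPart?

separator : ∀ {n} → Sep n → Subset n
separator (A , B) = A ∩ B

-- Distinct orientations have distinct parts

module DistinctParts (G : Graph) where

  open Tasks G
  open Levels G

  private
    ∣G∣ = ∣V∣ G

  module Orientation {N : SepSet ∣G∣} (N-sep : ∀ {s} → N s → IsSeparation G s) (N-swap : SwapClosed N)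
                     (N-nested : ∀ {s} → N s → NestedWith N s) (O : DecSepSet ∣G∣) (ori : IsOrientation N ⟦ O ⟧) where
    open IsOrientation ori public

    -- The form in which consistency is used from here on: no two elements of O point away from each
    -- other.
    never-apart : ∀ {s r} → ⟦ O ⟧ s → ⟦ O ⟧ r → ¬ swap r ≤ₛ s
    never-apart {s} {r} Os Or r≤s = consistent s (swap r) Os (N-sep (N-swap r (sub Or))) r≤s Or

    one-way : ∀ {s} → ⟦ O ⟧ s → ¬ ⟦ O ⟧ (swap s)
    one-way Os Os′ = never-apart Os Os′ ≤ₛ-refl

    -- Every other element of O is below m or points towards m, and in either case its second side
    -- contains one of the two sides of m.
    maximal-separator : ∀ {m} → Maximal ⟦ O ⟧ m → separator m ⊆ partOf O
    maximal-separator {m} (Om , max) {v} v∈ = ∈-partOf⁺ O λ s Os → go s Os (N-nested (sub Os) m (sub Om))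
      where
      v∈m = x∈p∩q⁻ (proj₁ m) (proj₂ m) v∈
      go : ∀ s → ⟦ O ⟧ s → Nested s m → v ∈ proj₂ s
      go s Os (≤n s≤m)  = proj₂ s≤m (proj₂ v∈m)
      go s Os (≥n m≤s) with refl ← max s Os m≤s = proj₂ v∈m
      go s Os (≤sn s≤m) = proj₂ s≤m (proj₁ v∈m)
      go s Os (≥sn m≤s) = ⊥-elim (never-apart Os Om m≤s)

    Max? : U.Decidable (Maximal ⟦ O ⟧)
    Max? = Maximal? λ s → T? (O s)

    ∈-partOf-maximal : ∀ {v} → (∀ m → Maximal ⟦ O ⟧ m → v ∈ proj₂ m) → v ∈ partOf O
    ∈-partOf-maximal h = ∈-partOf⁺ O λ s Os →
      let m , max , s≤m = ∃-maximal (λ s → T? (O s)) s Os in proj₂ s≤m (h m max)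

  -- A profile is closed only under joins of order below k. Separators inside the small set X stay
  -- inside X under joins, so that bound is met however many separations are joined.
  profile-join : ∀ {k P} → IsKProfile G k P → ∀ (X : Subset ∣G∣) → ∣ X ∣ < k → ∀ fs →
                 (∀ f → f ∈ₗ fs → P f × separator f ⊆ X) →
                 ∃[ u ] P u × separator u ⊆ X × (∀ f → f ∈ₗ fs → f ≤ₛ u)
  -- The empty join is the least separation; consistency excludes its inverse from P.
  profile-join {P = P} prof X X<k [] _ = (∅ , ⊤) ,
      [ id , (λ P⊤ → ⊥-elim (p.consistent (⊤ , ∅) (∅ , ⊤) P⊤ sep (⊥⊆ , ⊥⊆) P⊤)) ]′ (p.total sep small) , ⊆X , λ _ ()
    where
    module p = KProfile prof
    sep : IsSeparation G (∅ , ⊤)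
    sep = mkSeparation G (∅ , ⊤) (λ _ → inj₂ ∈⊤) (λ _ _ _ → inj₂ (∈⊤ , ∈⊤))
    ⊆X : ∅ ∩ ⊤ ⊆ X
    ⊆X v∈ = ⊥-elim (∉⊥ (proj₁ (x∈p∩q⁻ ∅ ⊤ v∈)))
    small = ℕ.≤-<-trans (p⊆q⇒∣p∣≤∣q∣ ⊆X) X<k
  profile-join prof X X<k (f ∷ fs) h with profile-join prof X X<k fs (λ g g∈ → h g (there g∈))
  ... | u , Pu , u⊆X , ub = f ∨ₛ u , KProfile.join prof Pf Pu (ℕ.≤-<-trans (p⊆q⇒∣p∣≤∣q∣ ⊆X) X<k) , ⊆X ,
      λ { g (here refl) → ∨ₛ-upperˡ {s = f} {u} ; g (there g∈) → ≤ₛ-trans (ub g g∈) (∨ₛ-upperʳ {s = f} {u}) }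
    where
    Pf = proj₁ (h f (here refl))
    f⊆X = proj₂ (h f (here refl))
    ⊆X : separator (f ∨ₛ u) ⊆ X
    ⊆X v∈ with x∈p∩q⁻ (proj₁ f ∪ proj₁ u) _ v∈
    ... | a , b with x∈p∪q⁻ (proj₁ f) (proj₁ u) a | x∈p∩q⁻ (proj₂ f) (proj₂ u) b
    ...   | inj₁ a′ | b′ , _ = f⊆X (x∈p∩q⁺ (a′ , b′))
    ...   | inj₂ a′ | _ , b′ = u⊆X (x∈p∩q⁺ (a′ , b′))

  -- Says that X is exactly the separator of s.
  record Spans (s : Sep ∣G∣) (X : Subset ∣G∣) : Set where
    field
      left  : X ⊆ proj₁ s
      right : X ⊆ proj₂ s
      back  : separator s ⊆ X

    order-≤ : sepOrder s ≤ ∣ X ∣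
    order-≤ = p⊆q⇒∣p∣≤∣q∣ back

    order-≥ : ∣ X ∣ ≤ sepOrder s
    order-≥ = p⊆q⇒∣p∣≤∣q∣ λ v∈ → x∈p∩q⁺ (left v∈ , right v∈)

    both : ∀ {v} → v ∈ proj₁ s → v ∈ proj₂ s → v ∈ X
    both a b = back (x∈p∩q⁺ (a , b))

    order-≡ : sepOrder s ≡ ∣ X ∣
    order-≡ = ℕ.≤-antisym order-≤ order-≥

  Spans-swap : ∀ {s X} → Spans s X → Spans (swap s) X
  Spans-swap {s} sp = record { left = right ; right = left ; back = λ v∈ → let b , a = x∈p∩q⁻ (proj₂ s) (proj₁ s) v∈ in both a b }
    where open Spans sp

  Spans-∨ₛ : ∀ {s r X} → Spans s X → Spans r X → Spans (s ∨ₛ r) X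
  Spans-∨ₛ {s} {r} spans-s spans-r = record
    { left = λ v∈ → x∈p∪q⁺ (inj₁ (s.left v∈))
    ; right = λ v∈ → x∈p∩q⁺ (s.right v∈ , r.right v∈)
    ; back = λ v∈ → let a , b = x∈p∩q⁻ (proj₁ s ∪ proj₁ r) _ v∈
                        b₁ , b₂ = x∈p∩q⁻ (proj₂ s) (proj₂ r) b
                    in [ (λ a′ → s.both a′ b₁) , (λ a′ → r.both a′ b₂) ]′ (x∈p∪q⁻ (proj₁ s) (proj₁ r) a) }
    where
    module s = Spans spans-s
    module r = Spans spans-r

  -- A separation between s and the inverse of r would have X in its separator.
  Nested-spanning-∨ₛ : ∀ {u s r X} → Spans s X → Spans r X → sepOrder u < ∣ X ∣ →
                       Nested u s → Nested u r → Nested u (s ∨ₛ r)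
  Nested-spanning-∨ₛ {u} {s} {r} {X} spans-s spans-r lt nst nst′ =
    [ id , [ (λ (s≤u , u≤r) → ⊥-elim (too-small {u} s≤u u≤r lt))
           , (λ (s≤u , u≤r) → ⊥-elim (too-small {swap u} s≤u u≤r (swap< u lt))) ]′ ]′ (Nested-∨ₛ {s = s} {r} nst nst′)
    where
    too-small : ∀ {u} → s ≤ₛ u → u ≤ₛ swap r → ¬ sepOrder u < ∣ X ∣
    too-small s≤u u≤r lt = ℕ.<⇒≱ lt (p⊆q⇒∣p∣≤∣q∣ λ v∈ →
      x∈p∩q⁺ (proj₁ s≤u (Spans.left spans-s v∈) , proj₂ u≤r (Spans.left spans-r v∈)))

  module _ {k : ℕ} {N : SepSet ∣G∣} {𝒫 : Family ∣G∣} (fam : KFamily k 𝒫) (good : Good k N 𝒫) where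
    open KFamily fam
    open Good good

    -- If every maximal element of O were in Q, then so would be their join, a separation whose second side is the part of O.
    separated-beyond : ∀ O → IsOrientation N ⟦ O ⟧ → ∀ {e} → Maximal ⟦ O ⟧ (swap e) → Spans e (partOf O) →
                  ∀ P Q → 𝒫 P → 𝒫 Q → Dist e ⟦ P ⟧ ⟦ Q ⟧ → Agree (sepOrder e) ⟦ P ⟧ ⟦ Q ⟧ →
                  ∃[ f ] ⟦ O ⟧ f × f ≤ₛ e × f ≢ e × Spans f (partOf O) × Dist f ⟦ P ⟧ ⟦ Q ⟧
    separated-beyond O ori {e} maxe@(Oe , emax) spans P Q 𝒫P 𝒫Q (Pe , Qe) agree with ∃Sep? (λ f → Max? f ×-dec ¬? (T? (Q f)))
      where open Orientation separation swap-closed nested O ori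
    ... | no ¬f = ⊥-elim (KProfile.consistent q u (swap u) Qu (swap-separation G u (KProfile.separations q u Qu)) (B⊆A , B⊆A) Qu)
      where
      open Orientation separation swap-closed nested O ori
      open Spans spans
      q = kprofiles Q 𝒫Q
      fs = filter Max? (allSeps ∣G∣)
      all-in-Q : ∀ f → f ∈ₗ fs → ⟦ Q ⟧ f × separator f ⊆ partOf O
      all-in-Q f f∈ = let max = proj₂ (∈-filter⁻ Max? {xs = allSeps ∣G∣} f∈) in
        decidable-stable (T? (Q f)) (λ ¬Qf → ¬f (f , max , ¬Qf)) , maximal-separator max
      joined = profile-join q (partOf O) (ℕ.≤-<-trans order-≥ (KProfile.order< (kprofiles P 𝒫P) e Pe)) fs all-in-Q
      u = proj₁ joined
      Qu = proj₁ (proj₂ joined)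
      below : ∀ f → Maximal ⟦ O ⟧ f → f ≤ₛ u
      below f max = proj₂ (proj₂ (proj₂ joined)) f (∈-filter⁺ Max? (∈-allSeps f) max)
      -- The second side of u lies in that of every maximal element, hence in the part, hence in the
      -- second side of e; and this is inside the first side of u because u is above the inverse of
      -- e.
      B⊆A : proj₂ u ⊆ proj₁ u
      B⊆A v∈ = proj₁ (below (swap e) maxe) (right (∈-partOf-maximal λ m max → proj₂ (below m max) v∈))
    ... | yes (f , maxf@(Of , fmax) , ¬Qf) = f , Of , f≤e , (λ { refl → one-way Of Oe }) , spansf , Pf , Qf
      where
      open Orientation separation swap-closed nested O ori
      open Spans spans
      p = kprofiles P 𝒫P
      q = kprofiles Q 𝒫Q
      f⊆X = maximal-separator maxf
      f<k : sepOrder f < k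
      f<k = ℕ.≤-<-trans (ℕ.≤-trans (p⊆q⇒∣p∣≤∣q∣ f⊆X) order-≥) (KProfile.order< p e Pe)
      sepf = separation (sub Of)
      Qf : ⟦ Q ⟧ (swap f)
      Qf = [ ⊥-elim ∘ ¬Qf , id ]′ (KProfile.total q sepf f<k)
      f≢ : f ≢ swap e
      f≢ refl = ¬Qf Qe
      f≤e : f ≤ₛ e
      f≤e with nested (sub Of) (swap e) (sub Oe)
      ... | ≤sn f≤e = f≤e
      ... | ≥sn e≤f = ⊥-elim (never-apart Of Oe e≤f)
      ... | ≤n f≤e  = ⊥-elim (f≢ (sym (fmax _ Oe f≤e)))
      ... | ≥n e≤f  = ⊥-elim (f≢ (emax _ Of e≤f))
      Pf = KProfile.down p Pe sepf f<k f≤e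
      -- As f distinguishes P and Q, which e does efficiently, its order is at least the size of the
      -- part. So its separator, contained in the part, fills it.
      X⊆ : partOf O ⊆ separator f
      X⊆ = ⊆∧≥⇒⊇ f⊆X (ℕ.≤-trans order-≥ (ℕ.≮⇒≥ λ lt → agree f sepf lt (Pf , Qf)))
      spansf : Spans f (partOf O)
      spansf = record { left = λ v∈ → proj₁ (x∈p∩q⁻ (proj₁ f) (proj₂ f) (X⊆ v∈))
                      ; right = λ v∈ → proj₂ (x∈p∩q⁻ (proj₁ f) (proj₂ f) (X⊆ v∈)) ; back = f⊆X }

    -- The join of f and h competes with e for P and Q. Each of `f≢e`, `H⊈X`, `B⊈H` and the
    -- properness of f rules out one of the four ways in which it could be nested with e.
    module _ {X : Subset ∣G∣} {e f h : Sep ∣G∣} (Ne : N e) (Nf : N f) (spans-e : Spans e X) (spans-f : Spans f X) (spans-h : Spans h X)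
             (f≤e : f ≤ₛ e) (f≢e : f ≢ e) (h≤ : h ≤ₛ swap e) (H⊈X : ¬ proj₁ h ⊆ X) (B⊈H : ¬ proj₂ e ⊆ proj₁ h)
             (P Q : DecSepSet ∣G∣) (𝒫P : 𝒫 P) (𝒫Q : 𝒫 Q) (df : Dist f ⟦ P ⟧ ⟦ Q ⟧) (Ph : ⟦ P ⟧ h)
             (nested-h : ∀ u → N u → sepOrder u < sepOrder e → Nested u h)
             (uncrossed : ∀ g → sepOrder g ≡ sepOrder e → (∀ u → N u → sepOrder u < sepOrder e → Nested g u) →
                          Dist g ⟦ P ⟧ ⟦ Q ⟧ → Nested e g) where

      private
        module e = Spans spans-e
        module f = Spans spans-f
        module h = Spans spans-h

        spans-g : Spans (f ∨ₛ h) X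
        spans-g = Spans-∨ₛ spans-f spans-h

        e-order : ∀ {s} → Spans s X → sepOrder s ≡ sepOrder e
        e-order sp = trans (Spans.order-≡ sp) (sym e.order-≡)

        nested-g : ∀ u → N u → sepOrder u < sepOrder e → Nested (f ∨ₛ h) u
        nested-g u Nu lt = Nested-sym (Nested-spanning-∨ₛ spans-f spans-h (subst (_ <_) e.order-≡ lt) (nested Nu f Nf) (nested-h u Nu lt))

        dg : Dist (f ∨ₛ h) ⟦ P ⟧ ⟦ Q ⟧
        dg = Dist-∨ₛ (kprofiles P 𝒫P) (kprofiles Q 𝒫Q) {f} {h} df Ph (subst (_< k) (sym (e-order spans-g)) (order< Ne))

        crosses : ¬ Nested e (f ∨ₛ h)
        crosses (≤n (A⊆ , _)) = f≢e (≤ₛ-antisym f≤e (A⊆A , B⊆B))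
          where
          A⊆A : proj₁ e ⊆ proj₁ f
          A⊆A a = [ id , (λ a′ → f.left (h.both a′ (proj₂ h≤ a))) ]′ (x∈p∪q⁻ (proj₁ f) (proj₁ h) (A⊆ a))
          B⊆B : proj₂ f ⊆ proj₂ e
          B⊆B {v} b = [ (λ a → e.right (f.both (A⊆A a) b)) , id ]′ (sep-cover G e (separation Ne) v)
        crosses (≥n (⊆A , _)) = H⊈X λ v∈ → e.both (⊆A (x∈p∪q⁺ (inj₂ v∈))) (proj₁ h≤ v∈)
        crosses (≤sn (_ , ⊆B)) = proj₁ (proper Nf) λ a → f.right (e.both (proj₁ f≤e a) (⊆B (x∈p∪q⁺ (inj₁ a))))
        crosses (≥sn (_ , B⊆)) = B⊈H λ b → [ (λ a → h.left (e.both (proj₁ f≤e a) b)) , id ]′ (x∈p∪q⁻ (proj₁ f) (proj₁ h) (B⊆ b))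

      no-crossing-corner : ⊥
      no-crossing-corner = crosses (uncrossed (f ∨ₛ h) (e-order spans-g) nested-g dg)

    module _ (O O′ : DecSepSet ∣G∣) (ori : IsOrientation N ⟦ O ⟧) (ori′ : IsOrientation N ⟦ O′ ⟧) (V≡V′ : partOf O ≡ partOf O′)
             {e e′ : Sep ∣G∣} (e-maximal : Maximal ⟦ O ⟧ (swap e)) (e′-maximal : Maximal ⟦ O′ ⟧ e′)
             (O′e : ⟦ O′ ⟧ e) (Oe′ : ⟦ O ⟧ (swap e′)) (e≤e′ : e ≤ₛ e′) where

      private
        module o  = Orientation separation swap-closed nested O ori
        module o′ = Orientation separation swap-closed nested O′ ori′
        X = partOf O
        Ne = o′.sub O′e
        Ne′ = o′.sub (proj₁ e′-maximal)

        -- X is the part of both orientations, so it lies in both sides of a separation that they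
        -- orient oppositely.
        spans : ∀ {s} → ⟦ O′ ⟧ s → ⟦ O ⟧ (swap s) → separator s ⊆ X → Spans s X
        spans {s} O′s Os back = record
          { left = λ v∈ → ∈-partOf⁻ O v∈ (swap s) Os
          ; right = λ {v} v∈ → ∈-partOf⁻ O′ (subst (v ∈_) V≡V′ v∈) s O′s ; back = back }

        spans-e : Spans e X
        spans-e = spans O′e (proj₁ e-maximal)
          λ v∈ → let a , b = x∈p∩q⁻ (proj₁ e) (proj₂ e) v∈ in o.maximal-separator e-maximal (x∈p∩q⁺ (b , a))

        spans-e′ : Spans e′ X
        spans-e′ = spans (proj₁ e′-maximal) Oe′ λ {v} v∈ → subst (v ∈_) (sym V≡V′) (o′.maximal-separator e′-maximal v∈)

        module e = Spans spans-e
        module e′ = Spans spans-e′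

        module _ (P Q : DecSepSet ∣G∣) (𝒫P : 𝒫 P) (𝒫Q : 𝒫 Q) (de : Dist e ⟦ P ⟧ ⟦ Q ⟧)
                 (uncrossed : ∀ g → sepOrder g ≡ sepOrder e → (∀ u → N u → sepOrder u < sepOrder e → Nested g u) →
                              Dist g ⟦ P ⟧ ⟦ Q ⟧ → Nested e g)
                 {f : Sep ∣G∣} (Of : ⟦ O ⟧ f) (f≤e : f ≤ₛ e) (f≢e : f ≢ e) (spans-f : Spans f X) (df : Dist f ⟦ P ⟧ ⟦ Q ⟧) where

          p = kprofiles P 𝒫P

          -- If P sits between e and e′, the inverse of e′ can play the role of h. The inclusion to
          -- be excluded would make e and e′ equal, against P containing e.
          P-before-e′ : ¬ ⟦ P ⟧ (swap e′)
          P-before-e′ Pe′ = no-crossing-corner Ne (o.sub Of) spans-e spans-f (Spans-swap spans-e′) f≤e f≢e (swap-anti e≤e′)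
                  (λ B⊆X → proj₂ (proper Ne′) (e′.left ∘ B⊆X)) B⊈B P Q 𝒫P 𝒫Q df Pe′
                  (λ u Nu _ → Nested-swapʳ (nested Nu e′ Ne′)) uncrossed
            where
            B⊈B : ¬ proj₂ e ⊆ proj₂ e′
            B⊈B B⊆B = KProfile.anti p (proj₁ de) (subst (λ s → ⟦ P ⟧ (swap s)) (≤ₛ-antisym (A⊆A , B⊆B) e≤e′) Pe′)
              where
              A⊆A : proj₁ e′ ⊆ proj₁ e
              A⊆A {v} a = [ id , (λ b → e.left (e′.both a (B⊆B b))) ]′ (sep-cover G e (separation Ne) v)

          module _ {c : Sep ∣G∣} (O′c : ⟦ O′ ⟧ c) (c≤e′ : c ≤ₛ swap e′) (c≢e′ : c ≢ swap e′) (spans-c : Spans c X) (Pc : ⟦ P ⟧ (swap c)) where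

            Nc = o′.sub O′c
            module c = Spans spans-c

            spans-j : Spans (e ∨ₛ c) X
            spans-j = Spans-∨ₛ spans-e spans-c

            H⊈X : ¬ proj₂ e ∩ proj₂ c ⊆ X
            H⊈X ⊆X = c≢e′ (≤ₛ-antisym c≤e′ (B⊆A , B⊆A′))
              where
              B⊆A : proj₂ e′ ⊆ proj₁ c
              B⊆A {v} b = [ id , (λ b′ → c.left (⊆X (x∈p∩q⁺ (proj₂ e≤e′ b , b′)))) ]′ (sep-cover G c (separation Nc) v)
              B⊆A′ : proj₂ c ⊆ proj₁ e′
              B⊆A′ {v} b = [ id , (λ b′ → e′.left (⊆X (x∈p∩q⁺ (proj₂ e≤e′ b′ , b)))) ]′ (sep-cover G e′ (separation Ne′) v)

            B⊈H : ¬ proj₂ e ⊆ proj₂ e ∩ proj₂ c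
            B⊈H ⊆H = proj₁ (proper Nc) λ a → proj₂ (x∈p∩q⁻ (proj₂ e) (proj₂ c) (⊆H (proj₂ e≤e′ (proj₁ c≤e′ a))))

            Ph : ⟦ P ⟧ (swap (e ∨ₛ c))
            Ph = KProfile.down p Pc (swap-separation G (e ∨ₛ c) (∨ₛ-separation G e c (separation Ne) (separation Nc)))
                   (swap< (e ∨ₛ c) (subst (_< k) (trans e.order-≡ (sym (Spans.order-≡ spans-j))) (order< Ne)))
                   (swap-anti {s = c} {e ∨ₛ c} (∨ₛ-upperʳ {s = e} {c}))

            nested-h : ∀ u → N u → sepOrder u < sepOrder e → Nested u (swap (e ∨ₛ c))
            nested-h u Nu lt = Nested-swapʳ
              (Nested-spanning-∨ₛ spans-e spans-c (subst (_ <_) e.order-≡ lt) (nested Nu e Ne) (nested Nu c Nc))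

            -- The inverse of c is in P but not below that of e. So h is taken as the meet of the
            -- two inverses, which has separator X again.
            P-beyond-e′ : ⊥
            P-beyond-e′ = no-crossing-corner Ne (o.sub Of) spans-e spans-f (Spans-swap spans-j) f≤e f≢e
              (swap-anti {s = e} {e ∨ₛ c} (∨ₛ-upperˡ {s = e} {c})) H⊈X B⊈H P Q 𝒫P 𝒫Q df Ph nested-h uncrossed

      parts-clash : ⊥
      parts-clash =
        let P , Q , 𝒫P , 𝒫Q , de , agree , uncrossed = efficient Ne
            f , Of , f≤e , f≢e , spans-f , df = separated-beyond O ori e-maximal spans-e P Q 𝒫P 𝒫Q de agree
            Qe′ = KProfile.down (kprofiles Q 𝒫Q) (proj₂ de) (separation (swap-closed _ Ne′)) (order< (swap-closed _ Ne′)) (swap-anti e≤e′)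
        -- How P orients e′ decides which h is joined to f. If P contains e′, then Q contains its
        -- inverse, and `separated-beyond` at O′, with P and Q exchanged, yields a c beyond e′.
        in [ (λ Pe′ →
               let c , O′c , c≤e′ , c≢e′ , spans-c , (Qc , Pc) = separated-beyond O′ ori′ {swap e′} e′-maximal
                     (subst (Spans (swap e′)) V≡V′ (Spans-swap spans-e′)) Q P 𝒫Q 𝒫P (Qe′ , Pe′)
                     (subst (λ ℓ → Agree ℓ ⟦ Q ⟧ ⟦ P ⟧) (trans (trans e.order-≡ (sym e′.order-≡)) (sym (sepOrder-swap e′)))
                       (Agree-sym {P = ⟦ P ⟧} {⟦ Q ⟧} agree))
               in P-beyond-e′ P Q 𝒫P 𝒫Q de uncrossed Of f≤e f≢e spans-f df O′c c≤e′ c≢e′ (subst (Spans c) (sym V≡V′) spans-c) Pc)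
           , P-before-e′ P Q 𝒫P 𝒫Q de uncrossed Of f≤e f≢e spans-f df ]′
           (KProfile.total (kprofiles P 𝒫P) (separation Ne′) (order< Ne′))

    -- Among the separations that lead from O to O′, a minimal one has its inverse maximal in O and
    -- a maximal one is maximal in O′: by consistency, anything further out would also be oriented
    -- oppositely by O and O′.
    distinct-parts : ∀ O O′ → IsOrientation N ⟦ O ⟧ → IsOrientation N ⟦ O′ ⟧ → partOf O ≡ partOf O′ → ⟦ O ⟧ U.≐ ⟦ O′ ⟧
    distinct-parts O O′ ori ori′ V≡V′ = [ id , ⊥-elim ∘ contra ]′ (≐-or-differ O O′ ori ori′)
      where
      module o  = Orientation separation swap-closed nested O ori
      module o′ = Orientation separation swap-closed nested O′ ori′
      Between : SepSet ∣G∣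
      Between s = ⟦ O′ ⟧ s × ⟦ O ⟧ (swap s)
      Between? : U.Decidable Between
      Between? s = T? (O′ s) ×-dec T? (O (swap s))
      contra : ¬ (∃[ d ] ⟦ O ⟧ d × ⟦ O′ ⟧ (swap d))
      contra (d , Od , O′d) with ∃-minimal {Q = Between} Between? (swap d) (O′d , Od)
      ... | e , be , min , _ with ∃-maximal {Q = Between} Between? e be
      ...   | e′ , (be′ , max) , e≤e′ = parts-clash O O′ ori ori′ V≡V′
        (proj₂ be , λ f Of e≤f → cong swap (min (swap f)
          ([ (λ O′f → ⊥-elim (o′.never-apart (proj₁ be) O′f (swap-anti e≤f))) , id ]′ (o′.total (o.sub Of)) , Of) (swap-anti e≤f)))
        (proj₁ be′ , λ f O′f e≤f → max f
          (O′f , [ (λ Of → ⊥-elim (o.never-apart Of (proj₂ be′) e≤f)) , id ]′ (o.total (o′.sub O′f))) e≤f)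
        (proj₁ be) (proj₂ be′) e≤e′

-- The tree of consistent orientations

-- One representative is kept from each extensional class, so that indices can serve as the nodes of
-- the tree.
record Enumeration (𝒬 : Family n) (Ps : List (DecSepSet n)) : Set where
  field
    size      : ℕ
    node      : Fin size → DecSepSet n
    sound     : ∀ i → 𝒬 (node i)
    injective : ∀ {i j} → ⟦ node i ⟧ U.≐ ⟦ node j ⟧ → i ≡ j
    complete  : ∀ P → P ∈ₗ Ps → 𝒬 P → ∃[ i ] ⟦ node i ⟧ U.≐ ⟦ P ⟧

enumerate : {𝒬 : Family n} → U.Decidable 𝒬 → ∀ Ps → Enumeration 𝒬 Ps
enumerate 𝒬? [] = record { size = 0 ; node = λ () ; sound = λ () ; injective = λ { {()} } ; complete = λ _ () }
enumerate {n} {𝒬} 𝒬? (P ∷ Ps) with enumerate 𝒬? Ps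
... | enum with 𝒬? P | Fin.any? (λ i → (λ s → T? (Enumeration.node enum i s)) ≐? (λ s → T? (P s)))
...   | no ¬q | _ = record { Enumeration enum ; complete = λ { _ (here refl) q → ⊥-elim (¬q q) ; Q (there Q∈) → Enumeration.complete enum Q Q∈ } }
...   | yes q | yes old = record { Enumeration enum ; complete = λ { _ (here refl) _ → old ; Q (there Q∈) → Enumeration.complete enum Q Q∈ } }
...   | yes q | no new = record { size = suc size ; node = node′ ; sound = sound′ ; injective = injective′ ; complete = complete′ }
  where
  open Enumeration enum
  node′ : Fin (suc size) → DecSepSet n
  node′ zero    = P
  node′ (suc i) = node i
  sound′ : ∀ i → 𝒬 (node′ i)
  sound′ zero    = q
  sound′ (suc i) = sound i
  injective′ : ∀ {i j} → ⟦ node′ i ⟧ U.≐ ⟦ node′ j ⟧ → i ≡ j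
  injective′ {zero}  {zero}  _  = refl
  injective′ {zero}  {suc j} eq = ⊥-elim (new (j , ≐-sym eq))
  injective′ {suc i} {zero}  eq = ⊥-elim (new (i , eq))
  injective′ {suc i} {suc j} eq = cong suc (injective eq)
  complete′ : ∀ Q → Q ∈ₗ P ∷ Ps → 𝒬 Q → ∃[ i ] ⟦ node′ i ⟧ U.≐ ⟦ Q ⟧
  complete′ Q (here refl) _ = zero , id , id
  complete′ Q (there Q∈) q  = let i , eq = complete Q Q∈ q in suc i , eq

module _ {H : Graph} where

  start∈vertices : ∀ {u v} (w : Walk H u v) → u ∈ₗ vertices H w
  start∈vertices ε       = here refl
  start∈vertices (_ ◅ _) = here refl

  end∈vertices : ∀ {u v} (w : Walk H u v) → v ∈ₗ vertices H w
  end∈vertices ε       = here refl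
  end∈vertices (_ ◅ w) = there (end∈vertices w)

module _ (𝒯 : TreeDecomposition G) where

  open TreeDecomposition 𝒯 using (Induces)

  Induces-unique : ∀ {t₁ t₂ s r} → Induces t₁ t₂ s → Induces t₁ t₂ r → s ≡ r
  Induces-unique (a , b) (c , d) = cong₂ _,_ (ext-≡ a c) (ext-≡ b d)
    where
    ext-≡ : {p q : Subset (∣V∣ G)} {Q : Vertex G → Set} → (∀ v → v ∈ p ⇔ Q v) → (∀ v → v ∈ q ⇔ Q v) → p ≡ q
    ext-≡ f g = ⊆-antisym (λ {v} v∈ → Equivalence.from (g v) (Equivalence.to (f v) v∈))
                          (λ {v} v∈ → Equivalence.from (f v) (Equivalence.to (g v) v∈))

module Trees (G : Graph) where

  open Tasks G
  open Solutions G
  open DistinctParts G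

  private
    ∣G∣ = ∣V∣ G

  record NestedSystem (N : SepSet ∣G∣) : Set where
    field
      N?          : U.Decidable N
      separation  : ∀ {s} → N s → IsSeparation G s
      proper      : ∀ {s} → N s → IsProper s
      swap-closed : SwapClosed N
      nested      : ∀ {s} → N s → NestedWith N s

  -- The edge from O to O′ with label e. For orientations of the same set, the last clause already
  -- makes O′ equal to O with the inverse of e replaced by e.
  Flip : Sep ∣G∣ → SepSet ∣G∣ → SepSet ∣G∣ → Set
  Flip e O O′ = O′ e × O (swap e) × (∀ f → O f → f ≡ swap e ⊎ O′ f)

  Flip-resp : ∀ {e O O′ Q Q′} → O U.≐ Q → O′ U.≐ Q′ → Flip e O O′ → Flip e Q Q′
  Flip-resp (f , g) (h , _) (a , b , c) = h a , f b , λ r Qr → Sum.map₂ h (c r (g Qr))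

  module FromSystem {N : SepSet ∣G∣} (sys : NestedSystem N) where
    open NestedSystem sys

    module Ori (O : DecSepSet ∣G∣) (ori : IsOrientation N ⟦ O ⟧) where
      open Orientation separation swap-closed nested O ori public

    IsOri : Family ∣G∣
    IsOri O = IsOrientation N ⟦ O ⟧

    IsOri-ext : Extensional IsOri
    IsOri-ext P Q (f , g) o = record
      { sub = sub ∘ g ; total = Sum.map f f ∘ total ; consistent = λ s r Qs sep r≤s Qr → consistent s r (g Qs) sep r≤s (g Qr) }
      where open IsOrientation o

    IsOri? : U.Decidable IsOri
    IsOri? O = map′ (λ (a , b , c) → record { sub = λ {s} → a s ; total = λ {s} → b s ; consistent = c })
                    (λ o → (λ s → IsOrientation.sub o) , (λ s → IsOrientation.total o) , IsOrientation.consistent o)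
      (∀Sep? (λ s → T? (O s) →-dec N? s) ×-dec
       (∀Sep? (λ s → N? s →-dec (T? (O s) ⊎-dec T? (O (swap s)))) ×-dec Consistent? (λ s → T? (O s))))

    flip-sym : ∀ O O′ → IsOri O → IsOri O′ → ∀ {e} → Flip e ⟦ O ⟧ ⟦ O′ ⟧ → Flip (swap e) ⟦ O′ ⟧ ⟦ O ⟧
    flip-sym O O′ o o′ {e} (O′e , Oe , keep) = Oe , O′e , λ f O′f →
      [ inj₂ , [ inj₁ ∘ cong swap , ⊥-elim ∘ Ori.one-way O′ o′ O′f ]′ ∘ keep (swap f) ]′
        (IsOrientation.total o (IsOrientation.sub o′ O′f))

    flip-maximal : ∀ O O′ → IsOri O → IsOri O′ → ∀ {e} → Flip e ⟦ O ⟧ ⟦ O′ ⟧ → Maximal ⟦ O ⟧ (swap e)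
    flip-maximal O O′ o o′ (O′e , Oe , keep) = Oe , λ f Of e≤f → [ id , (λ O′f → ⊥-elim (Ori.never-apart O′ o′ O′f O′e e≤f)) ]′ (keep f Of)

    -- A label determines the ends of its edge: its inverse is maximal in the tail, and for every
    -- other separation nestedness with it leaves only one consistent choice.
    flip-unique : ∀ O O′ Q Q′ → IsOri O → IsOri O′ → IsOri Q → IsOri Q′ →
                  ∀ {e} → Flip e ⟦ O ⟧ ⟦ O′ ⟧ → Flip e ⟦ Q ⟧ ⟦ Q′ ⟧ → ∀ {f} → ⟦ O ⟧ f → ⟦ Q ⟧ f
    flip-unique O O′ Q Q′ o o′ q q′ {e} F F′ {f} Of =
      [ id , (λ Qf → ⊥-elim (contra Qf (nested (IsOrientation.sub o Of) (swap e) (IsOrientation.sub o Oe)))) ]′ (IsOrientation.total q (IsOrientation.sub o Of))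
      where
      Oe = proj₁ (proj₂ F)
      Qe = proj₁ (proj₂ F′)
      contra : ⟦ Q ⟧ (swap f) → ¬ Nested f (swap e)
      contra Qf (≤n f≤e) = Ori.never-apart Q q Qe Qf f≤e
      contra Qf (≥n e≤f) with refl ← proj₂ (flip-maximal O O′ o o′ F) f Of e≤f = Ori.one-way Q q Qe Qf
      contra Qf (≤sn f≤e) with refl ← proj₂ (flip-maximal Q Q′ q q′ F′) (swap f) Qf (swap-anti f≤e) = Ori.one-way O o Of Oe
      contra Qf (≥sn e≤f) = Ori.never-apart O o Of Oe e≤f

    -- After the exchange, an inconsistency would involve e and an element of O strictly above the
    -- inverse of e, which maximality excludes.
    flip-exists : ∀ O → IsOri O → ∀ {e} → Maximal ⟦ O ⟧ (swap e) → ∃[ O′ ] IsOri O′ × Flip e ⟦ O ⟧ ⟦ O′ ⟧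
    flip-exists O o {e} (Oe , max) = decSet Q? , IsOri-decSet , decSet⁺ Q? (inj₁ refl) , Oe , keep
      where
      open Ori O o
      Q : SepSet ∣G∣
      Q s = s ≡ e ⊎ (⟦ O ⟧ s × s ≢ swap e)
      Q? : U.Decidable Q
      Q? s = (s ≟ₛ e) ⊎-dec (T? (O s) ×-dec ¬? (s ≟ₛ swap e))
      Ne : N e
      Ne = swap-closed _ (sub Oe)
      con : ∀ s r → Q s → r ≤ₛ s → ¬ Q (swap r)
      con s r (inj₁ refl) r≤s (inj₁ refl) = proj₂ (proper Ne) (proj₁ r≤s)
      con s r (inj₁ refl) r≤s (inj₂ (Or , r≢)) = r≢ (max _ Or (swap-anti r≤s))
      con s r (inj₂ (Os , s≢)) r≤s (inj₁ refl) = s≢ (max s Os r≤s)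
      con s r (inj₂ (Os , _)) r≤s (inj₂ (Or , _)) = never-apart Os Or r≤s
      IsOri-decSet : IsOri (decSet Q?)
      IsOri-decSet = record
        { sub = λ Qs → [ (λ { refl → Ne }) , sub ∘ proj₁ ]′ (decSet⁻ Q? Qs)
        ; total = λ {s} Ns → tot s Ns (s ≟ₛ e) (s ≟ₛ swap e)
        ; consistent = λ s r Qs _ r≤s Qr → con s r (decSet⁻ Q? Qs) r≤s (decSet⁻ Q? Qr) }
        where
        tot : ∀ s → N s → Dec (s ≡ e) → Dec (s ≡ swap e) → ⟦ decSet Q? ⟧ s ⊎ ⟦ decSet Q? ⟧ (swap s)
        tot s Ns (yes s≡e) _ = inj₁ (decSet⁺ Q? (inj₁ s≡e))
        tot s Ns (no _) (yes refl) = inj₂ (decSet⁺ Q? (inj₁ refl))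
        tot s Ns (no s≢e) (no s≢e′) = Sum.map (λ Os → decSet⁺ Q? (inj₂ (Os , s≢e′)))
          (λ Os → decSet⁺ Q? (inj₂ (Os , λ { refl → s≢e refl }))) (total Ns)
      keep : ∀ f → ⟦ O ⟧ f → f ≡ swap e ⊎ ⟦ decSet Q? ⟧ f
      keep f Of = Sum.map₂ (λ f≢ → decSet⁺ Q? (inj₂ (Of , f≢))) (toSum (f ≟ₛ swap e))

    -- Orient e as its inverse and everything else towards e, that is, so as to be below the inverse
    -- of e or strictly below e. Properness of e keeps the two kinds apart.
    tail-exists : ∀ {e} → N e → ∃[ O ] IsOri O × Maximal ⟦ O ⟧ (swap e)
    tail-exists {e} Ne = decSet Q? , ori , decSet⁺ Q? (swap-closed e Ne , inj₁ ≤ₛ-refl) ,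
        λ f Qf e≤f → [ (λ f≤e → ≤ₛ-antisym f≤e e≤f) , (λ (f≤e , _) → ⊥-elim (improper (≤ₛ-trans e≤f f≤e))) ]′ (proj₂ (decSet⁻ Q? Qf))
      where
      Q : SepSet ∣G∣
      Q f = N f × (f ≤ₛ swap e ⊎ (f ≤ₛ e × f ≢ e))
      Q? : U.Decidable Q
      Q? f = N? f ×-dec ((f ≤ₛ? swap e) ⊎-dec ((f ≤ₛ? e) ×-dec ¬? (f ≟ₛ e)))
      improper : ¬ swap e ≤ₛ e
      improper h = proj₂ (proper Ne) (proj₁ h)
      improper′ : ¬ e ≤ₛ swap e
      improper′ h = proj₁ (proper Ne) (proj₁ h)
      below : ∀ {f} → N f → f ≤ₛ e → Q f ⊎ Q (swap f)
      below {f} Nf f≤e with f ≟ₛ e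
      ... | yes refl = inj₂ (swap-closed f Nf , inj₁ ≤ₛ-refl)
      ... | no f≢e   = inj₁ (Nf , inj₂ (f≤e , f≢e))
      tot : ∀ {f} → N f → Nested f e → Q f ⊎ Q (swap f)
      tot Nf (≤n f≤e)  = below Nf f≤e
      tot Nf (≥n e≤f)  = inj₂ (swap-closed _ Nf , inj₁ (swap-anti e≤f))
      tot Nf (≤sn f≤e) = inj₁ (Nf , inj₁ f≤e)
      tot Nf (≥sn e≤f) = Sum.swap (below (swap-closed _ Nf) (swap-anti e≤f))
      con : ∀ s r → Q s → r ≤ₛ s → ¬ Q (swap r)
      con s r (_ , inj₁ s≤) r≤s (_ , inj₁ r≤) = improper′ (≤ₛ-trans (swap-anti r≤) (≤ₛ-trans r≤s s≤))
      con s r (_ , inj₁ s≤) r≤s (_ , inj₂ (r≤ , r≢)) = r≢ (≤ₛ-antisym r≤ (swap-anti (≤ₛ-trans r≤s s≤)))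
      con s r (_ , inj₂ (s≤ , s≢)) r≤s (_ , inj₁ r≤) = s≢ (≤ₛ-antisym s≤ (≤ₛ-trans (swap-anti r≤) r≤s))
      con s r (_ , inj₂ (s≤ , _)) r≤s (_ , inj₂ (r≤ , _)) = improper (≤ₛ-trans (swap-anti r≤) (≤ₛ-trans r≤s s≤))
      ori : IsOri (decSet Q?)
      ori = record
        { sub = λ Qs → proj₁ (decSet⁻ Q? Qs)
        ; total = λ Nf → Sum.map (decSet⁺ Q?) (decSet⁺ Q?) (tot Nf (nested Nf e Ne))
        ; consistent = λ s r Qs _ r≤s Qr → con s r (decSet⁻ Q? Qs) r≤s (decSet⁻ Q? Qr) }

    orientation-exists : ∃ IsOri
    orientation-exists with ∃Sep? N?
    ... | yes (e , Ne) = let O , o , _ = tail-exists Ne in O , o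
    ... | no ¬N = decSet none? , record
        { sub = λ {s} Os → ⊥-elim (decSet⁻ none? {s} Os) ; total = λ Ns → ⊥-elim (¬N (_ , Ns))
        ; consistent = λ s _ Os _ _ _ → decSet⁻ none? {s} Os }
      where
      none? : U.Decidable {A = Sep ∣G∣} (λ _ → ⊥)
      none? _ = no id

    module _ (W : Subset ∣G∣) (inseparable : ∀ s → N s → W ⊆ proj₁ s ⊎ W ⊆ proj₂ s) where

      private
        Bad : DecSepSet ∣G∣ → SepSet ∣G∣
        Bad O s = ⟦ O ⟧ s × ¬ W ⊆ proj₂ s

        bad? : ∀ O → U.Decidable (Bad O)
        bad? O s = T? (O s) ×-dec ¬? (W ⊆? proj₂ s)

        Result : DecSepSet ∣G∣ → Set
        Result O = ∃[ O* ] IsOri O* × (∀ s → ⟦ O* ⟧ s → W ⊆ proj₂ s) × (∀ s → ⟦ O ⟧ s → W ⊆ proj₂ s → ⟦ O* ⟧ s)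

        -- Whatever lies above a bad element of O is bad, so a maximal bad element is maximal in O
        -- and can be flipped.
        turn : ∀ O → IsOri O → ∀ m → Maximal (Bad O) m → ∃[ O′ ] IsOri O′ × Flip (swap m) ⟦ O ⟧ ⟦ O′ ⟧
        turn O o m ((Om , bad) , max) = flip-exists O o (Om , λ f Of m≤f → max f (Of , λ ⊆f → bad (proj₂ m≤f ∘ ⊆f)) m≤f)

        step : ∀ O O′ → IsOri O → IsOri O′ → ∀ {m} → Bad O m → Flip (swap m) ⟦ O ⟧ ⟦ O′ ⟧ →
               count (bad? O′) < count (bad? O) × (Result O′ → Result O)
        step O O′ o o′ {m} (Om , bad) F@(O′m , _ , keep) =
          count-strict (bad? O′) (bad? O) fewer {m} (Om , bad) (λ (O′m′ , _) → Ori.one-way O′ o′ O′m′ O′m) ,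
          λ (O* , o* , good , kept) → O* , o* , good , λ s Os ⊆s →
            [ (λ { refl → ⊥-elim (bad ⊆s) }) , (λ O′s → kept s O′s ⊆s) ]′ (keep s Os)
          where
          W⊆m : W ⊆ proj₁ m
          W⊆m = [ id , ⊥-elim ∘ bad ]′ (inseparable m (IsOrientation.sub o Om))
          fewer : ∀ {f} → Bad O′ f → Bad O f
          fewer {f} (O′f , badf) = [ (λ { refl → ⊥-elim (badf W⊆m) }) , id ]′ (proj₂ (proj₂ (flip-sym O O′ o o′ {swap m} F)) f O′f) , badf

        go : ∀ O → IsOri O → Acc _<_ (count (bad? O)) → Result O
        go O o (acc rec) with ∃Sep? (bad? O)
        ... | no ¬bad = O , o , (λ s Os → decidable-stable (W ⊆? proj₂ s) λ bad → ¬bad (s , Os , bad)) , λ s Os _ → Os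
        ... | yes (s , bad) =
          let m , max , _ = ∃-maximal (bad? O) s bad
              O′ , o′ , F = turn O o m max
              lt , back = step O O′ o o′ (proj₁ max) F
          in back (go O′ o′ (rec lt))

      -- Bad elements are turned round one at a time; inseparability of W makes each turned element
      -- good. The last clause allows a part containing W to be found on a prescribed side of an
      -- edge.
      orient-towards : ∀ O → IsOri O → ∃[ O* ] IsOri O* × (∀ s → ⟦ O* ⟧ s → W ⊆ proj₂ s) × (∀ s → ⟦ O ⟧ s → W ⊆ proj₂ s → ⟦ O* ⟧ s)
      orient-towards O o = go O o (<-wellFounded _)

    module OnNodes (enum : Enumeration IsOri (allDecSepSets ∣G∣)) where
      open Enumeration enum using (size; node)

      node-ori : ∀ i → IsOri (node i)
      node-ori = Enumeration.sound enum

      node-injective : ∀ {i j} → ⟦ node i ⟧ U.≐ ⟦ node j ⟧ → i ≡ j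
      node-injective = Enumeration.injective enum

      nodeOf : ∀ O → IsOri O → ∃[ i ] ⟦ node i ⟧ U.≐ ⟦ O ⟧
      nodeOf O o = let Q , Q∈ , O≐Q = ∈-allDecSepSets O
                       i , i≐Q = Enumeration.complete enum Q Q∈ (IsOri-ext O Q O≐Q o)
                   in i , ≐-trans i≐Q (≐-sym O≐Q)

      module At (i : Fin size) where
        open Ori (node i) (node-ori i) public using (one-way; never-apart)

        sub : ∀ {s} → ⟦ node i ⟧ s → N s
        sub = IsOrientation.sub (node-ori i)

        total : ∀ {s} → N s → ⟦ node i ⟧ s ⊎ ⟦ node i ⟧ (swap s)
        total = IsOrientation.total (node-ori i)

      FlipAt : Sep ∣G∣ → Fin size → Fin size → Set
      FlipAt e i j = Flip e ⟦ node i ⟧ ⟦ node j ⟧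

      FlipAt-sym : ∀ {e i j} → FlipAt e i j → FlipAt (swap e) j i
      FlipAt-sym {e} {i} {j} = flip-sym (node i) (node j) (node-ori i) (node-ori j) {e}

      FlipAt-uniqueˡ : ∀ {e i j i′ j′} → FlipAt e i j → FlipAt e i′ j′ → i ≡ i′
      FlipAt-uniqueˡ {e} {i} {j} {i′} {j′} F F′ = node-injective
        ( flip-unique (node i) (node j) (node i′) (node j′) (node-ori i) (node-ori j) (node-ori i′) (node-ori j′) F F′
        , flip-unique (node i′) (node j′) (node i) (node j) (node-ori i′) (node-ori j′) (node-ori i) (node-ori j) F′ F )

      FlipAt-uniqueʳ : ∀ {e i j i′ j′} → FlipAt e i j → FlipAt e i′ j′ → j ≡ j′
      FlipAt-uniqueʳ {e} F F′ = FlipAt-uniqueˡ {swap e} (FlipAt-sym {e} F) (FlipAt-sym {e} F′)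

      H : Graph
      H = record
        { order = size
        ; Adj = λ i j → ∃[ e ] FlipAt e i j
        ; adj? = λ i j → ∃Sep? λ e → T? (node j e) ×-dec (T? (node i (swap e)) ×-dec
                   ∀Sep? λ f → T? (node i f) →-dec ((f ≟ₛ swap e) ⊎-dec T? (node j f)))
        ; sym = λ {i} {j} (e , F) → swap e , FlipAt-sym {e} F
        ; irrefl = λ {i} (e , a , b , _) → At.one-way i {e} a b }

      flips : ∀ {x y e} → Adj H x y → ⟦ node x ⟧ e → ⟦ node y ⟧ (swap e) → FlipAt (swap e) x y
      flips {x} {y} {e} (e₁ , F@(_ , _ , keep)) xe ye with keep e xe
      ... | inj₁ refl = F
      ... | inj₂ ye′  = ⊥-elim (At.one-way y ye′ ye)

      module _ {K : SepSet ∣G∣} where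

        -- Walks are built inside the nodes that contain K. Connectivity takes K empty; to stay on
        -- one side of an edge, K is the single inverse of its label.
        Kept : Fin size → Fin size → Set
        Kept u v = Adj H u v × (∀ f → K f → ⟦ node u ⟧ f × ⟦ node v ⟧ f)

        private
          Diff : Fin size → Fin size → SepSet ∣G∣
          Diff i j s = ⟦ node j ⟧ s × ¬ ⟦ node i ⟧ s

          diff? : ∀ i j → U.Decidable (Diff i j)
          diff? i j s = T? (node j s) ×-dec ¬? (T? (node i s))

          abstract
            -- By consistency of j, an element of i above the inverse of m is one whose inverse lies
            -- in j and not in i. So a minimal difference m has its inverse maximal in i and can be
            -- flipped.
            advance : ∀ i j m → Diff i j m → (∀ r → Diff i j r → r ≤ₛ m → r ≡ m) → ∃[ i′ ] FlipAt m i i′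
            advance i j m (jm , ¬im) min =
              let O′ , o′ , F = flip-exists (node i) (node-ori i) {m} (im , max)
                  i′ , eq = nodeOf O′ o′
              in i′ , Flip-resp {m} {⟦ node i ⟧} {⟦ O′ ⟧} {⟦ node i ⟧} {⟦ node i′ ⟧} (id , id) (≐-sym eq) F
              where
              im : ⟦ node i ⟧ (swap m)
              im = [ ⊥-elim ∘ ¬im , id ]′ (At.total i (At.sub j jm))
              max : ∀ f → ⟦ node i ⟧ f → swap m ≤ₛ f → f ≡ swap m
              max f if m≤f = cong swap (min (swap f)
                ( [ (λ jf → ⊥-elim (At.never-apart j jm jf (swap-anti m≤f))) , id ]′ (At.total j (At.sub i if))
                , At.one-way i if) (swap-anti m≤f))

          closer : ∀ i j m i′ → Diff i j m → FlipAt m i i′ → count (diff? i′ j) < count (diff? i j)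
          closer i j m i′ (jm , ¬im) (i′m , im , keep) = count-strict (diff? i′ j) (diff? i j)
            (λ {f} (jf , ¬i′f) → jf , λ if → [ (λ { refl → At.one-way j jm jf }) , ¬i′f ]′ (keep f if))
            {m} (jm , ¬im) (λ (_ , ¬i′m) → ¬i′m i′m)

          arrived : ∀ i j → ¬ ∃ (Diff i j) → i ≡ j
          arrived i j ¬d = node-injective (⊇ , ⊆′)
            where
            ⊆′ : ∀ {s} → ⟦ node j ⟧ s → ⟦ node i ⟧ s
            ⊆′ {s} js = decidable-stable (T? (node i s)) λ ¬is → ¬d (s , js , ¬is)
            ⊇ : ∀ {s} → ⟦ node i ⟧ s → ⟦ node j ⟧ s
            ⊇ {s} is = [ id , (λ js → ⊥-elim (At.one-way i is (⊆′ js))) ]′ (At.total j (At.sub i is))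

          next : ∀ i j → (∀ f → K f → ⟦ node i ⟧ f) → (∀ f → K f → ⟦ node j ⟧ f) → ∃ (Diff i j) →
                 ∃[ i′ ] Kept i i′ × (∀ f → K f → ⟦ node i′ ⟧ f) × count (diff? i′ j) < count (diff? i j)
          next i j Ki Kj (s , d) =
            let m , dm , min , _ = ∃-minimal (diff? i j) s d
                i′ , F = advance i j m dm min
                Ki′ : ∀ f → K f → ⟦ node i′ ⟧ f
                Ki′ f Kf = [ (λ eq → ⊥-elim (At.one-way j (proj₁ dm) (subst ⟦ node j ⟧ eq (Kj f Kf)))) , id ]′ (proj₂ (proj₂ F) f (Ki f Kf))
            in i′ , ((m , F) , λ f Kf → Ki f Kf , Ki′ f Kf) , Ki′ , closer i j m i′ dm F

          go : ∀ i j → (∀ f → K f → ⟦ node i ⟧ f) → (∀ f → K f → ⟦ node j ⟧ f) → Acc _<_ (count (diff? i j)) → Star Kept i j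
          go i j Ki Kj (acc rec) with ∃Sep? (diff? i j)
          ... | no ¬d = subst (Star Kept i) (arrived i j ¬d) ε
          ... | yes d with next i j Ki Kj d
          ...   | i′ , kept , Ki′ , lt = kept ◅ go i′ j Ki′ Kj (rec lt)

        geodesic : ∀ i j → (∀ f → K f → ⟦ node i ⟧ f) → (∀ f → K f → ⟦ node j ⟧ f) → Star Kept i j
        geodesic i j Ki Kj = go i j Ki Kj (<-wellFounded _)

      -- A discrete intermediate value argument. As a label belongs to one edge only, it locates
      -- that edge on the walk.
      walk-flips : ∀ {x y e} (w : Walk H x y) → ⟦ node x ⟧ e → ⟦ node y ⟧ (swap e) →
                   ∃₂ λ a b → a ∈ₗ vertices H w × b ∈ₗ vertices H w × FlipAt (swap e) a b
      walk-flips {x} ε xe ye = ⊥-elim (At.one-way x xe ye)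
      walk-flips {x} {y} {e} (_◅_ {j = z} xz w) xe ye with At.total z (At.sub x xe)
      ... | inj₁ ze = let a , b , a∈ , b∈ , F = walk-flips {e = e} w ze ye in a , b , there a∈ , there b∈ , F
      ... | inj₂ ze = x , z , here refl , there (start∈vertices w) , flips {e = e} xz xe ze

      -- A path that left the side of e would have to return over the only edge with that label, and
      -- so visit one of its ends twice.
      path-keeps : ∀ {x y e} (w : Walk H x y) → IsPath H w → ⟦ node x ⟧ e → ⟦ node y ⟧ e → ∀ t → t ∈ₗ vertices H w → ⟦ node t ⟧ e
      path-keeps ε _ xe _ t (here refl) = xe
      path-keeps (_ ◅ _) _ xe _ t (here refl) = xe
      path-keeps {x} {y} {e} (_◅_ {j = z} xz w) (x∉ ∷ path) xe ye t (there t∈) with At.total z (At.sub x xe)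
      ... | inj₁ ze = path-keeps w path ze ye t t∈
      ... | inj₂ ze =
        let a , b , _ , b∈ , F = walk-flips {e = swap e} w ze ye
            b≡x = FlipAt-uniqueʳ {e} {a} {b} F (FlipAt-sym {swap e} {x} {z} (flips {e = e} xz xe ze))
        in ⊥-elim (All.lookup x∉ b∈ (sym b≡x))

      -- The path must change its orientation of the label of the closing edge, hence use that edge.
      -- Later than its first step this revisits u; at its first step the path is already at v.
      H-acyclic : ∀ {u v} (w : Walk H u v) → IsPath H w → 3 ≤ length (vertices H w) → ¬ Adj H v u
      H-acyclic ε _ (s≤s ())
      H-acyclic {u} {v} (_◅_ {j = z} uz w) (u∉ ∷ path) 3≤ (e , F@(ue , ve , _)) with At.total z (At.sub u ue)
      ... | inj₁ ze = let a , b , a∈ , _ , F′ = walk-flips {e = e} w ze ve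
                      in All.lookup u∉ a∈ (FlipAt-uniqueˡ {swap e} (FlipAt-sym {e} F) F′)
      ... | inj₂ ze with refl ← FlipAt-uniqueʳ {swap e} (flips {e = e} uz ue ze) (FlipAt-sym {e} F) = closed w path 3≤
        where
        closed : (w : Walk H z z) → IsPath H w → ¬ 3 ≤ suc (length (vertices H w))
        closed ε _ (s≤s (s≤s ()))
        closed (_ ◅ w) (z∉ ∷ _) _ = All.lookup z∉ (end∈vertices w) refl

      root : Fin size
      root = proj₁ (nodeOf (proj₁ orientation-exists) (proj₂ orientation-exists))

      ∃-node-containing : ∀ W → (∀ s → N s → W ⊆ proj₁ s ⊎ W ⊆ proj₂ s) → ∀ i →
                          ∃[ t ] W ⊆ partOf (node t) × (∀ s → ⟦ node i ⟧ s → W ⊆ proj₂ s → ⟦ node t ⟧ s)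
      ∃-node-containing W insep i =
        let O , o , good , kept = orient-towards W insep (node i) (node-ori i)
            t , t≐O = nodeOf O o
        in t , (λ w∈ → ∈-partOf⁺ (node t) λ s ts → good s (proj₁ t≐O ts) w∈) , λ s is ⊆s → proj₂ t≐O (kept s is ⊆s)

      singleton⊆ : ∀ {v} {A : Subset ∣G∣} → v ∈ A → ⁅ v ⁆ ⊆ A
      singleton⊆ {v} {A} v∈ w∈ = subst (_∈ A) (sym (x∈⁅y⁆⇒x≡y v w∈)) v∈

      singleton-inseparable : ∀ v s → N s → ⁅ v ⁆ ⊆ proj₁ s ⊎ ⁅ v ⁆ ⊆ proj₂ s
      singleton-inseparable v s Ns = Sum.map singleton⊆ singleton⊆ (sep-cover G s (separation Ns) v)

      𝒯 : TreeDecomposition G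
      𝒯 = record
        { tree = H
        ; isTree = record
          { nonempty = nonempty root
          ; connected = λ u v → Star.map proj₁ (geodesic {K = λ _ → ⊥} u v (λ _ ()) (λ _ ()))
          ; acyclic = H-acyclic }
        ; part = λ t → partOf (node t)
        ; coverVertex = λ v → let t , ⊆t , _ = ∃-node-containing ⁅ v ⁆ (singleton-inseparable v) root in t , ⊆t (x∈⁅x⁆ v)
        ; coverEdge = λ u v uv →
            let t , ⊆t , _ = ∃-node-containing (⁅ u ⁆ ∪ ⁅ v ⁆)
                  (λ s Ns → Sum.map (λ (a , b) → pair⊆ a b) (λ (a , b) → pair⊆ a b) (sep-edge G s (separation Ns) u v uv)) root
            in t , ⊆t (x∈p∪q⁺ (inj₁ (x∈⁅x⁆ u))) , ⊆t (x∈p∪q⁺ (inj₂ (x∈⁅x⁆ v)))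
        ; onPath = onPath }
        where
        nonempty : ∀ {m} → Fin m → 0 < m
        nonempty zero    = s≤s z≤n
        nonempty (suc _) = s≤s z≤n
        pair⊆ : ∀ {u v} {A : Subset ∣G∣} → u ∈ A → v ∈ A → ⁅ u ⁆ ∪ ⁅ v ⁆ ⊆ A
        pair⊆ {u} {v} u∈ v∈ w∈ = [ singleton⊆ u∈ , singleton⊆ v∈ ]′ (x∈p∪q⁻ ⁅ u ⁆ ⁅ v ⁆ w∈)
        onPath : ∀ {t₁ t₃} (w : Walk H t₁ t₃) → IsPath H w → ∀ t₂ → t₂ ∈ₗ vertices H w →
                 partOf (node t₁) ∩ partOf (node t₃) ⊆ partOf (node t₂)
        onPath {t₁} {t₃} w path t₂ t₂∈ {v} v∈ = ∈-partOf⁺ (node t₂) at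
          where
          v∈₁ = ∈-partOf⁻ (node t₁) (proj₁ (x∈p∩q⁻ (partOf (node t₁)) (partOf (node t₃)) v∈))
          v∈₃ = ∈-partOf⁻ (node t₃) (proj₂ (x∈p∩q⁻ (partOf (node t₁)) (partOf (node t₃)) v∈))
          at : ∀ s → ⟦ node t₂ ⟧ s → v ∈ proj₂ s
          at s s∈₂ with At.total t₁ (At.sub t₂ s∈₂) | At.total t₃ (At.sub t₂ s∈₂)
          ... | inj₁ s∈₁ | _        = v∈₁ s s∈₁
          ... | inj₂ _   | inj₁ s∈₃ = v∈₃ s s∈₃
          ... | inj₂ ¬₁  | inj₂ ¬₃  = ⊥-elim (At.one-way t₂ s∈₂ (path-keeps w path ¬₁ ¬₃ t₂ t₂∈))

      open TreeDecomposition 𝒯 using (AdjWithout; Induces)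

      AdjWithout-keeps : ∀ {e t₁ t₂} → FlipAt e t₁ t₂ → ∀ {u v} → AdjWithout t₁ t₂ u v → ⟦ node u ⟧ (swap e) → ⟦ node v ⟧ (swap e)
      AdjWithout-keeps {e} {t₁} {t₂} F {u} {v} (uv , without) ue with At.total v (At.sub u ue)
      ... | inj₁ ve = ve
      ... | inj₂ ve = let F′ = flips {u} {v} {swap e} uv ue ve in
        ⊥-elim (without (inj₁ (FlipAt-uniqueˡ {e} F′ F , FlipAt-uniqueʳ {e} F′ F)))

      -- A vertex on the first side is in the part of an orientation that still contains the inverse
      -- of e, and a walk through such nodes avoids the edge. Conversely, only that edge changes the
      -- orientation of e, so every node reached has its part inside the first side.
      side : ∀ {e t₁ t₂} → FlipAt e t₁ t₂ → ∀ v → v ∈ proj₁ e ⇔ (∃[ t ] Star (AdjWithout t₁ t₂) t₁ t × v ∈ partOf (node t))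
      side {e} {t₁} {t₂} F@(t₂e , t₁e , _) v = mk⇔ to from
        where
        to : v ∈ proj₁ e → ∃[ t ] Star (AdjWithout t₁ t₂) t₁ t × v ∈ partOf (node t)
        to v∈ =
          let t , ⊆t , kept = ∃-node-containing ⁅ v ⁆ (singleton-inseparable v) t₁
              te = kept (swap e) t₁e (singleton⊆ v∈)
          in t , Star.map avoid (geodesic {K = U.｛ swap e ｝} t₁ t (λ { _ refl → t₁e }) (λ { _ refl → te })) , ⊆t (x∈⁅x⁆ v)
          where
          avoid : ∀ {x y} → Kept {K = U.｛ swap e ｝} x y → AdjWithout t₁ t₂ x y
          avoid (xy , keeps) = xy ,
            [ (λ { (_ , refl) → At.one-way t₂ t₂e (proj₂ (keeps _ refl)) })
            , (λ { (refl , _) → At.one-way t₂ t₂e (proj₁ (keeps _ refl)) }) ]′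
        reach : ∀ {x t} → Star (AdjWithout t₁ t₂) x t → ⟦ node x ⟧ (swap e) → ⟦ node t ⟧ (swap e)
        reach ε xe = xe
        reach (xy ◅ w) xe = reach w (AdjWithout-keeps {e} F xy xe)
        from : (∃[ t ] Star (AdjWithout t₁ t₂) t₁ t × v ∈ partOf (node t)) → v ∈ proj₁ e
        from (t , w , v∈) = ∈-partOf⁻ (node t) v∈ (swap e) (reach w t₁e)

      flip-induces : ∀ {e t₁ t₂} → FlipAt e t₁ t₂ → Induces t₁ t₂ e
      flip-induces {e} {t₁} {t₂} F = side {e} F , λ v → mk⇔
        (λ v∈ → let t , w , v∈t = Equivalence.to (back v) v∈ in t , Star.map reverse w , v∈t)
        (λ (t , w , v∈t) → Equivalence.from (back v) (t , Star.map reverse w , v∈t))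
        where
        back : ∀ v → v ∈ proj₂ e ⇔ (∃[ t ] Star (AdjWithout t₂ t₁) t₂ t × v ∈ partOf (node t))
        back = side {swap e} (FlipAt-sym {e} F)
        reverse : ∀ {a b x y} → AdjWithout a b x y → AdjWithout b a x y
        reverse (xy , without) = xy , without ∘ Sum.swap

      𝒯-induces : (∀ O O′ → IsOri O → IsOri O′ → partOf O ≡ partOf O′ → ⟦ O ⟧ U.≐ ⟦ O′ ⟧) → InducesExactly 𝒯 N
      𝒯-induces distinct = record
        { induced≐ = (λ (t₁ , t₂ , (e , F) , ind) → subst N (Induces-unique 𝒯 (flip-induces {e} F) ind) (At.sub t₂ {e} (proj₁ F))) , induced⊇
        ; distinctParts = λ {t} {u} eq → node-injective (distinct (node t) (node u) (node-ori t) (node-ori u) eq)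
        ; distinctSeps = λ { (e , F) (e′ , F′) ind ind′ →
            let e≡s = Induces-unique 𝒯 (flip-induces {e} F) ind
                e′≡s = Induces-unique 𝒯 (flip-induces {e′} F′) ind′
                F″ = subst (λ x → FlipAt x _ _) (trans e′≡s (sym e≡s)) F′
            in FlipAt-uniqueˡ {e} F F″ , FlipAt-uniqueʳ {e} F F″ } }
        where
        induced⊇ : ∀ {e} → N e → induced 𝒯 e
        induced⊇ {e} Ne =
          let O , o , max = tail-exists Ne
              O′ , o′ , F = flip-exists O o {e} max
              i , i≐ = nodeOf O o
              j , j≐ = nodeOf O′ o′
              F′ = Flip-resp {e} {⟦ O ⟧} {⟦ O′ ⟧} {⟦ node i ⟧} {⟦ node j ⟧} (≐-sym i≐) (≐-sym j≐) F
          in i , j , (e , F′) , flip-induces {e} F′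

      𝒯-adhesion : ∀ {k} → 0 < k → (∀ {s} → N s → sepOrder s < k) → adhesion 𝒯 < k
      -- Positivity of k bounds the default value 0 of the maximum, which is the adhesion of a tree
      -- without edges.
      𝒯-adhesion {k} 0<k N-order = max<v⁺ {xs = map (λ (t , t′) → ∣ partOf (node t) ∩ partOf (node t′) ∣) edges} 0<k
        (All.map⁺ (All.tabulate λ {(t , t′)} tt′∈ → bound (proj₂ (∈-filter⁻ edge? {xs = pairs} tt′∈))))
        where
        pairs = cartesianProduct (allFin size) (allFin size)
        edge? : U.Decidable (λ ((t , t′) : Fin size × Fin size) → Adj H t t′)
        edge? (t , t′) = adj? H t t′
        edges = filter edge? pairs
        bound : ∀ {t t′} → Adj H t t′ → ∣ partOf (node t) ∩ partOf (node t′) ∣ < k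
        bound {t} {t′} (e , t′e , te , _) = ℕ.≤-<-trans (p⊆q⇒∣p∣≤∣q∣ λ v∈ →
            let a , b = x∈p∩q⁻ (partOf (node t)) (partOf (node t′)) v∈ in
            x∈p∩q⁺ (∈-partOf⁻ (node t) a (swap e) te , ∈-partOf⁻ (node t′) b e t′e)) (N-order (At.sub t′ {e} t′e))

-- Uniqueness of the tree-decomposition

module _ (H : Graph) where

  Without : (t₁ t₂ : Vertex H) → Vertex H → Vertex H → Set
  Without t₁ t₂ u v = Adj H u v × ¬ ((u ≡ t₁ × v ≡ t₂) ⊎ (u ≡ t₂ × v ≡ t₁))

  Side : (t₁ t₂ : Vertex H) → Vertex H → Vertex H → Set
  Side t₁ t₂ = Star (Without t₁ t₂)

-- The two sides of an edge of a tree

module TreeFacts {H : Graph} (isTree : IsTree H) where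

  open IsTree isTree

  private
    _≟_ = Fin._≟_ {∣V∣ H}

  Without-sym : ∀ {a b u v} → Without H a b u v → Without H a b v u
  Without-sym (uv , w) = Graph.sym H uv , λ { (inj₁ (p , q)) → w (inj₂ (q , p)) ; (inj₂ (p , q)) → w (inj₁ (q , p)) }

  reverse-edge : ∀ {a b u v} → Side H a b u v → Side H b a u v
  reverse-edge = Star.map λ (uv , w) → uv , w ∘ Sum.swap

  walk : ∀ {a b u v} → Side H a b u v → Walk H u v
  walk = Star.map proj₁

  module _ {R : Vertex H → Vertex H → Set} (R⊆ : ∀ {u v} → R u v → Adj H u v) where

    prefix : ∀ {u v} (w : Star R u v) → ∀ {a} → a ∈ₗ vertices H (Star.map R⊆ w) → Star R u a
    prefix ε (here refl) = ε
    prefix (r ◅ w) (here refl) = ε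
    prefix (r ◅ w) (there a∈)  = r ◅ prefix w a∈

    suffix : ∀ {u v} (w : Star R u v) → IsPath H (Star.map R⊆ w) → ∀ {a} → a ∈ₗ vertices H (Star.map R⊆ w) →
             ∃[ w′ ] IsPath H (Star.map R⊆ {a} {v} w′)
    suffix ε path (here refl) = ε , path
    suffix (r ◅ w) path (here refl) = r ◅ w , path
    suffix (r ◅ w) (_ ∷ path) (there a∈) = suffix w path a∈

    -- Stated for any R inside adjacency, so that a walk avoiding an edge becomes a path avoiding
    -- the same edge.
    loop-erased : ∀ {u v} → Star R u v → ∃[ w ] IsPath H (Star.map R⊆ {u} {v} w)
    loop-erased ε = ε , [] ∷ []
    loop-erased {u} (r ◅ w) with loop-erased w
    ... | w′ , path with mem? _≟_ u (vertices H (Star.map R⊆ w′))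
    ...   | yes u∈ = suffix w′ path u∈
    ...   | no u∉  = r ◅ w′ , All.¬Any⇒All¬ _ u∉ ∷ path

  path : ∀ u v → ∃[ w ] IsPath H {u} {v} w
  path u v = let w , p = loop-erased id (connected u v) in Star.map id w , p

  some-side : ∀ t₁ t₂ t → Side H t₁ t₂ t₁ t ⊎ Side H t₁ t₂ t₂ t
  some-side t₁ t₂ t = go (connected t t₁)
    where
    go : ∀ {x} → Walk H x t₁ → Side H t₁ t₂ t₁ x ⊎ Side H t₁ t₂ t₂ x
    go ε = inj₁ ε
    go {x} (_◅_ {j = y} xy w) with x ≟ t₁ | x ≟ t₂
    ... | yes refl | _ = inj₁ ε
    ... | _ | yes refl = inj₂ ε
    ... | no x≢t₁ | no x≢t₂ = Sum.map (_◅◅ (yx ◅ ε)) (_◅◅ (yx ◅ ε)) (go w)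
      where
      yx : Without H t₁ t₂ y x
      yx = Graph.sym H xy , [ x≢t₂ ∘ proj₂ , x≢t₁ ∘ proj₂ ]′

  -- Otherwise a path from t₁ to t₂ that avoids the edge would close up to a cycle with it.
  only-one-side : ∀ {t₁ t₂ t} → Adj H t₁ t₂ → Side H t₁ t₂ t₁ t → ¬ Side H t₁ t₂ t₂ t
  only-one-side {t₁} {t₂} t₁t₂ w₁ w₂ = 
    let w , p = loop-erased proj₁ (w₁ ◅◅ Star.reverse Without-sym w₂) in no-path w p
    where
    no-path : (w : Side H t₁ t₂ t₁ t₂) → ¬ IsPath H (walk w)
    no-path ε _ = Graph.irrefl H t₁t₂
    no-path ((_ , without) ◅ ε) _ = without (inj₁ (refl , refl))
    no-path w@(_ ◅ r ◅ w′) p = acyclic (walk w) p (s≤s (s≤s (nonempty-vertices (walk w′)))) (Graph.sym H t₁t₂)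
      where
      nonempty-vertices : ∀ {u v} (w : Walk H u v) → 1 ≤ length (vertices H w)
      nonempty-vertices ε = s≤s z≤n
      nonempty-vertices (_ ◅ _) = s≤s z≤n

  side? : ∀ {t₁ t₂} → Adj H t₁ t₂ → ∀ t → Dec (Side H t₁ t₂ t₁ t)
  side? {t₁} {t₂} t₁t₂ t with some-side t₁ t₂ t
  ... | inj₁ w = yes w
  ... | inj₂ w = no λ w′ → only-one-side t₁t₂ w′ w

  leaving : ∀ {x y z t} (w : Walk H z t) → All (x ≢_) (vertices H w) → Side H x y z t
  leaving ε _ = ε
  leaving (zz′ ◅ w) (x≢z ∷ x∉) =
    (zz′ , [ (λ (z≡x , _) → x≢z (sym z≡x)) , (λ (_ , z′≡x) → All.lookup x∉ (start∈vertices w) (sym z′≡x)) ]′) ◅ leaving w x∉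

  -- A walk on the side of b₁ never traverses the edge between a₁ and a₂, whose ends lie on the
  -- other side, so it stays on the side of a₂ where it starts.
  far-side : ∀ {a₁ a₂ b₁ b₂} → Adj H b₁ b₂ → Side H b₁ b₂ b₂ a₁ → Side H b₁ b₂ b₂ a₂ → Side H a₁ a₂ a₂ b₁ →
             ∀ {x} → Side H b₁ b₂ b₁ x → Side H a₁ a₂ a₂ x
  far-side {a₁} {a₂} {b₁} {b₂} b₁b₂ b₂a₁ b₂a₂ a₂b₁ = go ε a₂b₁
    where
    go : ∀ {x y} → Side H b₁ b₂ b₁ y → Side H a₁ a₂ a₂ y → Side H b₁ b₂ y x → Side H a₁ a₂ a₂ x
    go b₁y a₂y ε = a₂y
    go b₁y a₂y (step@(yz , _) ◅ w) = go (b₁y ◅◅ (step ◅ ε)) (a₂y ◅◅ ((yz ,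
      [ (λ { (refl , _) → only-one-side b₁b₂ b₁y b₂a₁ }) , (λ { (refl , _) → only-one-side b₁b₂ b₁y b₂a₂ }) ]′) ◅ ε)) w

-- Comparison of an arbitrary decomposition with the tree of orientations

module Uniqueness (G : Graph) where

  open Tasks G
  open Trees G

  private
    ∣G∣ = ∣V∣ G

  module _ (𝒯′ : TreeDecomposition G) where

    private
      module 𝒯′ = TreeDecomposition 𝒯′
      H′ = 𝒯′.tree
    open TreeFacts 𝒯′.isTree

    Induces-swap : ∀ {t₁ t₂ s} → 𝒯′.Induces t₁ t₂ s → 𝒯′.Induces t₂ t₁ (swap s)
    Induces-swap (f , g) = (λ v → flip-side (g v)) , (λ v → flip-side (f v))
      where
      flip-side : ∀ {a b c v} {p : Subset ∣G∣} → v ∈ p ⇔ (∃[ t ] Side H′ a b c t × v ∈ 𝒯′.part t) →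
                  v ∈ p ⇔ (∃[ t ] Side H′ b a c t × v ∈ 𝒯′.part t)
      flip-side e = mk⇔ (λ v∈ → let t , w , v∈t = Equivalence.to e v∈ in t , reverse-edge w , v∈t)
                        (λ (t , w , v∈t) → Equivalence.from e (t , reverse-edge w , v∈t))

    edge-induces : ∀ {t₁ t₂} → Adj H′ t₁ t₂ → ∃[ s ] 𝒯′.Induces t₁ t₂ s
    edge-induces {t₁} {t₂} t₁t₂ = (subsetOf (A? t₁t₂) , subsetOf (A? t₂t₁)) ,
        (λ v → mk⇔ (∈-subsetOf⁻ (A? t₁t₂)) (∈-subsetOf⁺ (A? t₁t₂))) ,
        (λ v → mk⇔ (λ v∈ → let t , w , v∈t = ∈-subsetOf⁻ (A? t₂t₁) v∈ in t , reverse-edge w , v∈t)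
                   (λ (t , w , v∈t) → ∈-subsetOf⁺ (A? t₂t₁) (t , reverse-edge w , v∈t)))
      where
      t₂t₁ = Graph.sym H′ t₁t₂
      A? : ∀ {a b} → Adj H′ a b → ∀ v → Dec (∃[ t ] Side H′ a b a t × v ∈ 𝒯′.part t)
      A? ab v = Fin.any? λ t → side? ab t ×-dec (v ∈? 𝒯′.part t)

    module _ {N : SepSet ∣G∣} (sys : NestedSystem N) (exact : InducesExactly 𝒯′ N) where
      open NestedSystem sys
      open FromSystem sys using (IsOri)
      open InducesExactly exact

      Towards : 𝒯′.Node → SepSet ∣G∣
      Towards t s = ∃₂ λ t₁ t₂ → Adj H′ t₁ t₂ × 𝒯′.Induces t₁ t₂ s × Side H′ t₁ t₂ t₂ t

      Towards-sub : ∀ {t s} → Towards t s → N s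
      Towards-sub (t₁ , t₂ , t₁t₂ , ind , _) = proj₁ induced≐ (t₁ , t₂ , t₁t₂ , ind)

      Towards-total : ∀ t {s} → N s → Towards t s ⊎ Towards t (swap s)
      Towards-total t {s} Ns with proj₂ induced≐ Ns
      ... | t₁ , t₂ , t₁t₂ , ind with some-side t₁ t₂ t
      ...   | inj₂ w = inj₁ (t₁ , t₂ , t₁t₂ , ind , w)
      ...   | inj₁ w = inj₂ (t₂ , t₁ , Graph.sym H′ t₁t₂ , Induces-swap {t₁} {t₂} ind , reverse-edge w)

      private
        -- Each edge lies on the head side of the other, so by `far-side` the nodes behind one are
        -- ahead of the other, and the induced separations point towards each other.
        apart : ∀ {a₁ a₂ b₁ b₂ s r} → Adj H′ a₁ a₂ → Adj H′ b₁ b₂ → 𝒯′.Induces a₁ a₂ s → 𝒯′.Induces b₁ b₂ r →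
                Side H′ b₁ b₂ b₂ a₁ → Side H′ b₁ b₂ b₂ a₂ → Side H′ a₁ a₂ a₂ b₁ → Side H′ a₁ a₂ a₂ b₂ → s ≤ₛ swap r
        apart ab bb (A , B) (C , D) b₂a₁ b₂a₂ a₂b₁ a₂b₂ =
          (λ {v} v∈ → let t , w , v∈t = Equivalence.to (A v) v∈ in Equivalence.from (D v) (t , far-side ab a₂b₁ a₂b₂ b₂a₁ w , v∈t)) ,
          (λ {v} v∈ → let t , w , v∈t = Equivalence.to (C v) v∈ in Equivalence.from (B v) (t , far-side bb b₂a₁ b₂a₂ a₂b₁ w , v∈t))

      Towards-never-apart : ∀ {t s r} → Towards t s → Towards t r → ¬ swap r ≤ₛ s
      Towards-never-apart {t} {s} {r} Ts@(a₁ , a₂ , aa , ind , a₂t) Tr@(b₁ , b₂ , bb , jnd , b₂t) r≤s =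
          cases ((b₁ Fin.≟ a₁) ×-dec (b₂ Fin.≟ a₂)) ((b₁ Fin.≟ a₂) ×-dec (b₂ Fin.≟ a₁))
        where
        a₂a = Graph.sym H′ aa
        b₂b = Graph.sym H′ bb
        cases : Dec (b₁ ≡ a₁ × b₂ ≡ a₂) → Dec (b₁ ≡ a₂ × b₂ ≡ a₁) → ⊥
        cases (yes (refl , refl)) _ with refl ← Induces-unique 𝒯′ {b₁} {b₂} ind jnd = proj₂ (proper (Towards-sub Ts)) (proj₁ r≤s)
        cases (no _) (yes (refl , refl)) = only-one-side aa (reverse-edge b₂t) a₂t
        cases (no same) (no opposite) = positions (some-side b₁ b₂ a₁) (some-side a₁ a₂ b₁)
          where
          b-step : Without H′ a₁ a₂ b₁ b₂
          b-step = bb , [ same , opposite ]′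
          a-step : Without H′ b₁ b₂ a₁ a₂
          a-step = aa , [ (λ (p , q) → same (sym p , sym q)) , (λ (p , q) → opposite (sym q , sym p)) ]′
          positions : Side H′ b₁ b₂ b₁ a₁ ⊎ Side H′ b₁ b₂ b₂ a₁ → Side H′ a₁ a₂ a₁ b₁ ⊎ Side H′ a₁ a₂ a₂ b₁ → ⊥
          positions (inj₂ ba) (inj₂ ab) =
            -- Edges facing each other are the one position that properness and the location of t do
            -- not exclude. Here two different oriented edges would induce the same separation,
            -- against `distinctSeps`.
            let s≡ = ≤ₛ-antisym (apart aa bb ind jnd ba (ba ◅◅ (a-step ◅ ε)) ab (ab ◅◅ (b-step ◅ ε))) r≤s
                p , q = distinctSeps aa b₂b ind (subst (𝒯′.Induces b₂ b₁) (sym s≡) (Induces-swap {b₁} {b₂} jnd))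
            in opposite (sym q , sym p)
          positions (inj₁ ba) (inj₂ ab) =
            let s≤r = apart aa b₂b ind (Induces-swap {b₁} {b₂} jnd) (reverse-edge ba) (reverse-edge (ba ◅◅ (a-step ◅ ε))) (ab ◅◅ (b-step ◅ ε)) ab
            in proj₂ (proper (Towards-sub Tr)) (proj₁ (≤ₛ-trans r≤s s≤r))
          positions (inj₂ ba) (inj₁ ab) =
            let s≥r = apart a₂a bb (Induces-swap {a₁} {a₂} ind) jnd (ba ◅◅ (a-step ◅ ε)) ba (reverse-edge ab) (reverse-edge (ab ◅◅ (b-step ◅ ε)))
            in proj₂ (proper (Towards-sub Ts)) (λ b → proj₁ (swap-anti s≥r) (proj₂ r≤s b))
          positions (inj₁ ba) (inj₁ ab) = only-one-side aa
            (reverse-edge (far-side b₂b (reverse-edge (ba ◅◅ (a-step ◅ ε))) (reverse-edge ba) (reverse-edge (ab ◅◅ (b-step ◅ ε))) (reverse-edge b₂t))) a₂t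

      Towards? : ∀ t → U.Decidable (Towards t)
      Towards? t s with N? s
      ... | no ¬Ns = no (¬Ns ∘ Towards-sub)
      ... | yes Ns = [ yes , (λ Ts′ → no λ Ts → Towards-never-apart Ts Ts′ ≤ₛ-refl) ]′ (Towards-total t Ns)

      Towards-ori : ∀ t → IsOri (decSet (Towards? t))
      Towards-ori t = record
        { sub = Towards-sub ∘ decSet⁻ (Towards? t)
        ; total = Sum.map (decSet⁺ (Towards? t)) (decSet⁺ (Towards? t)) ∘ Towards-total t
        ; consistent = λ s r Ts _ r≤s Tr → Towards-never-apart (decSet⁻ (Towards? t) Ts) (decSet⁻ (Towards? t) Tr) r≤s }

      Towards-flip : ∀ {t u s} → Adj H′ t u → 𝒯′.Induces t u s → Flip s (Towards t) (Towards u)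
      Towards-flip {t} {u} {s} tu ind = (t , u , tu , ind , ε) , (u , t , Graph.sym H′ tu , Induces-swap {t} {u} ind , ε) , keep
        where
        keep : ∀ f → Towards t f → f ≡ swap s ⊎ Towards u f
        keep f (c₁ , c₂ , cc , jnd , c₂t) with (t Fin.≟ c₁) ×-dec (u Fin.≟ c₂) | (t Fin.≟ c₂) ×-dec (u Fin.≟ c₁)
        ... | yes (refl , refl) | _ = ⊥-elim (only-one-side tu ε c₂t)
        ... | _ | yes (refl , refl) = inj₁ (Induces-unique 𝒯′ {u} {t} jnd (Induces-swap {t} {u} ind))
        ... | no ¬p | no ¬q = inj₂ (c₁ , c₂ , cc , jnd , c₂t ◅◅ ((tu , [ ¬p , ¬q ]′) ◅ ε))

      part⇒ : ∀ {t v} → v ∈ 𝒯′.part t → ∀ s → Towards t s → v ∈ proj₂ s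
      part⇒ {t} {v} v∈ s (_ , _ , _ , (_ , B) , w) = Equivalence.from (B v) (t , w , v∈)

      -- Carry v along a path from a part that contains it. Across each edge, v lies in some part on
      -- the side of t, so it lies in the part at the head of the edge, which is on the path to that
      -- part.
      part⇐ : ∀ {t v} → (∀ s → Towards t s → v ∈ proj₂ s) → v ∈ 𝒯′.part t
      part⇐ {t} {v} inside with 𝒯′.coverVertex v
      ... | t₀ , v∈t₀ with path t₀ t
      ...   | w , p = go w p v∈t₀
        where
        next : ∀ {x y} → Adj H′ x y → Side H′ x y y t → v ∈ 𝒯′.part x → v ∈ 𝒯′.part y
        next {x} {y} xy yt v∈x with edge-induces xy
        ... | s , ind@(_ , B) with Equivalence.to (B v) (inside s (x , y , xy , ind , yt))
        ...   | z , yz , v∈z with loop-erased proj₁ yz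
        ...     | w , p = 𝒯′.onPath (xy ◅ walk w) (All.¬Any⇒All¬ _ (λ x∈ → only-one-side xy ε (prefix proj₁ w x∈)) ∷ p) y
                    (there (start∈vertices (walk w))) (x∈p∩q⁺ (v∈x , v∈z))
        go : ∀ {x} (w : Walk H′ x t) → IsPath H′ w → v ∈ 𝒯′.part x → v ∈ 𝒯′.part t
        go ε _ v∈ = v∈
        go (xy ◅ w) (x∉ ∷ p) v∈ = go w p (next xy (leaving w x∉) v∈)

      module _ (enum : Enumeration IsOri (allDecSepSets ∣G∣)) where

        open FromSystem sys
        open OnNodes enum
        open Enumeration enum using (size; node)

        private
          abstract
            image : ∀ t → ∃[ i ] ⟦ node i ⟧ U.≐ Towards t
            image t = let i , eq = nodeOf (decSet (Towards? t)) (Towards-ori t) in i , ≐-trans eq (decSet-≐ (Towards? t))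

          θ : 𝒯′.Node → Fin size
          θ = proj₁ ∘ image

          θ-≐ : ∀ t → ⟦ node (θ t) ⟧ U.≐ Towards t
          θ-≐ = proj₂ ∘ image

          θ-part : ∀ t v → v ∈ 𝒯′.part t ⇔ v ∈ partOf (node (θ t))
          θ-part t v = mk⇔ (λ v∈ → ∈-partOf⁺ (node (θ t)) λ s s∈ → part⇒ v∈ s (proj₁ (θ-≐ t) s∈))
                           (λ v∈ → part⇐ λ s s∈ → ∈-partOf⁻ (node (θ t)) v∈ s (proj₂ (θ-≐ t) s∈))

          θ-injective : ∀ {t u} → θ t ≡ θ u → t ≡ u
          θ-injective {t} {u} eq = distinctParts (⊆-antisym (⊆′ eq) (⊆′ (sym eq)))
            where
            ⊆′ : ∀ {t u} → θ t ≡ θ u → 𝒯′.part t ⊆ 𝒯′.part u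
            ⊆′ {t} {u} eq {v} v∈ = Equivalence.from (θ-part u v) (subst (λ i → v ∈ partOf (node i)) eq (Equivalence.to (θ-part t v) v∈))

          θ-flip : ∀ {t u s} → Adj H′ t u → 𝒯′.Induces t u s → FlipAt s (θ t) (θ u)
          θ-flip {t} {u} {s} tu ind = Flip-resp {s} (≐-sym (θ-≐ t)) (≐-sym (θ-≐ u)) (Towards-flip tu ind)

          θ-adj : ∀ {t u} → Adj H′ t u → Adj H (θ t) (θ u)
          θ-adj tu = let s , ind = edge-induces tu in s , θ-flip tu ind

          -- The label of the edge is in N, so some edge of the other tree induces it; since a label
          -- determines its ends, that edge starts at t and ends over j.
          θ-lift : ∀ {t j} → Adj H (θ t) j → ∃[ u ] Adj H′ t u × θ u ≡ j
          θ-lift {t} {j} (e , F) with proj₂ induced≐ (At.sub j {e} (proj₁ F))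
          ... | t₁ , t₂ , t₁t₂ , ind with θ-flip t₁t₂ ind
          ...   | F′ with θ-injective (FlipAt-uniqueˡ {e} F F′)
          ...     | refl = t₂ , t₁t₂ , sym (FlipAt-uniqueʳ {e} F F′)

          θ-surjective : ∀ j → ∃[ t ] θ t ≡ j
          θ-surjective j = go (t₀ , refl) (IsTree.connected (TreeDecomposition.isTree 𝒯) (θ t₀) j)
            where
            first : ∀ {m} → 0 < m → Fin m
            first (s≤s _) = zero
            t₀ = first (IsTree.nonempty 𝒯′.isTree)
            go : ∀ {i} → ∃[ t ] θ t ≡ i → Star (Adj H) i j → ∃[ t ] θ t ≡ j
            go found ε = found
            go (t , refl) (ij ◅ w) = let u , _ , eq = θ-lift ij in go (u , eq) w

        unique : 𝒯′ ≅[ ≅-refl ] 𝒯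
        unique = record
          { treeIso = record
            { bijection = mk↔ₛ′ θ (proj₁ ∘ θ-surjective) (proj₂ ∘ θ-surjective) (λ t → θ-injective (proj₂ (θ-surjective (θ t))))
            ; adj⇔ = λ t u → mk⇔ θ-adj λ tu → let u′ , tu′ , eq = θ-lift tu in subst (Adj H′ t) (θ-injective eq) tu′ }
          ; parts = θ-part }

-- Invariance of N_Σ

open Sums ℕ.+-0-commutativeMonoid using (sum; sum-permute; sum-cong-≗)

private
  indicator : ∀ {n} → Subset n → Fin n → ℕ
  indicator p i = if lookup p i then 1 else 0

  ∣p∣≡sum : ∀ {n} (p : Subset n) → ∣ p ∣ ≡ sum (indicator p)
  ∣p∣≡sum []          = refl
  ∣p∣≡sum (true ∷ p)  = cong suc (∣p∣≡sum p)
  ∣p∣≡sum (false ∷ p) = ∣p∣≡sum p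

  lookup-cong : ∀ {m n} {p : Subset m} {q : Subset n} {i j} → i ∈ p ⇔ j ∈ q → lookup p i ≡ lookup q j
  lookup-cong {p = p} {q} {i} {j} eq with lookup p i in pᵢ | lookup q j in qⱼ
  ... | true  | true  = refl
  ... | false | false = refl
  ... | true  | false = trans (sym (Vec.[]=⇒lookup (Equivalence.to eq (Vec.lookup⇒[]= i p pᵢ)))) qⱼ
  ... | false | true  = trans (sym pᵢ) (Vec.[]=⇒lookup (Equivalence.from eq (Vec.lookup⇒[]= j q qⱼ)))

-- Cardinality is written as a sum of indicators, which is invariant under permutation.
∣∣-bijection : ∀ {m n} (π : Fin m ↔ Fin n) {p : Subset m} {q : Subset n} →
               (∀ i → i ∈ p ⇔ Inverse.to π i ∈ q) → ∣ p ∣ ≡ ∣ q ∣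
∣∣-bijection π {p} {q} eq = begin
  ∣ p ∣                            ≡⟨ ∣p∣≡sum p ⟩
  sum (indicator p)                ≡⟨ sum-cong-≗ (λ i → cong (if_then 1 else 0) (lookup-cong (eq i))) ⟩
  sum (indicator q ∘ Inverse.to π) ≡⟨ sum-permute (indicator q) π ⟨
  sum (indicator q)                ≡⟨ ∣p∣≡sum q ⟨
  ∣ q ∣                            ∎
  where open ≡-Reasoning

module _ (φ : G ≅ G′) where

  private
    module φ = _≅_ φ
    from = Inverse.from φ.bijection
    to∘from : ∀ v → φ.to (from v) ≡ v
    to∘from = Inverse.strictlyInverseˡ φ.bijection

    _≈_ : Subset (∣V∣ G) → Subset (∣V∣ G′) → Set
    p ≈ p′ = ∀ v → v ∈ p ⇔ φ.to v ∈ p′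

  ≈-from : ∀ {p p′} → p ≈ p′ → ∀ v′ → v′ ∈ p′ ⇔ from v′ ∈ p
  ≈-from {p′ = p′} e v′ = mk⇔ (λ v∈ → Equivalence.from (e (from v′)) (subst (_∈ p′) (sym (to∘from v′)) v∈))
                               (λ v∈ → subst (_∈ p′) (to∘from v′) (Equivalence.to (e (from v′)) v∈))

  private
    to⊆ : ∀ {p q p′ q′} → p ≈ p′ → q ≈ q′ → p ⊆ q → p′ ⊆ q′
    to⊆ e f p⊆q {v′} v∈ = Equivalence.from (≈-from f v′) (p⊆q (Equivalence.to (≈-from e v′) v∈))

    from⊆ : ∀ {p q p′ q′} → p ≈ p′ → q ≈ q′ → p′ ⊆ q′ → p ⊆ q
    from⊆ e f p′⊆q′ {v} v∈ = Equivalence.from (f v) (p′⊆q′ (Equivalence.to (e v) v∈))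

    image? : ∀ p v′ → Dec (from v′ ∈ p)
    image? p v′ = from v′ ∈? p

    preimage? : ∀ p′ v → Dec (φ.to v ∈ p′)
    preimage? p′ v = φ.to v ∈? p′

    from∘to : ∀ v → from (φ.to v) ≡ v
    from∘to = Inverse.strictlyInverseʳ φ.bijection

    separation⇒ : ∀ {p p′ q q′} → p ≈ p′ → q ≈ q′ → IsSeparation G (p , q) → IsSeparation G′ (p′ , q′)
    separation⇒ {p} {p′} {q} {q′} e f sep = mkSeparation G′ (p′ , q′)
      (λ v′ → Sum.map (Equivalence.from (≈-from e v′)) (Equivalence.from (≈-from f v′)) (sep-cover G (p , q) sep (from v′)))
      λ u′ v′ u′v′ → Sum.map
        (λ (a , b) → Equivalence.from (≈-from e u′) a , Equivalence.from (≈-from e v′) b)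
        (λ (a , b) → Equivalence.from (≈-from f u′) a , Equivalence.from (≈-from f v′) b)
        (sep-edge G (p , q) sep (from u′) (from v′)
          (Equivalence.from (φ.adj⇔ (from u′) (from v′)) (subst₂ (Adj G′) (sym (to∘from u′)) (sym (to∘from v′)) u′v′)))

    separation⇐ : ∀ {p p′ q q′} → p ≈ p′ → q ≈ q′ → IsSeparation G′ (p′ , q′) → IsSeparation G (p , q)
    separation⇐ {p} {p′} {q} {q′} e f sep = mkSeparation G (p , q)
      (λ v → Sum.map (Equivalence.from (e v)) (Equivalence.from (f v)) (sep-cover G′ (p′ , q′) sep (φ.to v)))
      λ u v uv → Sum.map
        (λ (a , b) → Equivalence.from (e u) a , Equivalence.from (e v) b)
        (λ (a , b) → Equivalence.from (f u) a , Equivalence.from (f v) b)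
        (sep-edge G′ (p′ , q′) sep (φ.to u) (φ.to v) (Equivalence.to (φ.adj⇔ u v) uv))

  isomorphism : Correspondence G G′
  isomorphism = record
    { _≈_ = _≈_
    ; to = λ p → subsetOf (image? p)
    ; to≈ = λ p v → mk⇔ (λ v∈ → ∈-subsetOf⁺ (image? p) (subst (_∈ p) (sym (from∘to v)) v∈))
                        (λ v∈ → subst (_∈ p) (from∘to v) (∈-subsetOf⁻ (image? p) v∈))
    ; from = λ p′ → subsetOf (preimage? p′)
    ; from≈ = λ p′ v → mk⇔ (∈-subsetOf⁻ (preimage? p′)) (∈-subsetOf⁺ (preimage? p′))
    ; functional = λ e f → ⊆-antisym (to⊆ e f id) (to⊆ f e id)
    ; injective = λ e f → ⊆-antisym (from⊆ e f id) (from⊆ f e id)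
    ; ⊆⇒ = to⊆ ; ⊆⇐ = from⊆
    ; ∩-cong = λ {p} {p′} {q} {q′} e f v → mk⇔
        (λ v∈ → let a , b = x∈p∩q⁻ p q v∈ in x∈p∩q⁺ (Equivalence.to (e v) a , Equivalence.to (f v) b))
        (λ v∈ → let a , b = x∈p∩q⁻ p′ q′ v∈ in x∈p∩q⁺ (Equivalence.from (e v) a , Equivalence.from (f v) b))
    ; ∪-cong = λ {p} {p′} {q} {q′} e f v → mk⇔
        (λ v∈ → x∈p∪q⁺ (Sum.map (Equivalence.to (e v)) (Equivalence.to (f v)) (x∈p∪q⁻ p q v∈)))
        (λ v∈ → x∈p∪q⁺ (Sum.map (Equivalence.from (e v)) (Equivalence.from (f v)) (x∈p∪q⁻ p′ q′ v∈)))
    ; ∣∣-cong = ∣∣-bijection φ.bijection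
    ; sep⇒ = separation⇒ ; sep⇐ = separation⇐ }

module _ (c : Correspondence G G′) where
  open Correspondence c

  order<-fwd : ∀ {ℓ} → Fwd c (λ s → sepOrder s < ℓ) (λ s → sepOrder s < ℓ)
  order<-fwd s s′ e = subst (_< _) (order-cong e)

  proper-fwd : Fwd c IsProper IsProper
  proper-fwd s s′ (a , b) (A⊈B , B⊈A) = A⊈B ∘ ⊆⇐ a b , B⊈A ∘ ⊆⇐ b a

  kprofile-fwd : ∀ {k} → FamFwd c (KProfiles G k) (KProfiles G′ k)
  kprofile-fwd {k} P P′ (f , g) prof = record
    { isProfile = record
      { separations = λ s′ P′s′ → let a , b = fromₛ≈ s′ in sep⇒ a b (separations _ (back s′ P′s′))
      ; consistent = consistent-fwd c {⟦ P ⟧} {⟦ P′ ⟧} (f , g) consistent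
      ; profile = λ A B C D P′s P′r P′t →
          profile _ _ _ _ (back (A , B) P′s) (back (C , D) P′r)
            (g _ _ (∩-cong (from≈ B) (from≈ D) , ∪-cong (from≈ A) (from≈ C)) P′t) }
    ; order< = λ s′ P′s′ → subst (_< k) (order-cong (fromₛ≈ s′)) (order< _ (back s′ P′s′))
    ; exactlyOne = λ s′ sep lt → let e@(a , b) = fromₛ≈ s′ in
        Sum.map (λ (p , ¬p) → f _ _ e p , ¬p ∘ g _ _ (swap e)) (λ (¬p , p) → ¬p ∘ g _ _ e , f _ _ (swap e) p)
          (exactlyOne _ (sep⇐ a b sep) (subst (_< k) (sym (order-cong e)) lt)) }
    where
    open IsKProfile prof
    open IsProfile isProfile
    back : ∀ s′ → ⟦ P′ ⟧ s′ → ⟦ P ⟧ (fromₛ s′)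
    back s′ = g s′ _ (fromₛ≈ s′)

kprofile-rel : (c : Correspondence G G′) → ∀ k → FamRel c (KProfiles G k) (KProfiles G′ k)
kprofile-rel c k = kprofile-fwd c , kprofile-fwd (flip c)

order<-rel : (c : Correspondence G G′) → ∀ ℓ → Rel c (λ s → sepOrder s < ℓ) (λ s → sepOrder s < ℓ)
order<-rel c ℓ = order<-fwd c , order<-fwd (flip c)

truncate-fwd : (c : Correspondence G G′) → ∀ ℓ {𝒫 𝒫′} → FamRel c 𝒫 𝒫′ → FamFwd c (truncate ℓ 𝒫) (truncate ℓ 𝒫′)
truncate-fwd c ℓ R𝒫 Q Q′ RQ (P , 𝒫P , eq) = push c P , proj₁ R𝒫 P _ (push-rel c P) 𝒫P ,
  ≐-fwd c RQ (∩-rel c {⟦ P ⟧} {λ s → sepOrder s < ℓ} {⟦ push c P ⟧} {λ s → sepOrder s < ℓ} (push-rel c P) (order<-rel c ℓ)) eq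

extend-fwd : (c : Correspondence G G′) → ∀ ℓ {N N′} σ {𝒫 𝒫′} → Rel c N N′ → FamRel c 𝒫 𝒫′ →
             Fwd c (extend G ℓ N σ 𝒫) (extend G′ ℓ N′ σ 𝒫′)
extend-fwd {G} {G′} c ℓ {N} {N′} σ {𝒫} {𝒫′} N-rel R𝒫 s s′ e =
  Sum.map (proj₁ N-rel s s′ e)
    λ (O , con , d) → push c O , consOrient-fwd c N-rel O _ (push-rel c O) con ,
      Nσ-fwd c σ (splitters-rel c O (push c O) (S-fwd c N-rel , S-fwd (flip c) (swap N-rel)) (push-rel c O))
        (inducing-rel c {N} {N′} {𝒫} {𝒫′} O (push c O) R𝒫 N-rel (push-rel c O)) s s′ e d
  where
  S-fwd : ∀ {G G′} (c : Correspondence G G′) {N N′} → Rel c N N′ →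
          Fwd c (λ s → IsSeparation G s × IsProper s × sepOrder s ≡ ℓ × NestedWith N s)
                (λ s → IsSeparation G′ s × IsProper s × sepOrder s ≡ ℓ × NestedWith N′ s)
  S-fwd c RN s s′ e@(a , b) (sep , pr , o≡ , nst) =
    Correspondence.sep⇒ c a b sep , proper-fwd c s s′ e pr , trans (sym (Correspondence.order-cong c e)) o≡ , nestedWith-fwd c RN s s′ e nst

NΣ-fwd : (c : Correspondence G G′) → ∀ k (σs : KStrategy k) {𝒫 𝒫′} → FamRel c 𝒫 𝒫′ → Fwd c (NΣ G k σs 𝒫) (NΣ G′ k σs 𝒫′)
NΣ-fwd c zero σs R𝒫 s s′ e ()
NΣ-fwd c (suc zero) σs R𝒫 = Nσ-fwd c (proj₁ (last σs)) (S-fwd c , S-fwd (flip c)) R𝒫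
  where
  S-fwd : ∀ {G G′} (c : Correspondence G G′) →
          Fwd c (λ s → IsSeparation G s × IsProper s × sepOrder s < 1) (λ s → IsSeparation G′ s × IsProper s × sepOrder s < 1)
  S-fwd c s s′ e@(a , b) (sep , pr , lt) = Correspondence.sep⇒ c a b sep , proper-fwd c s s′ e pr , order<-fwd c s s′ e lt
NΣ-fwd c (suc (suc j)) σs R𝒫 = extend-fwd c (suc j) (proj₁ (last σs))
  ( NΣ-fwd c (suc j) (init σs) (truncate-fwd c (suc j) R𝒫 , truncate-fwd (flip c) (suc j) (swap R𝒫))
  , NΣ-fwd (flip c) (suc j) (init σs) (truncate-fwd (flip c) (suc j) (swap R𝒫) , truncate-fwd c (suc j) R𝒫)) R𝒫

NΣ-rel : (c : Correspondence G G′) → ∀ k (σs : KStrategy k) {𝒫 𝒫′} → FamRel c 𝒫 𝒫′ → Rel c (NΣ G k σs 𝒫) (NΣ G′ k σs 𝒫′)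
NΣ-rel c k σs R𝒫 = NΣ-fwd c k σs R𝒫 , NΣ-fwd (flip c) k σs (swap R𝒫)

-- Transport of tree-decompositions along isomorphisms

module _ (φ : G ≅ G′) (𝒯 : TreeDecomposition G) where

  private
    module φ = _≅_ φ
    module 𝒯 = TreeDecomposition 𝒯
    module c = Correspondence (isomorphism φ)
    from = Inverse.from φ.bijection
    at : ∀ t v′ → v′ ∈ c.to (𝒯.part t) ⇔ from v′ ∈ 𝒯.part t
    at t = ≈-from φ (c.to≈ (𝒯.part t))

  -- The nodes constructed for G and for G′ are listed in orders that depend on the numbering of the
  -- vertices. Moving the parts along φ over an unchanged tree leaves the comparison of the two
  -- trees to uniqueness.
  relabel : TreeDecomposition G′
  relabel = record
    { tree = 𝒯.tree ; isTree = 𝒯.isTree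
    ; part = c.to ∘ 𝒯.part
    ; coverVertex = λ v′ → let t , v∈ = 𝒯.coverVertex (from v′) in t , Equivalence.from (at t v′) v∈
    ; coverEdge = λ u′ v′ u′v′ →
        let t , u∈ , v∈ = 𝒯.coverEdge (from u′) (from v′) (Equivalence.from (φ.adj⇔ _ _)
              (subst₂ (Adj G′) (sym (Inverse.strictlyInverseˡ φ.bijection u′)) (sym (Inverse.strictlyInverseˡ φ.bijection v′)) u′v′))
        in t , Equivalence.from (at t u′) u∈ , Equivalence.from (at t v′) v∈
    ; onPath = λ w p t₂ t₂∈ → c.⊆⇒ (c.∩-cong (c.to≈ _) (c.to≈ _)) (c.to≈ _) (𝒯.onPath w p t₂ t₂∈) }

  private
    module 𝒯′ = TreeDecomposition relabel

  Induces-fwd : ∀ {t₁ t₂ s s′} → s c.≈ₛ s′ → 𝒯.Induces t₁ t₂ s → 𝒯′.Induces t₁ t₂ s′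
  Induces-fwd (a , b) (A , B) = (λ v′ → convert a A v′) , (λ v′ → convert b B v′)
    where
    convert : ∀ {p p′} {Q : 𝒯.Node → Set} → p c.≈ p′ → (∀ v → v ∈ p ⇔ (∃[ t ] Q t × v ∈ 𝒯.part t)) →
              ∀ v′ → v′ ∈ p′ ⇔ (∃[ t ] Q t × v′ ∈ 𝒯′.part t)
    convert e h v′ = mk⇔
      (λ v∈ → let t , q , v∈t = Equivalence.to (h (from v′)) (Equivalence.to (≈-from φ e v′) v∈) in t , q , Equivalence.from (at t v′) v∈t)
      (λ (t , q , v∈t) → Equivalence.from (≈-from φ e v′) (Equivalence.from (h (from v′)) (t , q , Equivalence.to (at t v′) v∈t)))

  Induces-bwd : ∀ {t₁ t₂ s s′} → s c.≈ₛ s′ → 𝒯′.Induces t₁ t₂ s′ → 𝒯.Induces t₁ t₂ s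
  Induces-bwd (a , b) (A , B) = (λ v → convert a A v) , (λ v → convert b B v)
    where
    convert : ∀ {p p′} {Q : 𝒯.Node → Set} → p c.≈ p′ → (∀ v′ → v′ ∈ p′ ⇔ (∃[ t ] Q t × v′ ∈ 𝒯′.part t)) →
              ∀ v → v ∈ p ⇔ (∃[ t ] Q t × v ∈ 𝒯.part t)
    convert e h v = mk⇔
      (λ v∈ → let t , q , v∈t = Equivalence.to (h (φ.to v)) (Equivalence.to (e v) v∈) in t , q , Equivalence.from (c.to≈ (𝒯.part t) v) v∈t)
      (λ (t , q , v∈t) → Equivalence.from (e v) (Equivalence.from (h (φ.to v)) (t , q , Equivalence.to (c.to≈ (𝒯.part t) v) v∈t)))

  relabel-induces : ∀ {N N′} → Rel (isomorphism φ) N N′ → InducesExactly 𝒯 N → InducesExactly relabel N′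
  relabel-induces (f , g) exact = record
    { induced≐ = (λ {s′} (t₁ , t₂ , adj , ind) → f _ s′ (c.fromₛ≈ s′) (proj₁ induced≐ (t₁ , t₂ , adj , Induces-bwd {t₁} {t₂} (c.fromₛ≈ s′) ind)))
               , (λ {s′} N′s′ → let t₁ , t₂ , adj , ind = proj₂ induced≐ (g s′ _ (c.fromₛ≈ s′) N′s′)
                                in t₁ , t₂ , adj , Induces-fwd {t₁} {t₂} (c.fromₛ≈ s′) ind)
    ; distinctParts = λ eq → distinctParts (c.injective (c.to≈ _) (subst (_ c.≈_) (sym eq) (c.to≈ _)))
    ; distinctSeps = λ {t₁} {t₂} {u₁} {u₂} {s′} adj adj′ ind ind′ →
        distinctSeps adj adj′ (Induces-bwd {t₁} {t₂} (c.fromₛ≈ s′) ind) (Induces-bwd {u₁} {u₂} (c.fromₛ≈ s′) ind′) }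
    where open InducesExactly exact

  relabel-iso : ∀ {𝒯″} → relabel ≅[ ≅-refl ] 𝒯″ → 𝒯 ≅[ φ ] 𝒯″
  relabel-iso iso = record
    { treeIso = treeIso
    ; parts = λ t v → mk⇔ (Equivalence.to (parts t (φ.to v)) ∘ Equivalence.to (c.to≈ (𝒯.part t) v))
                          (Equivalence.from (c.to≈ (𝒯.part t) v) ∘ Equivalence.from (parts t (φ.to v))) }
    where open _≅[_]_ iso

-- Blocks and tangles

module BlocksAndTangles (G : Graph) (k : ℕ) where

  open Tasks G
  open Levels G

  private
    ∣G∣ = ∣V∣ G

  IsKProfile? : U.Decidable (KProfiles G k)
  IsKProfile? P = map′ to from
    ( (∀Sep? λ s → P? s →-dec IsSeparation? G s) ×-dec (Consistent? P? ×-dec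
    ( (∀Sep? λ s → ∀Sep? λ r → P? s →-dec (P? r →-dec ¬? (P? (swap (s ∨ₛ r))))) ×-dec
    ( (∀Sep? λ s → P? s →-dec (sepOrder s ℕ.<? k)) ×-dec
      (∀Sep? λ s → IsSeparation? G s →-dec ((sepOrder s ℕ.<? k) →-dec
        ((P? s ×-dec ¬? (P? (swap s))) ⊎-dec (¬? (P? s) ×-dec P? (swap s)))))))))
    where
    P? : U.Decidable ⟦ P ⟧
    P? s = T? (P s)
    Conditions : Set
    Conditions = (∀ s → ⟦ P ⟧ s → IsSeparation G s) × Consistent G ⟦ P ⟧ ×
      (∀ s r → ⟦ P ⟧ s → ⟦ P ⟧ r → ¬ ⟦ P ⟧ (swap (s ∨ₛ r))) × (∀ s → ⟦ P ⟧ s → sepOrder s < k) ×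
      (∀ s → IsSeparation G s → sepOrder s < k → ExactlyOne (⟦ P ⟧ s) (⟦ P ⟧ (swap s)))
    to : Conditions → IsKProfile G k ⟦ P ⟧
    to (a , b , c , d , e) = record
      { isProfile = record { separations = a ; consistent = b ; profile = λ A B C D → c (A , B) (C , D) } ; order< = d ; exactlyOne = e }
    from : IsKProfile G k ⟦ P ⟧ → Conditions
    from p = separations , consistent , (λ (A , B) (C , D) → profile A B C D) , order< , exactlyOne
      where
      open IsKProfile p
      open IsProfile isProfile

  kprofile-family : KFamily k (KProfiles G k)
  kprofile-family = record
    { 𝒫? = IsKProfile?
    ; 𝒫-ext = λ P Q eq → kprofile-fwd (identity G) P Q (≐⇒Rel eq)
    ; kprofiles = λ _ → id }

  kprofile-resp : ∀ {P Q} → P U.≐ Q → IsKProfile G k P → IsKProfile G k Q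
  kprofile-resp (f , g) p = record
    { isProfile = record
      { separations = λ s → separations s ∘ g
      ; consistent = λ s r Qs sep r≤s → consistent s r (g Qs) sep r≤s ∘ g
      ; profile = λ A B C D Qs Qr → profile A B C D (g Qs) (g Qr) ∘ g }
    ; order< = λ s → order< s ∘ g
    ; exactlyOne = λ s sep lt → Sum.map (λ (a , b) → f a , b ∘ g) (λ (a , b) → a ∘ g , f b) (exactlyOne s sep lt) }
    where
    open IsKProfile p
    open IsProfile isProfile

  too-large : ∀ {b} (s : Sep ∣G∣) → k ≤ ∣ b ∣ → sepOrder s < k → b ⊆ proj₁ s → ¬ b ⊆ proj₂ s
  too-large s k≤ lt ⊆A ⊆B = ℕ.<⇒≱ lt (ℕ.≤-trans k≤ (p⊆q⇒∣p∣≤∣q∣ λ v∈ → x∈p∩q⁺ (⊆A v∈ , ⊆B v∈)))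

  blockProfile-kprofile : ∀ {b} → k ≤ ∣ b ∣ → Inseparable G k b → IsKProfile G k (blockProfile G k b)
  blockProfile-kprofile {b} k≤ insep = record
    { isProfile = record
      { separations = λ _ → proj₁
      ; consistent = λ s r (_ , _ , ⊆B) _ (_ , B⊆D) (_ , lt , ⊆C) → too-large (swap r) k≤ lt (B⊆D ∘ ⊆B) ⊆C
      ; profile = λ A B C D (_ , _ , ⊆B) (_ , _ , ⊆D) (_ , lt , ⊆A∪C) →
          too-large (B ∩ D , A ∪ C) k≤ lt (λ v∈ → x∈p∩q⁺ (⊆B v∈ , ⊆D v∈)) ⊆A∪C }
    ; order< = λ _ → proj₁ ∘ proj₂
    ; exactlyOne = λ s sep lt →
        [ (λ ⊆A → inj₂ ((λ (_ , _ , ⊆B) → too-large s k≤ lt ⊆A ⊆B) , swap-separation G s sep , swap< s lt , ⊆A))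
        , (λ ⊆B → inj₁ ((sep , lt , ⊆B) , λ (_ , _ , ⊆A) → too-large s k≤ lt ⊆A ⊆B)) ]′
          (insep (proj₁ s) (proj₂ s) sep lt) }

  -- Each violation yields a forbidden cover: s below which r lies, with the inverse of r counted
  -- twice, for consistency; and A, C, B ∩ D for the profile property.
  tangle-kprofile : ∀ {θ} → IsTangle G k θ → IsKProfile G k θ
  tangle-kprofile {θ} tangle = record
    { isProfile = record
      { separations = λ s → proj₁ ∘ separations s
      ; consistent = λ s r θs sep (C⊆A , _) θr → noCover _ _ _ _ _ _ θs θr θr
          (covers (λ v → [ (λ c → inj₁ (C⊆A c)) , inj₂ ∘ inj₁ ]′ (sep-cover G r sep v))
                  (λ u v uv → [ (λ (a , b) → inj₁ (C⊆A a , C⊆A b)) , inj₂ ∘ inj₁ ]′ (sep-edge G r sep u v uv)))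
      ; profile = λ A B C D θs θr θt →
          let sep₁ = proj₁ (separations _ θs) ; sep₂ = proj₁ (separations _ θr) in noCover _ _ _ _ _ _ θs θr θt
          (covers (λ v → [ inj₁ , (λ b → [ inj₂ ∘ inj₁ , (λ d → inj₂ (inj₂ (x∈p∩q⁺ (b , d)))) ]′ (sep-cover G (C , D) sep₂ v)) ]′
                           (sep-cover G (A , B) sep₁ v))
                  (λ u v uv → [ inj₁ , (λ (b , b′) → [ inj₂ ∘ inj₁ , (λ (d , d′) → inj₂ (inj₂ (x∈p∩q⁺ (b , d) , x∈p∩q⁺ (b′ , d′)))) ]′
                           (sep-edge G (C , D) sep₂ u v uv)) ]′ (sep-edge G (A , B) sep₁ u v uv))) }
    ; order< = λ s → proj₂ ∘ separations s
    ; exactlyOne = exactlyOne }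
    where
    open IsTangle tangle
    covers : ∀ {A₁ A₂ A₃} → (∀ v → v ∈ A₁ ⊎ v ∈ A₂ ⊎ v ∈ A₃) →
             (∀ u v → Adj G u v → (u ∈ A₁ × v ∈ A₁) ⊎ (u ∈ A₂ × v ∈ A₂) ⊎ (u ∈ A₃ × v ∈ A₃)) → Covers G A₁ A₂ A₃
    covers cover edge = ⊆-antisym ⊆⊤ (λ {v} _ → x∈p∪q⁺ (Sum.map₂ x∈p∪q⁺ (cover v))) , edge

  blockProfile? : ∀ b → U.Decidable (blockProfile G k b)
  blockProfile? b s = IsSeparation? G s ×-dec ((sepOrder s ℕ.<? k) ×-dec (b ⊆? proj₂ s))

  -- The given P is an arbitrary predicate, whereas families of profiles consist of Boolean sets.
  -- For a tangle, decidability comes from its containing exactly one orientation of each small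
  -- separation.
  decidable-profile : ∀ {P} → IsBlockProfileOrTangle G k P → U.Decidable P × IsKProfile G k P
  decidable-profile (inj₁ (b , block , (f , g))) =
    (λ s → map′ g f (blockProfile? b s)) , kprofile-resp (g , f) (blockProfile-kprofile (IsBlock.size block) (IsBlock.inseparable block))
  decidable-profile {P} (inj₂ tangle) = dec , tangle-kprofile tangle
    where
    open IsTangle tangle
    dec : U.Decidable P
    dec s with IsSeparation? G s ×-dec (sepOrder s ℕ.<? k)
    ... | no ¬p = no (¬p ∘ separations s)
    ... | yes (sep , lt) = [ yes ∘ proj₁ , no ∘ proj₁ ]′ (exactlyOne s sep lt)

  distinguish : ∀ {N} → Good k N (KProfiles G k) → ∀ P P′ → IsBlockProfileOrTangle G k P → IsBlockProfileOrTangle G k P′ →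
                ¬ (P U.≐ P′) → ∃[ s ] N s × Distinguishes s P P′
  distinguish good P P′ p p′ P≢P′ with decidable-profile p | decidable-profile p′
  ... | P? , prof | P′? , prof′
    with Good.distinguishes good (decSet P?) (decSet P′?) (kprofile-resp (≐-sym (decSet-≐ P?)) prof) (kprofile-resp (≐-sym (decSet-≐ P′?)) prof′)
  ...   | inj₁ eq = ⊥-elim (P≢P′ (≐-trans (≐-sym (decSet-≐ P?)) (≐-trans eq (decSet-≐ P′?))))
  ...   | inj₂ (s , Ns , Ps , P′s) = s , Ns , Dist⇒Distinguishes (IsKProfile.isProfile prof) (IsKProfile.isProfile prof′)
            (decSet⁻ P? Ps , decSet⁻ P′? P′s)

  -- With equal profiles the two blocks always lie on the same side, so their union is inseparable
  -- and by maximality equals both.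
  blocks-equal : ∀ {b b′} → IsBlock G k b → IsBlock G k b′ → blockProfile G k b U.≐ blockProfile G k b′ → b ≡ b′
  blocks-equal {b} {b′} block block′ (f , g) = trans (sym (B.maximal (b ∪ b′) size insep (p⊆p∪q b′))) (B′.maximal (b ∪ b′) size insep (q⊆p∪q b b′))
    where
    module B = IsBlock block
    module B′ = IsBlock block′
    size : k ≤ ∣ b ∪ b′ ∣
    size = ℕ.≤-trans B.size (∣p∣≤∣p∪q∣ b b′)
    union⊆ : ∀ {A} → b ⊆ A → b′ ⊆ A → b ∪ b′ ⊆ A
    union⊆ ⊆A ⊆A′ v∈ = [ ⊆A , ⊆A′ ]′ (x∈p∪q⁻ b b′ v∈)
    insep : Inseparable G k (b ∪ b′)
    insep A B sep lt = Sum.map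
      (λ (⊆A : b ⊆ A) → union⊆ {A} ⊆A (proj₂ (proj₂ (f {B , A} (swap-separation G (A , B) sep , swap< (A , B) lt , ⊆A)))))
      (λ (⊆B : b ⊆ B) → union⊆ {B} ⊆B (proj₂ (proj₂ (f {A , B} (sep , lt , ⊆B))))) (B.inseparable A B sep lt)

-- The decomposition defined by a k-strategy

module _ {k : ℕ} (σs : KStrategy (suc k)) (G : Graph) where

  open Levels G
  open DistinctParts G
  open Trees G
  open BlocksAndTangles G (suc k)
  open Uniqueness G

  private
    N = NΣ G (suc k) σs (KProfiles G (suc k))

    good : Good (suc k) N (KProfiles G (suc k))
    good = NΣ-good k σs kprofile-family

    system : NestedSystem N
    system = record { Good good }

    open FromSystem system

    abstract
      nodes : Enumeration IsOri (allDecSepSets (∣V∣ G))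
      nodes = enumerate IsOri? (allDecSepSets (∣V∣ G))

  treeOf : TreeDecomposition G
  treeOf = OnNodes.𝒯 nodes

  treeOf-defined : Defines σs G treeOf
  treeOf-defined = OnNodes.𝒯-induces nodes (distinct-parts kprofile-family good)

  treeOf-unique : ∀ 𝒯 → Defines σs G 𝒯 → 𝒯 ≅[ ≅-refl ] treeOf
  treeOf-unique 𝒯 exact = unique 𝒯 system exact nodes

  treeOf-adhesion : adhesion treeOf < suc k
  treeOf-adhesion = OnNodes.𝒯-adhesion nodes (s≤s z≤n) (Good.order< good)

  treeOf-distinguishes : DistinguishesBlocksAndTangles (suc k) treeOf
  treeOf-distinguishes = dist , λ b b′ block block′ b≢b′ →
      dist _ _ (inj₁ (b , block , id , id)) (inj₁ (b′ , block′ , id , id)) (b≢b′ ∘ blocks-equal block block′)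
    where
    dist : ∀ P P′ → IsBlockProfileOrTangle G (suc k) P → IsBlockProfileOrTangle G (suc k) P′ → ¬ (P U.≐ P′) →
           ∃[ s ] induced treeOf s × Distinguishes s P P′
    dist P P′ p p′ P≢P′ = let s , Ns , d = distinguish good P P′ p p′ P≢P′
                          in s , proj₂ (InducesExactly.induced≐ treeOf-defined) Ns , d

treeOf-canonical : ∀ {k} (σs : KStrategy (suc k)) → IsCanonical (treeOf σs)
treeOf-canonical {k} σs {G} {G′} φ = relabel-iso φ (treeOf σs G) (treeOf-unique σs G′ (relabel φ (treeOf σs G))
  (relabel-induces φ (treeOf σs G) (NΣ-rel c (suc k) σs (kprofile-rel c (suc k))) (treeOf-defined σs G)))
  where c = isomorphism φ

-- Instantiates the existence clause; any strategy made of reduced operations would serve.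
always-allᵣ : Strategy
always-allᵣ = record { op = λ _ → allᵣ ; infinitely = λ m → m , ℕ.≤-refl , tt }

theorem4p5 : ∀ (k : ℕ) → 1 ≤ k →
    (∀ (σs : KStrategy k) →
    ∃[ τ ]
    (∀ G → Defines σs G (τ G) ×
    (∀ 𝒯 → Defines σs G 𝒯 → 𝒯 ≅[ ≅-refl ] τ G)) ×
    IsCanonical τ ×
    (∀ G → adhesion (τ G) < k × DistinguishesBlocksAndTangles k (τ G))) ×
    (∃[ τ ]
    IsCanonical τ ×
    (∀ G → adhesion (τ G) < k × DistinguishesBlocksAndTangles k (τ G)))
theorem4p5 (suc k) _ =
  (λ σs → treeOf σs , (λ G → treeOf-defined σs G , treeOf-unique σs G) , treeOf-canonical σs ,
          λ G → treeOf-adhesion σs G , treeOf-distinguishes σs G) ,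
  treeOf σ₀ , treeOf-canonical σ₀ , λ G → treeOf-adhesion σ₀ G , treeOf-distinguishes σ₀ G
  where
  σ₀ : KStrategy (suc k)
  σ₀ _ = always-allᵣ , λ _ → tt
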